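{- Fix $k,N,M\in\mathbb{N}$ with $N\le M$, and write $G_{k,N,M}(x)=\sum_{n\ge0}c_{k,N,M}(n)x^n$. Define $$\Delta_{k,N,M}:=(k+1)N(M-1)+N-M$$ and $$\Lambda_{k,N,M}:=\operatorname{lcm}\Bigl(\{(k+1)j+1:0\le j<M\}\cup\{2(k+1)i-2:1\le i\le N\}\Bigr).$$ There exist polynomials $Q_0(X),Q_1(X),\ldots,Q_{\Lambda_{k,N,M}-1}(X)\in\mathbb{Q}[X]$ of degree at most $M-1$ such that $c_{k,N,M}(n)=Q_r(n)$ whenever $n>\Delta_{k,N,M}$ and $n\equiv r\pmod{\Lambda_{k,N,M}}$. Moreover: (i) If $M>N$, every $Q_r$ has leading coefficient $$\frac{2^{M-1}}{(M-1)!\prod_{j=0}^{M-1}((k+1)j+1)}.$$ (ii) If $M=N\ge2$ and $k$ is even, every $Q_r$ has leading coefficient $$\frac{2^{N-1}}{(N-1)!\prod_{j=0}^{N-1}((k+1)j+1)}.$$ (iii) If $M=N\ge2$ and $k>1$ is odd, the leading coefficient in parity class $r$ (that is, of $Q_r$, depending only on the parity of $r$) is $$\frac{1}{(N-1)!}\left(\frac{2^{N-1}}{\prod_{j=0}^{N-1}((k+1)j+1)}+(-1)^r\frac{2^{N-1}}{\prod_{i=1}^{N}((k+1)i-1)}\right),$$ and this number is positive for both parities. Consequently, every fixed finite product $G_{k,N,M}(x)$ (with $k,N,M\in\mathbb{N}$, $N\le M$) is eventually strictly positive, i.e. $c_{k,N,M}(n)>0$ for all sufficiently large $n$, except that when $M=N$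 and $k=1$, every odd-degree coefficient is zero and every even-degree coefficient is positive.
   Context: $\mathbb{N}$ is the set of positive integers. Notation: $(z;q)_n=\prod_{i=0}^{n-1}(1-zq^i)$. For $k,N,M\in\mathbb{N}$, $$G_{k,N,M}(x):=\frac{(-x^{k+1};x^{k+1})_{N+M-1}}{(-x^{k};x^{k+1})_N\,(x;x^{k+1})_M}=\frac{\prod_{r=1}^{N+M-1}(1+x^{(k+1)r})}{\prod_{i=1}^{N}(1+x^{(k+1)i-1})\prod_{j=0}^{M-1}(1-x^{(k+1)j+1})},$$ expanded as a formal power series in $x$.
   Formalization: The closing eventual-positivity claim is stated for M ≥ 2 only: for M = N = 1 and k ≥ 2 it is false, since G = x/(1-x) + 1/(1+x^k) has zero coefficient at every odd multiple of k. -}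

module Defs where

open import Algebra.Bundles.Raw using (RawRing)
import Algebra.Definitions.RawSemiring as RawSemiringDefs
open import Data.Fin.Base as Fin using (Fin; toℕ)
open import Data.Integer.Base as ℤ using (ℤ; +_)
open import Data.List.Base as List using (List; []; _∷_; _++_; applyUpTo)
open import Data.Nat.Base as ℕ using (ℕ; zero; suc; NonZero; _∸_; _!)
open import Data.Nat.Divisibility using (_∣_)
open import Data.Nat.LCM using (lcm)
import Data.Nat.Properties as ℕ
open import Data.Product.Base using (_×_; _,_)
open import Data.Rational.Base as ℚ using (ℚ; 0ℚ; 1ℚ)
import Data.Rational.Properties as ℚ
import Data.Vec.Functional as Vector
open import Algebra.Properties.CommutativeMonoid.Sum ℚ.+-0-commutativeMonoid
  using (sum; sum-cong-≗)
open import Level using (0ℓ)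
open import Relation.Binary.PropositionalEquality

------------------------------------------------------------------------
-- Formal power series over ℚ, as coefficient sequences

PowerSeries : Set
PowerSeries = ℕ → ℚ

module Series where

  infixl 7 _*_ _÷_
  infixl 6 _+_ _-_
  infix  8 -_

  0# 1# x : PowerSeries
  0# _ = 0ℚ

  1# zero    = 1ℚ
  1# (suc _) = 0ℚ

  x zero          = 0ℚ
  x (suc zero)    = 1ℚ
  x (suc (suc _)) = 0ℚ

  _+_ _-_ _*_ : PowerSeries → PowerSeries → PowerSeries
  (f + g) n = f n ℚ.+ g n
  (f - g) n = f n ℚ.- g n
  (f * g) n = sum {suc n} λ i → f (toℕ i) ℚ.* g (n ∸ toℕ i)

  -_ : PowerSeries → PowerSeries
  (- f) n = ℚ.- f n

  rawRing : RawRing 0ℓ 0ℓ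
  rawRing = record
    { Carrier = PowerSeries
    ; _≈_     = _≗_
    ; _+_     = _+_
    ; _*_     = _*_
    ; -_      = -_
    ; 0#      = 0#
    ; 1#      = 1#
    }

  open RawSemiringDefs (RawRing.rawSemiring rawRing) public
    using (_^_; product)

  -- The quotient f ÷ g is meaningful only when g has constant term 1
  -- (see ÷-correct); its coefficients then satisfy
  --   h n = f n - Σ_{i<n} g (1 + i) · h (n - 1 - i).
  -- The vector  quotients f g n  lists h (n - 1), …, h 0 in this order.

  nextQuotient : (f g : PowerSeries) (n : ℕ) → Vector.Vector ℚ n → ℚ
  nextQuotient f g n hs = f n ℚ.- sum λ i → g (suc (toℕ i)) ℚ.* hs i

  quotients : (f g : PowerSeries) (n : ℕ) → Vector.Vector ℚ n
  quotients f g zero    = Vector.[]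
  quotients f g (suc n) = nextQuotient f g n (quotients f g n) Vector.∷ quotients f g n

  _÷_ : PowerSeries → PowerSeries → PowerSeries
  (f ÷ g) n = nextQuotient f g n (quotients f g n)

  quotients-lookup : ∀ f g n (i : Fin n) →
                     quotients f g n i ≡ (f ÷ g) (n ∸ suc (toℕ i))
  quotients-lookup f g (suc n) Fin.zero    = refl
  quotients-lookup f g (suc n) (Fin.suc i) = quotients-lookup f g n i

  ÷-correct : ∀ f g → g 0 ≡ 1ℚ → g * (f ÷ g) ≗ f
  ÷-correct f g g₀≡1 n = begin
    g 0 ℚ.* (f ÷ g) n ℚ.+ S′     ≡⟨ cong (λ a → a ℚ.* (f ÷ g) n ℚ.+ S′) g₀≡1 ⟩
    1ℚ ℚ.* (f ÷ g) n ℚ.+ S′      ≡⟨ cong (ℚ._+ S′) (ℚ.*-identityˡ ((f ÷ g) n)) ⟩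
    (f n ℚ.- S) ℚ.+ S′           ≡⟨ cong ((f n ℚ.- S) ℚ.+_) (sym S≡S′) ⟩
    (f n ℚ.- S) ℚ.+ S            ≡⟨ ℚ.+-assoc (f n) (ℚ.- S) S ⟩
    f n ℚ.+ (ℚ.- S ℚ.+ S)        ≡⟨ cong (f n ℚ.+_) (ℚ.+-inverseˡ S) ⟩
    f n ℚ.+ 0ℚ                   ≡⟨ ℚ.+-identityʳ (f n) ⟩
    f n                          ∎
    where
    open ≡-Reasoning
    S  = sum {n} λ i → g (suc (toℕ i)) ℚ.* quotients f g n i
    S′ = sum {n} λ i → g (suc (toℕ i)) ℚ.* (f ÷ g) (n ∸ suc (toℕ i))
    S≡S′ : S ≡ S′
    S≡S′ = sum-cong-≗ {n} λ i → cong (g (suc (toℕ i)) ℚ.*_) (quotients-lookup f g n i)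

  -- (z ; q)_n
  ⦅_⨾_⦆_ : PowerSeries → PowerSeries → ℕ → PowerSeries
  ⦅ z ⨾ q ⦆ n = product {n} λ i → 1# - z * q ^ toℕ i

------------------------------------------------------------------------
-- The series G and its coefficients

module _ (k N M : ℕ) where
  open Series

  numerator denominator G : PowerSeries
  numerator   = ⦅ - (x ^ (k ℕ.+ 1)) ⨾ x ^ (k ℕ.+ 1) ⦆ (N ℕ.+ M ∸ 1)
  denominator = ⦅ - (x ^ k) ⨾ x ^ (k ℕ.+ 1) ⦆ N * ⦅ x ⨾ x ^ (k ℕ.+ 1) ⦆ M
  G           = numerator ÷ denominator

  c : ℕ → ℚ
  c n = G n

module _ where
  open Series

  *-constantTerm : ∀ f g → (f * g) 0 ≡ f 0 ℚ.* g 0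
  *-constantTerm f g = ℚ.+-identityʳ _

  *-constantTerm-0 : ∀ f g → f 0 ≡ 0ℚ → (f * g) 0 ≡ 0ℚ
  *-constantTerm-0 f g f₀≡0 = trans (*-constantTerm f g)
    (trans (cong (ℚ._* g 0) f₀≡0) (ℚ.*-zeroˡ (g 0)))

  *-constantTerm-1 : ∀ f g → f 0 ≡ 1ℚ → g 0 ≡ 1ℚ → (f * g) 0 ≡ 1ℚ
  *-constantTerm-1 f g f₀≡1 g₀≡1 = trans (*-constantTerm f g) (cong₂ ℚ._*_ f₀≡1 g₀≡1)

  product-constantTerm : ∀ n (t : Fin n → PowerSeries) →
                         (∀ i → t i 0 ≡ 1ℚ) → product t 0 ≡ 1ℚ
  product-constantTerm zero    t t₀≡1 = refl
  product-constantTerm (suc n) t t₀≡1 =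
    *-constantTerm-1 (t Fin.zero) (product λ i → t (Fin.suc i)) (t₀≡1 Fin.zero)
      (product-constantTerm n (λ i → t (Fin.suc i)) (λ i → t₀≡1 (Fin.suc i)))

  ⦅⦆-constantTerm : ∀ z q n → z 0 ≡ 0ℚ → (⦅ z ⨾ q ⦆ n) 0 ≡ 1ℚ
  ⦅⦆-constantTerm z q n z₀≡0 = product-constantTerm n (λ i → 1# - z * q ^ toℕ i) λ i →
    cong (λ a → 1ℚ ℚ.- a) (*-constantTerm-0 z (q ^ toℕ i) z₀≡0)

  denominator-constantTerm : ∀ k N M .{{_ : NonZero k}} → denominator k N M 0 ≡ 1ℚ
  denominator-constantTerm (suc k) N M =
    *-constantTerm-1 (⦅ - (x ^ suc k) ⨾ q ⦆ N) (⦅ x ⨾ q ⦆ M)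
      (⦅⦆-constantTerm (- (x ^ suc k)) q N (cong ℚ.-_ (*-constantTerm-0 x (x ^ k) refl)))
      (⦅⦆-constantTerm x q M refl)
    where q = x ^ (suc k ℕ.+ 1)

  G-correct : ∀ k N M .{{_ : NonZero k}} → denominator k N M * G k N M ≗ numerator k N M
  G-correct k N M =
    ÷-correct (numerator k N M) (denominator k N M) (denominator-constantTerm k N M)

------------------------------------------------------------------------
-- The threshold and the period

-- An integer, so that no subtraction is truncated.
Δ : (k N M : ℕ) → ℤ
Δ k N M = + (k ℕ.+ 1) ℤ.* + N ℤ.* (+ M ℤ.- + 1) ℤ.+ + N ℤ.- + M

-- The second family is 2(k+1)i - 2 at i = 1 + i′ with i′ < N.
Λ : (k N M : ℕ) → ℕ
Λ k N M = List.foldr lcm 1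
  (  applyUpTo (λ j → (k ℕ.+ 1) ℕ.* j ℕ.+ 1) M
  ++ applyUpTo (λ i′ → 2 ℕ.* (k ℕ.+ 1) ℕ.* suc i′ ∸ 2) N)

infix 4 _≡_mod_
_≡_mod_ : ℕ → ℕ → ℕ → Set
a ≡ b mod m = m ∣ ℕ.∣ a - b ∣

------------------------------------------------------------------------
-- Polynomials over ℚ, as coefficient lists starting with the constant term

Polynomial : Set
Polynomial = List ℚ

coeff : Polynomial → ℕ → ℚ
coeff []      _       = 0ℚ
coeff (a ∷ p) zero    = a
coeff (a ∷ p) (suc i) = coeff p i

eval : Polynomial → ℚ → ℚ
eval []      y = 0ℚ
eval (a ∷ p) y = a ℚ.+ y ℚ.* eval p y

DegreeAtMost : ℕ → Polynomial → Set
DegreeAtMost d p = ∀ i → d ℕ.< i → coeff p i ≡ 0ℚ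

-- p has degree exactly d and leading coefficient a.
HasLeadingTerm : Polynomial → ℕ → ℚ → Set
HasLeadingTerm p d a = DegreeAtMost d p × coeff p d ≡ a × a ≢ 0ℚ

fromℕ : ℕ → ℚ
fromℕ n = + n ℚ./ 1

------------------------------------------------------------------------
-- The leading coefficients

open RawSemiringDefs ℕ.+-*-rawSemiring using () renaming (product to ∏)
open RawSemiringDefs ℚ.+-*-rawSemiring using () renaming (_^_ to _^ℚ_)

∏-nonZero : ∀ {n} (t : Fin n → ℕ) → (∀ i → NonZero (t i)) → NonZero (∏ t)
∏-nonZero {zero}  t t≢0 = _
∏-nonZero {suc n} t t≢0 = ℕ.m*n≢0 (t Fin.zero) (∏ (λ i → t (Fin.suc i)))
  {{t≢0 Fin.zero}} {{∏-nonZero (λ i → t (Fin.suc i)) (λ i → t≢0 (Fin.suc i))}}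

-- ∏_{j=0}^{M-1} ((k+1)j + 1)
A : (k M : ℕ) → ℕ
A k M = ∏ {M} λ j → (k ℕ.+ 1) ℕ.* toℕ j ℕ.+ 1

-- ∏_{i=1}^{N} ((k+1)i - 1)
B : (k N : ℕ) → ℕ
B k N = ∏ {N} λ i′ → (k ℕ.+ 1) ℕ.* suc (toℕ i′) ∸ 1

A-nonZero : ∀ k M → NonZero (A k M)
A-nonZero k M = ∏-nonZero {M} _ λ j →
  ℕ.>-nonZero (ℕ.m≤n+m 1 ((k ℕ.+ 1) ℕ.* toℕ j))

B-nonZero : ∀ k N .{{_ : NonZero k}} → NonZero (B k N)
B-nonZero k N = ∏-nonZero {N} _ λ i′ → ℕ.>-nonZero (ℕ.m<n⇒0<n∸m
  (ℕ.≤-trans (ℕ.+-monoˡ-≤ 1 (ℕ.>-nonZero⁻¹ k)) (ℕ.m≤m*n (k ℕ.+ 1) (suc (toℕ i′)))))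

-- 2^{M-1} / ((M-1)! ∏_{j=0}^{M-1} ((k+1)j + 1))
leading : (k M : ℕ) → ℚ
leading k M = + (2 ℕ.^ (M ∸ 1)) ℚ./ ((M ∸ 1) ! ℕ.* A k M)
  where instance
  nonZero : NonZero ((M ∸ 1) ! ℕ.* A k M)
  nonZero = ℕ.m*n≢0 ((M ∸ 1) !) (A k M) {{(M ∸ 1) ℕ.!≢0}} {{A-nonZero k M}}

-- 1/(N-1)! · (2^{N-1} / ∏_{j=0}^{N-1} ((k+1)j + 1) + (-1)^r 2^{N-1} / ∏_{i=1}^{N} ((k+1)i - 1))
leadingAlternating : (k N r : ℕ) .{{_ : NonZero k}} → ℚ
leadingAlternating k N r =
  (+ 1 ℚ./ (N ∸ 1) !) {{(N ∸ 1) ℕ.!≢0}}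
    ℚ.* ((+ (2 ℕ.^ (N ∸ 1)) ℚ./ A k N) {{A-nonZero k N}}
         ℚ.+ (ℚ.- 1ℚ) ^ℚ r ℚ.* (+ (2 ℕ.^ (N ∸ 1)) ℚ./ B k N) {{B-nonZero k N}})

{-# OPTIONS --safe #-}
module Submission where

-- Put q = x^{k+1} and F(N, M) = (-q; q)_{N+M-1} / ((-x^k; q)_N (x; q)_M).  Since
-- 1 + yz = (1 + y) - y (1 - z), these satisfy the Pascal-type recurrence
--   F(N, M) = F(N-1, M) - x^{(k+1)N-1} F(N, M-1),
-- so F(N, M) is a polynomial combination of the F(0, M′) and the F(N′, 0), whose
-- denominators have only M′ resp. N′ factors.  Hence G W is a polynomial whenever
-- both (-x^k; q)_N and (x; q)_M divide W.
--
-- * W = (1 - x^Λ)^M, with the degree of G W, gives quasi-polynomiality beyond Δ: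
--   the M-th Λ-step difference of c vanishes there.
-- * The factor j = 0 of (x; q)_M is 1 - x, and for N = M ≥ 2 the product
--   (1 + x^k)(1 + x^{2k+1}) divides (1 + x)(1 - x^Λ), and 2 (1 - x^Λ) if k is even.
--   So one may also take (1 - x)(1 - x^Λ)^{M-1} or, for N = M and k odd,
--   (1 - x²)(1 - x^Λ)^{M-1}: the coefficients of G (1 - x^Λ)^{M-1}, which are
--   (M-1)! Λ^{M-1} times the leading coefficients, are eventually a resp.
--   a + (-1)^n b.  Here a is the value of (1 - x) (1 - x^Λ)^{M-1} G at x = 1, and
--   b that of (1 - x) (1 - x^Λ)^{M-1} G(-x).

open import Defs
open import Algebra.Bundles using (CommutativeMonoid; CommutativeRing)
open import Algebra.Bundles.Raw using (RawRing)
import Algebra.Definitions.RawSemiring as RawSemiringDefs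
open import Algebra.Morphism.Structures using (IsRingMonomorphism)
import Algebra.Morphism.RingMonomorphism as RingMonomorphism
import Algebra.Properties.CommutativeSemigroup as CommutativeSemigroupProperties
open import Data.Fin.Base as Fin using (Fin; toℕ)
import Data.Fin.Properties as Fin
open import Data.Integer.Base as ℤ using (+_)
import Data.Integer.Properties as ℤ
open import Data.List.Base as List using ([]; _∷_; length; applyUpTo)
open import Data.List.Membership.Propositional using (_∈_)
open import Data.List.Membership.Propositional.Properties using (∈-applyUpTo⁺; ∈-++⁺ˡ; ∈-++⁺ʳ)
open import Data.List.Relation.Unary.All using (All; []; _∷_)
import Data.List.Relation.Unary.All.Properties as All
open import Data.List.Relation.Unary.Any using (here; there)
open import Data.Nat.Base as ℕ using (ℕ; zero; suc; NonZero; _≤_; _<_; _∸_; _!; z≤n; s≤s)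
open import Data.Nat.DivMod using (_%_; _/_; m%n<n; [m+kn]%n≡m%n; m≡m%n+[m/n]*n)
import Data.Nat.Divisibility as ℕ
open import Data.Nat.GCD using (gcd)
open import Data.Nat.Induction using (<-rec)
open import Data.Nat.LCM using (lcm; m∣lcm[m,n]; n∣lcm[m,n]; gcd*lcm)
import Data.Nat.Properties as ℕ
import Data.Nat.Solver as ℕ
open import Data.Product.Base using (_×_; _,_; proj₁; proj₂; ∃-syntax; Σ-syntax)
open import Data.Rational.Base as ℚ using (ℚ; 0ℚ; 1ℚ; ½)
import Data.Rational.Properties as ℚ
open import Data.Rational.Solver using (module +-*-Solver)
open import Data.Rational.Unnormalised.Base as ℚᵘ using (mkℚᵘ; *≡*)
import Data.Rational.Unnormalised.Properties as ℚᵘ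
open import Data.Sum.Base using (_⊎_; inj₁; inj₂)
open import Function.Base using (_∘_)
open import Level using (0ℓ)
import Relation.Binary.PropositionalEquality as ≡
open ≡ using (_≡_)
open import Relation.Nullary.Decidable.Core using (yes; no)
open import Relation.Nullary.Negation using (¬_; contradiction)

-- Divisibility in commutative rings

-- The obstacle is the order of the poles. `G` has `N + M` denominator factors, and both families
-- can vanish at the same root of unity, so a naive bound on the degree of the `Q_r` would be
-- `N + M - 1`. At a common zero of `1 + y` and `1 - z` one has `1 + yz = 0`, so a factor of the
-- numerator vanishes too; the recurrence does this cancellation for all roots of unity at once and
-- stays over ℚ, where partial fractions would need cyclotomic fields. Two rings are in play.
-- Divisibility is asserted among polynomials, because a power series with constant term 1 is a unit
-- and divisibility by it says nothing. Cancellation is done among power series, for the very same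
-- reason. A series has no value at `x = 1`. The eventual value of its coefficients serves instead:
-- if `(1 - x) f` is a polynomial `p`, then the coefficients of `f` are eventually `p(1)`.

module RingLemmas {r₁ r₂} (R : CommutativeRing r₁ r₂) where

  open CommutativeRing R
  open import Algebra.Properties.CommutativeSemigroup.Divisibility *-commutativeSemigroup public
    using (_∣_; _,_; ∙-cong-∣; x∣ʳy⇒x∣ʳzy; ∣ʳ-trans; ∣ʳ-respʳ-≈; ∣ʳ-respˡ-≈)
  open import Algebra.Properties.Semiring.Exp semiring public
    using (_^_; ^-congʳ; ^-congˡ; ^-homo-*; ^-assocʳ)
  open import Algebra.Properties.CommutativeSemiring.Exp commutativeSemiring public
    using (^-distrib-*)
  open import Algebra.Properties.Ring ring using (-‿distribˡ-*; -‿distribʳ-*; -‿involutive)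
  open import Algebra.Solver.Ring.NaturalCoefficients.Default commutativeSemiring
    using (solve; _:=_; _:+_; _:*_; con)
  open import Relation.Binary.Reasoning.Setoid setoid

  -- The recursion splits off the last factor, because that is the factor on which the Pascal-type
  -- recurrence acts; `∏<-suc` recovers the first one.
  ∏< : ℕ → (ℕ → Carrier) → Carrier
  ∏< zero    f = 1#
  ∏< (suc n) f = ∏< n f * f n

  ∏<-cong : ∀ n {f g : ℕ → Carrier} → (∀ i → f i ≈ g i) → ∏< n f ≈ ∏< n g
  ∏<-cong zero    f≈g = refl
  ∏<-cong (suc n) f≈g = *-cong (∏<-cong n f≈g) (f≈g n)

  ∏<-suc : ∀ n f → ∏< (suc n) f ≈ f 0 * ∏< n (f ∘ suc)
  ∏<-suc zero    f = *-comm 1# (f 0)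
  ∏<-suc (suc n) f = trans (*-congʳ (∏<-suc n f)) (*-assoc (f 0) _ _)

  ∏<-* : ∀ n f g → ∏< n (λ i → f i * g i) ≈ ∏< n f * ∏< n g
  ∏<-* zero    f g = sym (*-identityˡ 1#)
  ∏<-* (suc n) f g = trans (*-congʳ (∏<-* n f g))
    (solve 4 (λ a b c d → (a :* b) :* (c :* d) := (a :* c) :* (b :* d)) refl _ _ _ _)

  ∏<-∣-^ : ∀ n {f w} → (∀ i → i < n → f i ∣ w) → ∏< n f ∣ w ^ n
  ∏<-∣-^ zero    f∣w = 1# , *-identityˡ 1#
  ∏<-∣-^ (suc n) {f} {w} f∣w = ∣ʳ-respʳ-≈ (*-comm (w ^ n) w)
    (∙-cong-∣ (∏<-∣-^ n λ i i<n → f∣w i (ℕ.m≤n⇒m≤1+n i<n)) (f∣w n ℕ.≤-refl))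

  ∣-+ : ∀ {a b d} → d ∣ a → d ∣ b → d ∣ a + b
  ∣-+ {d = d} (p , pd≈a) (q , qd≈b) = p + q , trans (distribʳ d p q) (+-cong pd≈a qd≈b)

  ∣-+-cancelʳ : ∀ {a b d} → d ∣ a + b → d ∣ b → d ∣ a
  ∣-+-cancelʳ {a} {b} {d} (p , pd≈a+b) (q , qd≈b) = p - q , (begin
    (p - q) * d         ≈⟨ distribʳ d p (- q) ⟩
    p * d + - q * d     ≈⟨ +-cong pd≈a+b (sym (-‿distribˡ-* q d)) ⟩
    a + b - q * d       ≈⟨ +-congˡ (-‿cong qd≈b) ⟩
    a + b - b           ≈⟨ +-assoc a b (- b) ⟩
    a + (b - b)         ≈⟨ +-congˡ (-‿inverseʳ b) ⟩
    a + 0#              ≈⟨ +-identityʳ a ⟩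
    a                   ∎)

  -- `p * r` divides both `r * w` and `p * w`, hence also `u * w`, where `u = t r - s p` lies in the
  -- ideal of `p` and `r`. Coprime factors would allow `u = 1`; here `u` measures how far they are
  -- from coprime.
  bézout-∣ : ∀ {p r u w} s t → p ∣ w → r ∣ w → u + s * p ≈ t * r → p * r ∣ u * w
  bézout-∣ {p} {r} {u} {w} s t p∣w r∣w u+sp≈tr = ∣-+-cancelʳ
    (∣ʳ-respʳ-≈ (trans (sym (*-assoc t r w)) (trans (*-congʳ (sym u+sp≈tr)) (distribʳ w u (s * p))))
      (x∣ʳy⇒x∣ʳzy t (∣ʳ-respʳ-≈ (*-comm w r) (∙-cong-∣ p∣w ∣-refl))))
    (∣ʳ-respʳ-≈ (sym (*-assoc s p w)) (x∣ʳy⇒x∣ʳzy s (∙-cong-∣ ∣-refl r∣w)))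
    where
    ∣-refl : ∀ {a} → a ∣ a
    ∣-refl = 1# , *-identityˡ _

  1-ab≈ : ∀ a b → 1# - a * b ≈ (1# - a) + a * (1# - b)
  1-ab≈ a b = sym (begin
    (1# - a) + a * (1# - b)
      ≈⟨ solve 3 (λ a a⁻ b⁻ → con 1 :+ a⁻ :+ a :* (con 1 :+ b⁻) := con 1 :+ ((a⁻ :+ a) :+ a :* b⁻))
           refl a (- a) (- b) ⟩
    1# + ((- a + a) + a * - b)
      ≈⟨ +-congˡ (+-cong (-‿inverseˡ a) (sym (-‿distribʳ-* a b))) ⟩
    1# + (0# - a * b)
      ≈⟨ +-congˡ (+-identityˡ _) ⟩
    1# - a * b ∎)

  1+ab≈ : ∀ a b → 1# + a * b ≈ (1# + a) + - a * (1# - b)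
  1+ab≈ a b = begin
    1# + a * b                        ≈⟨ +-congˡ (-‿involutive (a * b)) ⟨
    1# - - (a * b)                    ≈⟨ +-congˡ (-‿cong (-‿distribˡ-* a b)) ⟩
    1# - (- a) * b                    ≈⟨ 1-ab≈ (- a) b ⟩
    (1# - - a) + - a * (1# - b)       ≈⟨ +-congʳ (+-congˡ (-‿involutive a)) ⟩
    (1# + a) + - a * (1# - b)         ∎

  geometric : Carrier → ℕ → Carrier
  geometric y zero    = 0#
  geometric y (suc n) = 1# + y * geometric y n

  geometric-* : ∀ y n → geometric y n * (1# - y) ≈ 1# - y ^ n
  geometric-* y zero    = trans (zeroˡ _) (sym (-‿inverseʳ 1#))
  geometric-* y (suc n) = begin
    (1# + y * q) * (1# - y)           ≈⟨ distribʳ (1# - y) 1# (y * q) ⟩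
    1# * (1# - y) + y * q * (1# - y)
      ≈⟨ +-cong (*-identityˡ _) (trans (*-assoc y q _) (*-congˡ (geometric-* y n))) ⟩
    (1# - y) + y * (1# - y ^ n)       ≈⟨ 1-ab≈ y (y ^ n) ⟨
    1# - y ^ suc n                    ∎
    where q = geometric y n

  [1-y][1+y] : ∀ y → (1# - y) * (1# + y) ≈ 1# - y * y
  [1-y][1+y] y = trans
    (solve 2 (λ y z → z :* (con 1 :+ y) := z :+ y :* z) refl y (1# - y)) (sym (1-ab≈ y y))

  -- The Pascal-type recurrence  F(N, M) = F(N-1, M) + s · F(N, M-1)  of
  -- F(N, M) = ∏ C / (∏ A ∏ B): the numerator's last factor is a combination of
  -- the last factors of the two denominators.
  ∏A∏B∣∏C : ∀ {A B C s : ℕ → Carrier} {W} →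
             (∀ i j → C (i ℕ.+ j) ≈ A i + s i * B j) →
             ∀ N M r → N ℕ.+ M ≡ suc r → ∏< N A ∣ W → ∏< M B ∣ W →
             ∏< N A * ∏< M B ∣ ∏< r C * W
  ∏A∏B∣∏C {C = C} C≈ zero M r N+M≡ ∏A∣W ∏B∣W =
    ∣ʳ-respˡ-≈ (sym (*-identityˡ _)) (x∣ʳy⇒x∣ʳzy (∏< r C) ∏B∣W)
  ∏A∏B∣∏C {C = C} C≈ (suc N) zero r N+M≡ ∏A∣W ∏B∣W =
    ∣ʳ-respˡ-≈ (sym (*-identityʳ _)) (x∣ʳy⇒x∣ʳzy (∏< r C) ∏A∣W)
  ∏A∏B∣∏C {A} {B} {C} {s} {W} C≈ (suc N) (suc M) r N+M≡ (p , p∏A≈W) (q , q∏B≈W)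
    rewrite ≡.sym (ℕ.suc-injective N+M≡) | ℕ.+-suc N M
    with u , u≈ ← ∏A∏B∣∏C {A} {B} {C} {s} {W} C≈ N (suc M) (N ℕ.+ M) (ℕ.+-suc N M)
                    (p * A N , trans (trans (*-assoc p _ _) (*-congˡ (*-comm _ _))) p∏A≈W) (q , q∏B≈W)
       | v , v≈ ← ∏A∏B∣∏C {A} {B} {C} {s} {W} C≈ (suc N) M (N ℕ.+ M) ≡.refl
                    (p , p∏A≈W) (q * B M , trans (trans (*-assoc q _ _) (*-congˡ (*-comm _ _))) q∏B≈W)
    -- The recurrence itself: `u` stands for `F(N-1, M) W` and `v` for `F(N, M-1) W`. Both have one
    -- numerator factor fewer, and `C (N + M)` is the missing one.
    = u + s N * v , (begin
    (u + s N * v) * ((a * A N) * (b * B M))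
      ≈⟨ solve 7 (λ u v s a A b B → (u :+ s :* v) :* ((a :* A) :* (b :* B))
                   := (u :* (a :* (b :* B))) :* A :+ s :* (v :* ((a :* A) :* b)) :* B)
           refl u v (s N) a (A N) b (B M) ⟩
    u * (a * (b * B M)) * A N + s N * (v * ((a * A N) * b)) * B M
      ≈⟨ +-cong (*-congʳ u≈) (*-congʳ (*-congˡ v≈)) ⟩
    (d * W) * A N + s N * (d * W) * B M
      ≈⟨ solve 5 (λ c W A s B → (c :* W) :* A :+ s :* (c :* W) :* B := (c :* (A :+ s :* B)) :* W)
           refl d W (A N) (s N) (B M) ⟩
    (d * (A N + s N * B M)) * W
      ≈⟨ *-congʳ (*-congˡ (C≈ N M)) ⟨
    (d * C (N ℕ.+ M)) * W ∎)
    where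
    a = ∏< N A
    b = ∏< M B
    d = ∏< (N ℕ.+ M) C

-- The binomials `1 + x^e` and `1 - x^e` in a commutative ring

module BinomialFactors {r₁ r₂} (R : CommutativeRing r₁ r₂) (x : CommutativeRing.Carrier R) where

  open CommutativeRing R
  open RingLemmas R
  open import Algebra.Properties.Ring ring using (-‿distribˡ-*; -‿involutive)
  open import Algebra.Solver.Ring.NaturalCoefficients.Default commutativeSemiring
    using (solve; _:=_; _:+_; _:*_; con)
  open import Relation.Binary.Reasoning.Setoid setoid

  1+x^_ 1-x^_ : ℕ → Carrier
  1+x^ e = 1# + x ^ e
  1-x^ e = 1# - x ^ e

  1+x^-affine : ∀ a b i → 1# - (- (x ^ a)) * (x ^ b) ^ i ≈ 1+x^ (a ℕ.+ b ℕ.* i)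
  1+x^-affine a b i = +-congˡ (begin
    - (- (x ^ a) * (x ^ b) ^ i)    ≈⟨ -‿cong (-‿distribˡ-* (x ^ a) _) ⟨
    - - (x ^ a * (x ^ b) ^ i)      ≈⟨ -‿involutive _ ⟩
    x ^ a * (x ^ b) ^ i            ≈⟨ *-congˡ (^-assocʳ x b i) ⟩
    x ^ a * x ^ (b ℕ.* i)          ≈⟨ ^-homo-* x a (b ℕ.* i) ⟨
    x ^ (a ℕ.+ b ℕ.* i)            ∎)

  1-x^-affine : ∀ b i → 1# - x * (x ^ b) ^ i ≈ 1-x^ (b ℕ.* i ℕ.+ 1)
  1-x^-affine b i = +-congˡ (-‿cong (trans (*-congˡ (^-assocʳ x b i)) (^-congʳ x (ℕ.+-comm 1 (b ℕ.* i)))))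

  1-x^∣ : ∀ {e n} → e ℕ.∣ n → 1-x^ e ∣ 1-x^ n
  1-x^∣ {e} (ℕ.divides q ≡.refl) = ∣ʳ-respʳ-≈
    (+-congˡ (-‿cong (trans (^-assocʳ x e q) (^-congʳ x (ℕ.*-comm e q))))) (geometric (x ^ e) q , geometric-* (x ^ e) q)

  [1-x^][1+x^] : ∀ e → 1-x^ e * 1+x^ e ≈ 1-x^ (2 ℕ.* e)
  [1-x^][1+x^] e = begin
    1-x^ e * 1+x^ e        ≈⟨ [1-y][1+y] (x ^ e) ⟩
    1# - x ^ e * x ^ e     ≈⟨ +-congˡ (-‿cong (^-homo-* x e e)) ⟨
    1-x^ (e ℕ.+ e)         ≡⟨ ≡.cong (λ e′ → 1-x^ (e ℕ.+ e′)) (ℕ.+-identityʳ e) ⟨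
    1-x^ (2 ℕ.* e)         ∎

  1+x^∣ : ∀ e {n} → 2 ℕ.* e ℕ.∣ n → 1+x^ e ∣ 1-x^ n
  1+x^∣ e 2e∣n = ∣ʳ-trans (1-x^ e , [1-x^][1+x^] e) (1-x^∣ 2e∣n)

  ∏geometric-* : ∀ n (e : ℕ → ℕ) → ∏< n (λ i → geometric x (e i)) * (1-x^ 1) ^ n ≈ ∏< n (λ i → 1-x^ (e i))
  ∏geometric-* zero    e = *-identityˡ 1#
  ∏geometric-* (suc n) e = begin
    g * geometric x (e n) * ((1-x^ 1) * (1-x^ 1) ^ n)
      ≈⟨ solve 4 (λ a b c d → a :* b :* (c :* d) := (a :* d) :* (b :* c)) refl g (geometric x (e n)) (1-x^ 1) ((1-x^ 1) ^ n) ⟩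
    g * (1-x^ 1) ^ n * (geometric x (e n) * 1-x^ 1)
      ≈⟨ *-cong (∏geometric-* n e) (*-congˡ (+-congˡ (-‿cong (*-identityʳ x)))) ⟩
    ∏< n (λ i → 1-x^ (e i)) * (geometric x (e n) * (1# - x))
      ≈⟨ *-congˡ (geometric-* x (e n)) ⟩
    ∏< n (λ i → 1-x^ (e i)) * 1-x^ (e n) ∎
    where g = ∏< n λ i → geometric x (e i)

  -- The left side has `m + 1` factors vanishing at `x = 1` and the right side only `m`; the surplus
  -- `1 - x` is the simple pole of `y`. The common power of `1 - x` stays on both sides, as an
  -- arbitrary ring gives no way to cancel it; for power series it is a unit.
  cleared : ∀ m r L (e g : ℕ → ℕ) y →
    ∏< (suc m) (λ i → 1-x^ (e i)) * y ≈ ∏< r (λ i → 1+x^ (g i)) * (1-x^ L) ^ m →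
    (1-x^ 1) ^ m * ((1-x^ 1) * (∏< (suc m) (λ i → geometric x (e i)) * y))
      ≈ (1-x^ 1) ^ m * (∏< r (λ i → 1+x^ (g i)) * geometric x L ^ m)
  cleared m r L e g y eq = begin
    d ^ m * (d * (p * y))
      ≈⟨ solve 4 (λ dᵐ d p y → dᵐ :* (d :* (p :* y)) := p :* (d :* dᵐ) :* y) refl (d ^ m) d p y ⟩
    p * d ^ suc m * y
      ≈⟨ *-congʳ (∏geometric-* (suc m) e) ⟩
    ∏< (suc m) (λ i → 1-x^ (e i)) * y
      ≈⟨ eq ⟩
    q * (1-x^ L) ^ m
      ≈⟨ *-congˡ (^-congˡ m (trans (*-congˡ (+-congˡ (-‿cong (*-identityʳ x)))) (geometric-* x L))) ⟨
    q * (geometric x L * d) ^ m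
      ≈⟨ *-congˡ (^-distrib-* (geometric x L) d m) ⟩
    q * (geometric x L ^ m * d ^ m)
      ≈⟨ solve 3 (λ q g d → q :* (g :* d) := d :* (q :* g)) refl q (geometric x L ^ m) (d ^ m) ⟩
    d ^ m * (q * geometric x L ^ m) ∎
    where
    d = 1-x^ 1
    p = ∏< (suc m) λ i → geometric x (e i)
    q = ∏< r λ i → 1+x^ (g i)

  -- 1 + x = (1 + x^{2k+1}) + x (1 - x^k) (1 + x^k)
  pair-∣ : ∀ k {w} → 1+x^ k ∣ w → 1+x^ (suc k ℕ.+ k) ∣ w → 1+x^ k * 1+x^ (suc k ℕ.+ k) ∣ (1+x^ 1) * w
  pair-∣ k p∣w r∣w = bézout-∣ (- (x * 1-x^ k)) 1# p∣w r∣w (begin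
    1# + x * 1# + - (x * 1-x^ k) * 1+x^ k
      ≈⟨ +-cong (+-congˡ (*-identityʳ x)) (sym (-‿distribˡ-* _ _)) ⟩
    1# + x - x * 1-x^ k * 1+x^ k
      ≈⟨ +-congˡ (-‿cong (trans (*-assoc x _ _) (*-congˡ ([1-y][1+y] (x ^ k))))) ⟩
    1# + x - x * (1# - x ^ k * x ^ k)
      ≈⟨ +-congˡ (-‿distribˡ-* _ _) ⟩
    1# + x + - x * (1# - x ^ k * x ^ k)
      ≈⟨ 1+ab≈ x (x ^ k * x ^ k) ⟨
    1# + x * (x ^ k * x ^ k)
      ≈⟨ +-congˡ (*-congˡ (^-homo-* x k k)) ⟨
    1+x^ (suc k ℕ.+ k)
      ≈⟨ *-identityˡ _ ⟨
    1# * 1+x^ (suc k ℕ.+ k) ∎)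

  -- 2 = (1 + x^k) + (1 - x^k), and 1 + x divides 1 - x^k.
  pair-∣-even : ∀ k {w} → 2 ℕ.∣ k → 1+x^ k ∣ w → 1+x^ (suc k ℕ.+ k) ∣ w →
                1+x^ k * 1+x^ (suc k ℕ.+ k) ∣ (1# + 1#) * w
  pair-∣-even k {w} 2∣k p∣w r∣w with q , q[1+x]≈1-xᵏ ← 1+x^∣ 1 2∣k =
    ∣ʳ-respʳ-≈ (begin
      (1+x^ k) * w + q * ((1+x^ 1) * w)
        ≈⟨ solve 4 (λ w p q r → p :* w :+ q :* (r :* w) := (p :+ q :* r) :* w) refl w (1+x^ k) q (1+x^ 1) ⟩
      (1+x^ k + q * 1+x^ 1) * w
        ≈⟨ *-congʳ (+-congˡ q[1+x]≈1-xᵏ) ⟩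
      (1+x^ k + 1-x^ k) * w
        ≈⟨ *-congʳ (solve 2 (λ a a⁻ → con 1 :+ a :+ (con 1 :+ a⁻) := con 1 :+ con 1 :+ (a :+ a⁻)) refl (x ^ k) (- (x ^ k))) ⟩
      (1# + 1# + (x ^ k - x ^ k)) * w
        ≈⟨ *-congʳ (trans (+-congˡ (-‿inverseʳ (x ^ k))) (+-identityʳ _)) ⟩
      (1# + 1#) * w ∎)
    (∣-+ (∙-cong-∣ (1# , *-identityˡ _) r∣w)
         (x∣ʳy⇒x∣ʳzy q (pair-∣ k p∣w r∣w)))

-- The exponents in G, indexed from 0: α k i = (k+1)(i+1) - 1.
α β γ : ℕ → ℕ → ℕ
α k i = k ℕ.+ suc k ℕ.* i
β k j = suc k ℕ.* j ℕ.+ 1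
γ k r = suc k ℕ.* suc r

-- The offsets `-1` and `+1` of the two families cancel, so the product of the monomials depends on
-- `i + j` alone. This is what the hypothesis on `C` in `∏A∏B∣∏C` asks for.
α+β≡γ : ∀ k i j → α k i ℕ.+ β k j ≡ γ k (i ℕ.+ j)
α+β≡γ = solve 3 (λ k i j → k :+ (con 1 :+ k) :* i :+ ((con 1 :+ k) :* j :+ con 1)
                             := (con 1 :+ k) :* (con 1 :+ (i :+ j))) ≡.refl
  where open ℕ.+-*-Solver

-- Multiples of both denominators built from powers of `1 - x^L`

module CommonMultiples {r₁ r₂} (R : CommutativeRing r₁ r₂) (x : CommutativeRing.Carrier R)
                       (k L N M : ℕ)
                       (2α∣L : ∀ i → i < N → 2 ℕ.* α k i ℕ.∣ L)
                       (β∣L  : ∀ j → j < M → β k j ℕ.∣ L) where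

  open CommutativeRing R
  open RingLemmas R
  open BinomialFactors R x
  open import Relation.Binary.Reasoning.Setoid setoid

  ∏α ∏β ∏γ : ℕ → Carrier
  ∏α n = ∏< n λ i → 1+x^ (α k i)
  ∏β m = ∏< m λ j → 1-x^ (β k j)
  ∏γ r = ∏< r λ i → 1+x^ (γ k i)

  w : Carrier
  w = 1-x^ L

  ∏α∏β∣∏γ : ∀ r {W} → N ℕ.+ M ≡ suc r → ∏α N ∣ W → ∏β M ∣ W → ∏α N * ∏β M ∣ ∏γ r * W
  ∏α∏β∣∏γ r {W} = ∏A∏B∣∏C {s = λ i → - (x ^ α k i)} {W = W} (λ i j → begin
    1+x^ (γ k (i ℕ.+ j))               ≡⟨ ≡.cong 1+x^_ (α+β≡γ k i j) ⟨
    1+x^ (α k i ℕ.+ β k j)             ≈⟨ +-congˡ (^-homo-* x (α k i) (β k j)) ⟩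
    1# + x ^ α k i * x ^ β k j         ≈⟨ 1+ab≈ (x ^ α k i) (x ^ β k j) ⟩
    1+x^ (α k i) + - (x ^ α k i) * 1-x^ (β k j) ∎) N M r

  w^-mono : ∀ {m n} → m ≤ n → w ^ m ∣ w ^ n
  w^-mono {m} {n} m≤n = w ^ (n ∸ m) , (begin
    w ^ (n ∸ m) * w ^ m   ≈⟨ ^-homo-* w (n ∸ m) m ⟨
    w ^ (n ∸ m ℕ.+ m)     ≡⟨ ≡.cong (w ^_) (ℕ.m∸n+n≡m m≤n) ⟩
    w ^ n                 ∎)

  ∏α∣w^ : ∀ {n} → N ≤ n → ∏α N ∣ w ^ n
  ∏α∣w^ N≤n = ∣ʳ-trans (∏<-∣-^ N λ i i<N → 1+x^∣ (α k i) (2α∣L i i<N)) (w^-mono N≤n)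

  ∏β∣w^M : ∏β M ∣ w ^ M
  ∏β∣w^M = ∏<-∣-^ M λ j j<M → 1-x^∣ (β∣L j j<M)

  ∏β∣[1-x]w^ : ∀ {m} → M ≡ suc m → ∏β M ∣ (1-x^ 1) * w ^ m
  ∏β∣[1-x]w^ {m} ≡.refl = ∣ʳ-respˡ-≈ (sym (∏<-suc m _)) (∙-cong-∣
    (1# , trans (*-identityˡ _) (reflexive (≡.cong (λ e → 1-x^ (e ℕ.+ 1)) (ℕ.*-zeroʳ (suc k)))))
    (∏<-∣-^ m λ j j<m → 1-x^∣ (β∣L (suc j) (s≤s j<m))))

  -- The first two factors, with exponents `k` and `2k + 1`, together cost a single `w` at the price
  -- of `t`; each of the remaining `n` factors costs one more. The factor `1 - x` is carried along
  -- because `∏β` has to divide the same multiple.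
  ∏α∣t[1-x]w^ : ∀ {n} t → N ≡ 2 ℕ.+ n →
                (1+x^ k ∣ w → 1+x^ (suc k ℕ.+ k) ∣ w → 1+x^ k * 1+x^ (suc k ℕ.+ k) ∣ t * w) →
                ∏α N ∣ t * ((1-x^ 1) * w ^ suc n)
  ∏α∣t[1-x]w^ {n} t ≡.refl pair = ∣ʳ-respʳ-≈ (begin
    (1-x^ 1) * ((t * w) * w ^ n)    ≈⟨ *-congˡ (*-assoc t w _) ⟩
    (1-x^ 1) * (t * w ^ suc n)      ≈⟨ x∙yz≈y∙xz _ t _ ⟩
    t * ((1-x^ 1) * w ^ suc n)      ∎)
    (x∣ʳy⇒x∣ʳzy (1-x^ 1) (∣ʳ-respˡ-≈ front (∙-cong-∣
      (pair (∣α 0 (s≤s z≤n) α₀) (∣α 1 (s≤s (s≤s z≤n)) α₁))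
      (∏<-∣-^ n λ i i<n → 1+x^∣ (α k (2 ℕ.+ i)) (2α∣L (2 ℕ.+ i) (s≤s (s≤s i<n)))))))
    where
    open import Algebra.Properties.CommutativeSemigroup *-commutativeSemigroup using (x∙yz≈y∙xz)
    α₀ : α k 0 ≡ k
    α₀ = ≡.trans (≡.cong (k ℕ.+_) (ℕ.*-zeroʳ (suc k))) (ℕ.+-identityʳ k)
    α₁ : α k 1 ≡ suc k ℕ.+ k
    α₁ = ≡.trans (≡.cong (k ℕ.+_) (ℕ.*-identityʳ (suc k))) (ℕ.+-comm k (suc k))
    ∣α : ∀ i {e} → i < N → α k i ≡ e → 1+x^ e ∣ w
    ∣α i i<N ≡.refl = 1+x^∣ (α k i) (2α∣L i i<N)
    front : 1+x^ k * 1+x^ (suc k ℕ.+ k) * ∏< n (λ i → 1+x^ (α k (2 ℕ.+ i))) ≈ ∏α N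
    front = begin
      1+x^ k * 1+x^ (suc k ℕ.+ k) * _
        ≡⟨ ≡.cong₂ (λ e e′ → 1+x^ e * 1+x^ e′ * ∏< n (λ i → 1+x^ (α k (2 ℕ.+ i)))) α₀ α₁ ⟨
      1+x^ (α k 0) * 1+x^ (α k 1) * _      ≈⟨ *-assoc _ _ _ ⟩
      1+x^ (α k 0) * (1+x^ (α k 1) * _)    ≈⟨ *-congˡ (∏<-suc n _) ⟨
      1+x^ (α k 0) * _                     ≈⟨ ∏<-suc (suc n) _ ⟨
      ∏α N                                 ∎

open import Algebra.Properties.CommutativeMonoid.Sum ℚ.+-0-commutativeMonoid
  using (sum-cong-≗; ∑-distrib-+)
open import Data.Nat.Divisibility
  using (_∣_; _∤_; divides; _∣?_; ∣-trans; ∣1⇒≡1; ∣m∣n⇒∣m+n; ∣m+n∣m⇒∣n; m∣m*n; ∣n⇒∣m*n; ∣m⇒∣m*n)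
open import Relation.Binary.PropositionalEquality

-- The rings of power series and of polynomials

-- The convolution at `suc n` unfolds by definition to `f 0 ℚ.* g (suc n)` plus `(tail f * g) n`.
-- The ring laws are therefore proved by induction on the index, with `tail` applied to the left
-- factor.
tail : PowerSeries → PowerSeries
tail f n = f (suc n)

module _ where
  open Series
  open ≡-Reasoning
  open CommutativeSemigroupProperties
    (CommutativeMonoid.commutativeSemigroup ℚ.+-0-commutativeMonoid) using (x∙yz≈y∙xz)

  *-congˢ : ∀ {f f′ g g′} → f ≗ f′ → g ≗ g′ → f * g ≗ f′ * g′
  *-congˢ f≗f′ g≗g′ n = sum-cong-≗ {suc n} λ i → cong₂ ℚ._*_ (f≗f′ (toℕ i)) (g≗g′ (n ∸ toℕ i))

  *-distribʳˢ : ∀ h f g → (f + g) * h ≗ f * h + g * h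
  *-distribʳˢ h f g n = trans
    (sum-cong-≗ {suc n} λ i → ℚ.*-distribʳ-+ (h (n ∸ toℕ i)) (f (toℕ i)) (g (toℕ i)))
    (∑-distrib-+ {suc n} (λ i → f (toℕ i) ℚ.* h (n ∸ toℕ i)) (λ i → g (toℕ i) ℚ.* h (n ∸ toℕ i)))

  *-scaleˡ : ∀ a f g → (λ m → a ℚ.* f m) * g ≗ λ n → a ℚ.* (f * g) n
  *-scaleˡ a f g zero = trans (*-constantTerm (λ m → a ℚ.* f m) g)
    (trans (ℚ.*-assoc a (f 0) (g 0)) (cong (a ℚ.*_) (sym (*-constantTerm f g))))
  *-scaleˡ a f g (suc n) = begin
    a ℚ.* f 0 ℚ.* g (suc n) ℚ.+ ((λ m → a ℚ.* tail f m) * g) n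
      ≡⟨ cong₂ ℚ._+_ (ℚ.*-assoc a (f 0) (g (suc n))) (*-scaleˡ a (tail f) g n) ⟩
    a ℚ.* (f 0 ℚ.* g (suc n)) ℚ.+ a ℚ.* (tail f * g) n
      ≡⟨ ℚ.*-distribˡ-+ a _ _ ⟨
    a ℚ.* (f * g) (suc n) ∎

  *-assocˢ : ∀ f g h → (f * g) * h ≗ f * (g * h)
  *-assocˢ f g h zero = begin
    ((f * g) * h) 0          ≡⟨ *-constantTerm (f * g) h ⟩
    (f * g) 0 ℚ.* h 0        ≡⟨ cong (ℚ._* h 0) (*-constantTerm f g) ⟩
    f 0 ℚ.* g 0 ℚ.* h 0      ≡⟨ ℚ.*-assoc (f 0) (g 0) (h 0) ⟩
    f 0 ℚ.* (g 0 ℚ.* h 0)    ≡⟨ cong (f 0 ℚ.*_) (*-constantTerm g h) ⟨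
    f 0 ℚ.* (g * h) 0        ≡⟨ *-constantTerm f (g * h) ⟨
    (f * (g * h)) 0          ∎
  *-assocˢ f g h (suc n) = begin
    (f * g) 0 ℚ.* h (suc n) ℚ.+ (tail (f * g) * h) n
      ≡⟨ cong₂ ℚ._+_ head-eq tail-eq ⟩
    f 0 ℚ.* (g 0 ℚ.* h (suc n)) ℚ.+ (f 0 ℚ.* (tail g * h) n ℚ.+ (tail f * (g * h)) n)
      ≡⟨ ℚ.+-assoc (f 0 ℚ.* (g 0 ℚ.* h (suc n))) _ _ ⟨
    f 0 ℚ.* (g 0 ℚ.* h (suc n)) ℚ.+ f 0 ℚ.* (tail g * h) n ℚ.+ (tail f * (g * h)) n
      ≡⟨ cong (ℚ._+ (tail f * (g * h)) n) (ℚ.*-distribˡ-+ (f 0) (g 0 ℚ.* h (suc n)) _) ⟨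
    (f * (g * h)) (suc n) ∎
    where
    head-eq : (f * g) 0 ℚ.* h (suc n) ≡ f 0 ℚ.* (g 0 ℚ.* h (suc n))
    head-eq = trans (cong (ℚ._* h (suc n)) (*-constantTerm f g)) (ℚ.*-assoc (f 0) (g 0) (h (suc n)))
    tail-eq : (tail (f * g) * h) n ≡ f 0 ℚ.* (tail g * h) n ℚ.+ (tail f * (g * h)) n
    tail-eq = trans (*-distribʳˢ h (λ m → f 0 ℚ.* tail g m) (tail f * g) n)
      (cong₂ ℚ._+_ (*-scaleˡ (f 0) (tail g) h n) (*-assocˢ (tail f) g h n))

  -- Unfolding the definition peels off the first term of the convolution; commutativity also needs
  -- the last term peeled off.
  *-sucʳ : ∀ f g n → (f * g) (suc n) ≡ f (suc n) ℚ.* g 0 ℚ.+ (f * tail g) n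
  *-sucʳ f g zero = begin
    f 0 ℚ.* g 1 ℚ.+ (tail f * g) 0          ≡⟨ cong (f 0 ℚ.* g 1 ℚ.+_) (*-constantTerm (tail f) g) ⟩
    f 0 ℚ.* g 1 ℚ.+ f 1 ℚ.* g 0             ≡⟨ ℚ.+-comm (f 0 ℚ.* g 1) (f 1 ℚ.* g 0) ⟩
    f 1 ℚ.* g 0 ℚ.+ f 0 ℚ.* g 1             ≡⟨ cong (f 1 ℚ.* g 0 ℚ.+_) (*-constantTerm f (tail g)) ⟨
    f 1 ℚ.* g 0 ℚ.+ (f * tail g) 0          ∎
  *-sucʳ f g (suc n) = begin
    f 0 ℚ.* g (2 ℕ.+ n) ℚ.+ (tail f * g) (suc n)
      ≡⟨ cong (f 0 ℚ.* g (2 ℕ.+ n) ℚ.+_) (*-sucʳ (tail f) g n) ⟩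
    f 0 ℚ.* g (2 ℕ.+ n) ℚ.+ (f (2 ℕ.+ n) ℚ.* g 0 ℚ.+ (tail f * tail g) n)
      ≡⟨ x∙yz≈y∙xz (f 0 ℚ.* g (2 ℕ.+ n)) (f (2 ℕ.+ n) ℚ.* g 0) _ ⟩
    f (2 ℕ.+ n) ℚ.* g 0 ℚ.+ (f * tail g) (suc n) ∎

  *-commˢ : ∀ f g → f * g ≗ g * f
  *-commˢ f g zero = trans (*-constantTerm f g)
    (trans (ℚ.*-comm (f 0) (g 0)) (sym (*-constantTerm g f)))
  *-commˢ f g (suc n) = begin
    f 0 ℚ.* g (suc n) ℚ.+ (tail f * g) n
      ≡⟨ cong₂ ℚ._+_ (ℚ.*-comm (f 0) (g (suc n))) (*-commˢ (tail f) g n) ⟩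
    g (suc n) ℚ.* f 0 ℚ.+ (g * tail f) n
      ≡⟨ *-sucʳ g f n ⟨
    (g * f) (suc n) ∎

  *-zeroˡˢ : ∀ g → 0# * g ≗ 0#
  *-zeroˡˢ g zero    = trans (*-constantTerm 0# g) (ℚ.*-zeroˡ (g 0))
  *-zeroˡˢ g (suc n) = trans (cong₂ ℚ._+_ (ℚ.*-zeroˡ (g (suc n))) (*-zeroˡˢ g n)) (ℚ.+-identityʳ 0ℚ)

  *-identityˡˢ : ∀ g → 1# * g ≗ g
  *-identityˡˢ g zero    = trans (*-constantTerm 1# g) (ℚ.*-identityˡ (g 0))
  *-identityˡˢ g (suc n) = trans
    (cong₂ ℚ._+_ (ℚ.*-identityˡ (g (suc n))) (*-zeroˡˢ g n)) (ℚ.+-identityʳ (g (suc n)))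

  seriesRing : CommutativeRing 0ℓ 0ℓ
  seriesRing = record
    { RawRing rawRing
    ; isCommutativeRing = record
      { isRing = record
        { +-isAbelianGroup = record
          { isGroup = record
            { isMonoid = record
              { isSemigroup = record
                { isMagma = record
                  { isEquivalence = record
                    { refl = λ _ → refl ; sym = λ p n → sym (p n) ; trans = λ p q n → trans (p n) (q n) }
                  ; ∙-cong = λ p q n → cong₂ ℚ._+_ (p n) (q n) }
                ; assoc = λ f g h n → ℚ.+-assoc (f n) (g n) (h n) }
              ; identity = (λ f n → ℚ.+-identityˡ (f n)) , λ f n → ℚ.+-identityʳ (f n) }
            ; inverse = (λ f n → ℚ.+-inverseˡ (f n)) , λ f n → ℚ.+-inverseʳ (f n)
            ; ⁻¹-cong = λ p n → cong ℚ.-_ (p n) }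
          ; comm = λ f g n → ℚ.+-comm (f n) (g n) }
        ; *-cong = *-congˢ
        ; *-assoc = *-assocˢ
        ; *-identity = *-identityˡˢ , λ f n → trans (*-commˢ f 1# n) (*-identityˡˢ f n)
        ; distrib = (λ f g h n → trans (*-commˢ f (g + h) n) (trans (*-distribʳˢ f g h n)
                      (cong₂ ℚ._+_ (*-commˢ g f n) (*-commˢ h f n))))
                  , *-distribʳˢ
        }
      ; *-comm = *-commˢ
      }
    }

  DegreeBelow : ℕ → PowerSeries → Set
  DegreeBelow d f = ∀ n → d ≤ n → f n ≡ 0ℚ

  Finite : PowerSeries → Set
  Finite f = ∃[ d ] DegreeBelow d f

  -- `DegreeBelow` is a strict bound. The asymmetric form, degree at most `d` times degree below
  -- `e`, avoids losing one in the product, and this keeps the threshold exact.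
  *-degreeBelow : ∀ d e f g → DegreeBelow (suc d) f → DegreeBelow e g → DegreeBelow (d ℕ.+ e) (f * g)
  *-degreeBelow zero e f g f≡0 g≡0 zero e≤0 = trans (*-constantTerm f g)
    (trans (cong (f 0 ℚ.*_) (g≡0 0 e≤0)) (ℚ.*-zeroʳ (f 0)))
  *-degreeBelow zero e f g f≡0 g≡0 (suc n) e≤n = begin
    f 0 ℚ.* g (suc n) ℚ.+ (tail f * g) n
      ≡⟨ cong₂ ℚ._+_ (cong (f 0 ℚ.*_) (g≡0 (suc n) e≤n))
           (*-congˢ {tail f} {0#} {g} (λ m → f≡0 (suc m) (s≤s z≤n)) (λ _ → refl) n) ⟩
    f 0 ℚ.* 0ℚ ℚ.+ (0# * g) n
      ≡⟨ cong₂ ℚ._+_ (ℚ.*-zeroʳ (f 0)) (*-zeroˡˢ g n) ⟩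
    0ℚ ∎
  *-degreeBelow (suc d) e f g f≡0 g≡0 (suc n) (s≤s d+e≤n) = begin
    f 0 ℚ.* g (suc n) ℚ.+ (tail f * g) n
      ≡⟨ cong₂ ℚ._+_ (cong (f 0 ℚ.*_) (g≡0 (suc n) (ℕ.m≤n⇒m≤1+n (ℕ.m+n≤o⇒n≤o d d+e≤n))))
           (*-degreeBelow d e (tail f) g (λ m d≤m → f≡0 (suc m) (s≤s d≤m)) g≡0 n d+e≤n) ⟩
    f 0 ℚ.* 0ℚ ℚ.+ 0ℚ   ≡⟨ cong (ℚ._+ 0ℚ) (ℚ.*-zeroʳ (f 0)) ⟩
    0ℚ                  ∎

  +-degreeBelow : ∀ d e f g → DegreeBelow d f → DegreeBelow e g → DegreeBelow (d ℕ.+ e) (f + g)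
  +-degreeBelow d e f g f≡0 g≡0 n d+e≤n =
    cong₂ ℚ._+_ (f≡0 n (ℕ.m+n≤o⇒m≤o d d+e≤n)) (g≡0 n (ℕ.m+n≤o⇒n≤o d d+e≤n))

  -- Equality ignores the degree bound, so the ring laws are inherited from the series along
  -- `proj₁`. The bounds are crude on purpose: only their existence matters, and sharp degrees are
  -- recovered later by `descend`.
  polynomialRawRing : RawRing 0ℓ 0ℓ
  polynomialRawRing = record
    { Carrier = Σ[ f ∈ PowerSeries ] Finite f
    ; _≈_ = λ p q → proj₁ p ≗ proj₁ q
    ; _+_ = λ (f , d , f≡0) (g , e , g≡0) → f + g , d ℕ.+ e , +-degreeBelow d e f g f≡0 g≡0
    ; _*_ = λ (f , d , f≡0) (g , e , g≡0) → f * g , d ℕ.+ e ,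
        *-degreeBelow d e f g (λ n 1+d≤n → f≡0 n (ℕ.<⇒≤ 1+d≤n)) g≡0
    ; -_  = λ (f , d , f≡0) → - f , d , λ n d≤n → cong ℚ.-_ (f≡0 n d≤n)
    ; 0#  = 0# , 0 , λ _ _ → refl
    ; 1#  = 1# , 1 , λ { (suc n) _ → refl }
    }

  polynomialRing : CommutativeRing 0ℓ 0ℓ
  polynomialRing = record
    { RawRing polynomialRawRing
    ; isCommutativeRing = RingMonomorphism.isCommutativeRing proj₁-isRingMonomorphism
        (CommutativeRing.isCommutativeRing seriesRing)
    }
    where
    proj₁-isRingMonomorphism : IsRingMonomorphism polynomialRawRing rawRing proj₁
    proj₁-isRingMonomorphism = record
      { isRingHomomorphism = record
        { isSemiringHomomorphism = record
          { isNearSemiringHomomorphism = record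
            { +-isMonoidHomomorphism = record
              { isMagmaHomomorphism = record
                { isRelHomomorphism = record { cong = λ p → p }
                ; homo = λ _ _ _ → refl }
              ; ε-homo = λ _ → refl }
            ; *-homo = λ _ _ _ → refl }
          ; 1#-homo = λ _ → refl }
        ; -‿homo = λ _ _ → refl }
      ; injective = λ p → p }

  X : CommutativeRing.Carrier polynomialRing
  X = x , 2 , λ { (suc zero) (s≤s ()) ; (suc (suc n)) _ → refl }

-- Arithmetic of fromℕ

fromℕ-+ : ∀ m n → fromℕ (m ℕ.+ n) ≡ fromℕ m ℚ.+ fromℕ n
fromℕ-+ m n = ℚ.toℚᵘ-injective (begin-equality
  ℚ.toℚᵘ (fromℕ (m ℕ.+ n))                      ≃⟨ ℚ.toℚᵘ-fromℚᵘ (mkℚᵘ (+ (m ℕ.+ n)) 0) ⟩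
  mkℚᵘ (+ (m ℕ.+ n)) 0                          ≃⟨ *≡* (cong (ℤ._* + 1) (trans (ℤ.pos-+ m n)
                                                    (cong₂ ℤ._+_ (sym (ℤ.*-identityʳ (+ m))) (sym (ℤ.*-identityʳ (+ n)))))) ⟩
  mkℚᵘ (+ m) 0 ℚᵘ.+ mkℚᵘ (+ n) 0
    ≃⟨ ℚᵘ.+-cong (ℚ.toℚᵘ-fromℚᵘ (mkℚᵘ (+ m) 0)) (ℚ.toℚᵘ-fromℚᵘ (mkℚᵘ (+ n) 0)) ⟨
  ℚ.toℚᵘ (fromℕ m) ℚᵘ.+ ℚ.toℚᵘ (fromℕ n)        ≃⟨ ℚ.toℚᵘ-homo-+ (fromℕ m) (fromℕ n) ⟨
  ℚ.toℚᵘ (fromℕ m ℚ.+ fromℕ n)                  ∎)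
  where open ℚᵘ.≤-Reasoning

fromℕ-* : ∀ m n → fromℕ (m ℕ.* n) ≡ fromℕ m ℚ.* fromℕ n
fromℕ-* m n = ℚ.toℚᵘ-injective (begin-equality
  ℚ.toℚᵘ (fromℕ (m ℕ.* n))                      ≃⟨ ℚ.toℚᵘ-fromℚᵘ (mkℚᵘ (+ (m ℕ.* n)) 0) ⟩
  mkℚᵘ (+ (m ℕ.* n)) 0                          ≃⟨ *≡* (cong (ℤ._* + 1) (ℤ.pos-* m n)) ⟩
  mkℚᵘ (+ m) 0 ℚᵘ.* mkℚᵘ (+ n) 0
    ≃⟨ ℚᵘ.*-cong (ℚ.toℚᵘ-fromℚᵘ (mkℚᵘ (+ m) 0)) (ℚ.toℚᵘ-fromℚᵘ (mkℚᵘ (+ n) 0)) ⟨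
  ℚ.toℚᵘ (fromℕ m) ℚᵘ.* ℚ.toℚᵘ (fromℕ n)        ≃⟨ ℚ.toℚᵘ-homo-* (fromℕ m) (fromℕ n) ⟨
  ℚ.toℚᵘ (fromℕ m ℚ.* fromℕ n)                  ∎)
  where open ℚᵘ.≤-Reasoning

/-*-cancel : ∀ m n .{{_ : NonZero n}} → (+ m ℚ./ n) ℚ.* fromℕ n ≡ fromℕ m
/-*-cancel m n@(suc n-1) = ℚ.toℚᵘ-injective (begin-equality
  ℚ.toℚᵘ ((+ m ℚ./ n) ℚ.* fromℕ n)              ≃⟨ ℚ.toℚᵘ-homo-* (+ m ℚ./ n) (fromℕ n) ⟩
  ℚ.toℚᵘ (+ m ℚ./ n) ℚᵘ.* ℚ.toℚᵘ (fromℕ n)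
    ≃⟨ ℚᵘ.*-cong (ℚ.toℚᵘ-fromℚᵘ (mkℚᵘ (+ m) n-1)) (ℚ.toℚᵘ-fromℚᵘ (mkℚᵘ (+ n) 0)) ⟩
  mkℚᵘ (+ m) n-1 ℚᵘ.* mkℚᵘ (+ n) 0              ≃⟨ *≡* (trans (ℤ.*-identityʳ (+ m ℤ.* + n))
                                                    (cong (λ d → + m ℤ.* + d) (sym (ℕ.*-identityʳ n)))) ⟩
  mkℚᵘ (+ m) 0                                  ≃⟨ ℚ.toℚᵘ-fromℚᵘ (mkℚᵘ (+ m) 0) ⟨
  ℚ.toℚᵘ (fromℕ m)                              ∎)
  where open ℚᵘ.≤-Reasoning

fromℕ-pos : ∀ n .{{_ : NonZero n}} → ℚ.Positive (fromℕ n)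
fromℕ-pos n = ℚ.normalize-pos n 1

*fromℕ-cancelʳ : ∀ n .{{_ : NonZero n}} {p q} → p ℚ.* fromℕ n ≡ q ℚ.* fromℕ n → p ≡ q
*fromℕ-cancelʳ n {p} {q} pn≡qn = begin
  p                                  ≡⟨ ℚ.*-identityʳ p ⟨
  p ℚ.* 1ℚ                           ≡⟨ cong (p ℚ.*_) (ℚ.*-inverseʳ (fromℕ n)) ⟨
  p ℚ.* (fromℕ n ℚ.* n⁻¹)            ≡⟨ ℚ.*-assoc p (fromℕ n) n⁻¹ ⟨
  p ℚ.* fromℕ n ℚ.* n⁻¹              ≡⟨ cong (ℚ._* n⁻¹) pn≡qn ⟩
  q ℚ.* fromℕ n ℚ.* n⁻¹              ≡⟨ ℚ.*-assoc q (fromℕ n) n⁻¹ ⟩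
  q ℚ.* (fromℕ n ℚ.* n⁻¹)            ≡⟨ cong (q ℚ.*_) (ℚ.*-inverseʳ (fromℕ n)) ⟩
  q ℚ.* 1ℚ                           ≡⟨ ℚ.*-identityʳ q ⟩
  q                                  ∎
  where
  open ≡-Reasoning
  instance _ = ℚ.pos⇒nonZero (fromℕ n) {{fromℕ-pos n}}
  n⁻¹ = ℚ.1/ fromℕ n

-- Newton interpolation

-- The coefficients of `c + (a + b X) p`, one Horner step of the Newton form. The first argument
-- carries the part `b d` of each product into the next coefficient.
affine : (c a b : ℚ) → Polynomial → Polynomial
affine c a b []      = c ∷ []
affine c a b (d ∷ p) = (c ℚ.+ a ℚ.* d) ∷ affine (b ℚ.* d) a b p

eval-affine : ∀ c a b p y → eval (affine c a b p) y ≡ c ℚ.+ (a ℚ.+ b ℚ.* y) ℚ.* eval p y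
eval-affine c a b []      y = solve 3 (λ c y d → c :+ y :* con 0ℚ := c :+ d :* con 0ℚ) refl c y (a ℚ.+ b ℚ.* y)
  where open +-*-Solver
eval-affine c a b (d ∷ p) y = trans
  (cong (λ z → c ℚ.+ a ℚ.* d ℚ.+ y ℚ.* z) (eval-affine (b ℚ.* d) a b p y))
  (solve 6 (λ c a b d y e → c :+ a :* d :+ y :* (b :* d :+ (a :+ b :* y) :* e)
                            := c :+ (a :+ b :* y) :* (d :+ y :* e)) refl c a b d y (eval p y))
  where open +-*-Solver

coeff-affine-suc : ∀ c a b p i → coeff (affine c a b p) (suc i) ≡ a ℚ.* coeff p (suc i) ℚ.+ b ℚ.* coeff p i
coeff-affine-suc c a b []      i       = solve 2 (λ a b → con 0ℚ := a :* con 0ℚ :+ b :* con 0ℚ) refl a b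
  where open +-*-Solver
coeff-affine-suc c a b (d ∷ []) zero   = solve 3 (λ a b d → b :* d := a :* con 0ℚ :+ b :* d) refl a b d
  where open +-*-Solver
coeff-affine-suc c a b (d ∷ d′ ∷ p) zero = ℚ.+-comm (b ℚ.* d) (a ℚ.* d′)
coeff-affine-suc c a b (d ∷ p) (suc i) = coeff-affine-suc (b ℚ.* d) a b p i

length-affine : ∀ c a b p → length (affine c a b p) ≡ suc (length p)
length-affine c a b []      = refl
length-affine c a b (d ∷ p) = cong suc (length-affine (b ℚ.* d) a b p)

coeff-≥-length : ∀ p i → length p ≤ i → coeff p i ≡ 0ℚ
coeff-≥-length []      i       _         = refl
coeff-≥-length (a ∷ p) (suc i) (s≤s p≤i) = coeff-≥-length p i p≤i

choose : ℕ → ℕ → ℚ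
choose t       zero    = 1ℚ
choose zero    (suc i) = 0ℚ
choose (suc t) (suc i) = choose t i ℚ.+ choose t (suc i)

-- This ratio of consecutive binomial coefficients is the linear factor of the nested Newton form.
-- The difference is taken in ℚ, so no condition `i ≤ t` arises: for `t < i` both binomial
-- coefficients are zero.
choose-absorb : ∀ t i → fromℕ (suc i) ℚ.* choose t (suc i) ≡ (fromℕ t ℚ.- fromℕ i) ℚ.* choose t i
choose-absorb zero    zero    = refl
choose-absorb zero    (suc i) = trans (ℚ.*-zeroʳ (fromℕ (2 ℕ.+ i))) (sym (ℚ.*-zeroʳ (0ℚ ℚ.- fromℕ (suc i))))
choose-absorb (suc t) zero    = begin
  1ℚ ℚ.* (1ℚ ℚ.+ choose t 1)            ≡⟨ ℚ.*-distribˡ-+ 1ℚ 1ℚ (choose t 1) ⟩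
  1ℚ ℚ.* 1ℚ ℚ.+ 1ℚ ℚ.* choose t 1       ≡⟨ cong (1ℚ ℚ.* 1ℚ ℚ.+_) (choose-absorb t 0) ⟩
  1ℚ ℚ.* 1ℚ ℚ.+ (fromℕ t ℚ.- 0ℚ) ℚ.* 1ℚ ≡⟨ solve 1 (λ t → con 1ℚ :* con 1ℚ :+ (t :- con 0ℚ) :* con 1ℚ
                                             := (con 1ℚ :+ t :- con 0ℚ) :* con 1ℚ) refl (fromℕ t) ⟩
  (1ℚ ℚ.+ fromℕ t ℚ.- 0ℚ) ℚ.* 1ℚ        ≡⟨ cong (λ s → (s ℚ.- 0ℚ) ℚ.* 1ℚ) (fromℕ-+ 1 t) ⟨
  (fromℕ (suc t) ℚ.- 0ℚ) ℚ.* 1ℚ         ∎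
  where
  open ≡-Reasoning
  open +-*-Solver
choose-absorb (suc t) (suc i) = begin
  fromℕ (2 ℕ.+ i) ℚ.* (c₁ ℚ.+ c₂)
    ≡⟨ ℚ.*-distribˡ-+ (fromℕ (2 ℕ.+ i)) c₁ c₂ ⟩
  fromℕ (2 ℕ.+ i) ℚ.* c₁ ℚ.+ fromℕ (2 ℕ.+ i) ℚ.* c₂
    ≡⟨ cong₂ ℚ._+_ (cong (ℚ._* c₁) (fromℕ-+ 1 (suc i))) (choose-absorb t (suc i)) ⟩
  (1ℚ ℚ.+ fromℕ (suc i)) ℚ.* c₁ ℚ.+ (fromℕ t ℚ.- fromℕ (suc i)) ℚ.* c₁
    ≡⟨ cong (λ s → (1ℚ ℚ.+ s) ℚ.* c₁ ℚ.+ (fromℕ t ℚ.- s) ℚ.* c₁) (fromℕ-+ 1 i) ⟩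
  (1ℚ ℚ.+ (1ℚ ℚ.+ fromℕ i)) ℚ.* c₁ ℚ.+ (fromℕ t ℚ.- (1ℚ ℚ.+ fromℕ i)) ℚ.* c₁
    ≡⟨ solve 3 (λ t i c → (con 1ℚ :+ (con 1ℚ :+ i)) :* c :+ (t :- (con 1ℚ :+ i)) :* c
                          := (con 1ℚ :+ i) :* c :+ (t :- i) :* c) refl (fromℕ t) (fromℕ i) c₁ ⟩
  (1ℚ ℚ.+ fromℕ i) ℚ.* c₁ ℚ.+ (fromℕ t ℚ.- fromℕ i) ℚ.* c₁
    ≡⟨ cong (λ s → s ℚ.* c₁ ℚ.+ (fromℕ t ℚ.- fromℕ i) ℚ.* c₁) (fromℕ-+ 1 i) ⟨
  fromℕ (suc i) ℚ.* c₁ ℚ.+ (fromℕ t ℚ.- fromℕ i) ℚ.* c₁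
    ≡⟨ cong (ℚ._+ (fromℕ t ℚ.- fromℕ i) ℚ.* c₁) (choose-absorb t i) ⟩
  (fromℕ t ℚ.- fromℕ i) ℚ.* c₀ ℚ.+ (fromℕ t ℚ.- fromℕ i) ℚ.* c₁
    ≡⟨ solve 4 (λ t i c d → (t :- i) :* c :+ (t :- i) :* d
                            := (con 1ℚ :+ t :- (con 1ℚ :+ i)) :* (c :+ d)) refl (fromℕ t) (fromℕ i) c₀ c₁ ⟩
  (1ℚ ℚ.+ fromℕ t ℚ.- (1ℚ ℚ.+ fromℕ i)) ℚ.* (c₀ ℚ.+ c₁)
    ≡⟨ cong₂ (λ s s′ → (s ℚ.- s′) ℚ.* (c₀ ℚ.+ c₁)) (fromℕ-+ 1 t) (fromℕ-+ 1 i) ⟨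
  (fromℕ (suc t) ℚ.- fromℕ (suc i)) ℚ.* (c₀ ℚ.+ c₁) ∎
  where
  open ≡-Reasoning
  open +-*-Solver
  c₀ = choose t i
  c₁ = choose t (suc i)
  c₂ = choose t (2 ℕ.+ i)

-- The Newton series with terms `a j · C(t, i + j)` for `j ≤ m`. The shift `i` allows recursion on
-- `m` from the lowest term.
newton : ℕ → ℕ → (ℕ → ℚ) → ℕ → ℚ
newton i zero    a t = a 0 ℚ.* choose t i
newton i (suc m) a t = a 0 ℚ.* choose t i ℚ.+ newton (suc i) m (a ∘ suc) t

newton-zero : ∀ i m a → newton (suc i) m a 0 ≡ 0ℚ
newton-zero i zero    a = ℚ.*-zeroʳ (a 0)
newton-zero i (suc m) a = cong₂ ℚ._+_ (ℚ.*-zeroʳ (a 0)) (newton-zero (suc i) m (a ∘ suc))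

newton-suc : ∀ i m a t → newton (suc i) m a (suc t) ≡ newton (suc i) m a t ℚ.+ newton i m a t
newton-suc i zero    a t = solve 3 (λ a c d → a :* (c :+ d) := a :* d :+ a :* c) refl (a 0) (choose t i) (choose t (suc i))
  where open +-*-Solver
newton-suc i (suc m) a t = trans
  (cong (a 0 ℚ.* (choose t i ℚ.+ choose t (suc i)) ℚ.+_) (newton-suc (suc i) m (a ∘ suc) t))
  (solve 5 (λ a c d e f → a :* (c :+ d) :+ (e :+ f) := (a :* d :+ e) :+ (a :* c :+ f)) refl
    (a 0) (choose t i) (choose t (suc i)) (newton (2 ℕ.+ i) m (a ∘ suc) t) (newton (suc i) m (a ∘ suc) t))
  where open +-*-Solver

-- Differences with step `L` and the interpolating polynomial

module _ (L : ℕ) .{{_ : NonZero L}} where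

  ∂ : PowerSeries → PowerSeries
  ∂ f n = f (L ℕ.+ n) ℚ.- f n

  ∂^ : ℕ → PowerSeries → PowerSeries
  ∂^ zero    f = f
  ∂^ (suc m) f = ∂^ m (∂ f)

  -- Newton's forward difference formula along the progression `n₀ + t L`; it ends at order `m`
  -- because the next difference vanishes from `n₀` on.
  newton-∂ : ∀ m f n₀ → (∀ n → n₀ ≤ n → ∂^ (suc m) f n ≡ 0ℚ) →
             ∀ t → f (t ℕ.* L ℕ.+ n₀) ≡ newton 0 m (λ j → ∂^ j f n₀) t
  newton-∂ m       f n₀ ∂f≡0 (suc t) = begin
    f (L ℕ.+ t ℕ.* L ℕ.+ n₀)              ≡⟨ cong f (ℕ.+-assoc L (t ℕ.* L) n₀) ⟩
    f (L ℕ.+ n)                           ≡⟨ solve 2 (λ a b → a := b :+ (a :- b)) refl (f (L ℕ.+ n)) (f n) ⟩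
    f n ℚ.+ ∂ f n                         ≡⟨ step m f ∂f≡0 (newton-∂ m f n₀ ∂f≡0 t) ⟩
    newton 0 m (λ j → ∂^ j f n₀) (suc t)  ∎
    where
    open ≡-Reasoning
    open +-*-Solver
    n = t ℕ.* L ℕ.+ n₀
    -- The formula for `f` is known at `t`, and the one for `∂ f` has lower order; Pascal's rule in
    -- the form `newton-suc` adds them up to the formula at `suc t`.
    step : ∀ m f → (∀ n → n₀ ≤ n → ∂^ (suc m) f n ≡ 0ℚ) → f n ≡ newton 0 m (λ j → ∂^ j f n₀) t →
           f n ℚ.+ ∂ f n ≡ newton 0 m (λ j → ∂^ j f n₀) (suc t)
    step zero f ∂f≡0 f≡ = trans (cong (f n ℚ.+_) (∂f≡0 n (ℕ.m≤n+m n₀ (t ℕ.* L)))) (trans (ℚ.+-identityʳ (f n)) f≡)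
    step (suc m) f ∂f≡0 f≡ = begin
      f n ℚ.+ ∂ f n
        ≡⟨ cong₂ ℚ._+_ f≡ (newton-∂ m (∂ f) n₀ ∂f≡0 t) ⟩
      f n₀ ℚ.* 1ℚ ℚ.+ u ℚ.+ v
        ≡⟨ ℚ.+-assoc (f n₀ ℚ.* 1ℚ) u v ⟩
      f n₀ ℚ.* 1ℚ ℚ.+ (u ℚ.+ v)
        ≡⟨ cong (f n₀ ℚ.* 1ℚ ℚ.+_) (newton-suc 0 m (λ j → ∂^ j (∂ f) n₀) t) ⟨
      newton 0 (suc m) (λ j → ∂^ j f n₀) (suc t) ∎
      where
      u = newton 1 m (λ j → ∂^ j (∂ f) n₀) t
      v = newton 0 m (λ j → ∂^ j (∂ f) n₀) t
  newton-∂ zero    f n₀ ∂f≡0 zero    = sym (ℚ.*-identityʳ (f n₀))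
  newton-∂ (suc m) f n₀ ∂f≡0 zero    = begin
    f n₀                                    ≡⟨ solve 1 (λ a → a := a :* con 1ℚ :+ con 0ℚ) refl (f n₀) ⟩
    f n₀ ℚ.* 1ℚ ℚ.+ 0ℚ
      ≡⟨ cong (f n₀ ℚ.* 1ℚ ℚ.+_) (newton-zero 0 m (λ j → ∂^ j (∂ f) n₀)) ⟨
    newton 0 (suc m) (λ j → ∂^ j f n₀) 0    ∎
    where
    open ≡-Reasoning
    open +-*-Solver

  module _ (n₀ : ℕ) where

    -- The linear factor ((y - n₀) / L - i) / (i + 1) taking C(t, i) to C(t, i + 1)
    -- at y = n₀ + t L is  offset i + slope i · y.
    slope offset : ℕ → ℚ
    slope  i = (+ 1 ℚ./ (L ℕ.* suc i)) {{ℕ.m*n≢0 L (suc i)}}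
    offset i = ℚ.- (fromℕ (i ℕ.* L ℕ.+ n₀) ℚ.* slope i)

    -- The Newton series with the common factor `C(t, i)` divided out and the rest nested as in
    -- Horner's scheme. At `i = 0` that factor is 1, and the polynomial interpolates the series
    -- itself.
    newtonPolynomial : ℕ → ℕ → (ℕ → ℚ) → Polynomial
    newtonPolynomial i zero    a = a 0 ∷ []
    newtonPolynomial i (suc m) a = affine (a 0) (offset i) (slope i) (newtonPolynomial (suc i) m (a ∘ suc))

    slope≡ : ∀ i → slope i ℚ.* (fromℕ L ℚ.* fromℕ (suc i)) ≡ 1ℚ
    slope≡ i = trans (cong (slope i ℚ.*_) (sym (fromℕ-* L (suc i))))
      (/-*-cancel 1 (L ℕ.* suc i) {{ℕ.m*n≢0 L (suc i)}})

    choose-suc : ∀ t i → choose t i ℚ.* (offset i ℚ.+ slope i ℚ.* fromℕ (t ℕ.* L ℕ.+ n₀)) ≡ choose t (suc i)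
    choose-suc t i = begin
      b ℚ.* (ℚ.- (fromℕ (i ℕ.* L ℕ.+ n₀) ℚ.* s) ℚ.+ s ℚ.* fromℕ (t ℕ.* L ℕ.+ n₀))
        ≡⟨ cong₂ (λ u v → b ℚ.* (ℚ.- (u ℚ.* s) ℚ.+ s ℚ.* v)) (expand i) (expand t) ⟩
      b ℚ.* (ℚ.- ((fromℕ i ℚ.* l ℚ.+ fromℕ n₀) ℚ.* s) ℚ.+ s ℚ.* (fromℕ t ℚ.* l ℚ.+ fromℕ n₀))
        ≡⟨ solve 6 (λ c i l n s t → c :* (:- ((i :* l :+ n) :* s) :+ s :* (t :* l :+ n)) := s :* l :* ((t :- i) :* c))
             refl b (fromℕ i) l (fromℕ n₀) s (fromℕ t) ⟩
      s ℚ.* l ℚ.* ((fromℕ t ℚ.- fromℕ i) ℚ.* b)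
        ≡⟨ cong (s ℚ.* l ℚ.*_) (choose-absorb t i) ⟨
      s ℚ.* l ℚ.* (fromℕ (suc i) ℚ.* choose t (suc i))
        ≡⟨ solve 4 (λ s l i c → s :* l :* (i :* c) := s :* (l :* i) :* c) refl s l (fromℕ (suc i)) (choose t (suc i)) ⟩
      s ℚ.* (l ℚ.* fromℕ (suc i)) ℚ.* choose t (suc i)
        ≡⟨ cong (ℚ._* choose t (suc i)) (slope≡ i) ⟩
      1ℚ ℚ.* choose t (suc i)
        ≡⟨ ℚ.*-identityˡ (choose t (suc i)) ⟩
      choose t (suc i) ∎
      where
      open ≡-Reasoning
      open +-*-Solver
      b = choose t i
      s = slope i
      l = fromℕ L
      expand : ∀ i → fromℕ (i ℕ.* L ℕ.+ n₀) ≡ fromℕ i ℚ.* l ℚ.+ fromℕ n₀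
      expand i = trans (fromℕ-+ (i ℕ.* L) n₀) (cong (ℚ._+ fromℕ n₀) (fromℕ-* i L))

    eval-newtonPolynomial : ∀ i m a t →
      choose t i ℚ.* eval (newtonPolynomial i m a) (fromℕ (t ℕ.* L ℕ.+ n₀)) ≡ newton i m a t
    eval-newtonPolynomial i zero    a t = solve 3 (λ c a y → c :* (a :+ y :* con 0ℚ) := a :* c) refl
      (choose t i) (a 0) (fromℕ (t ℕ.* L ℕ.+ n₀))
      where open +-*-Solver
    eval-newtonPolynomial i (suc m) a t = begin
      b ℚ.* eval (affine (a 0) (offset i) (slope i) p) y
        ≡⟨ cong (b ℚ.*_) (eval-affine (a 0) (offset i) (slope i) p y) ⟩
      b ℚ.* (a 0 ℚ.+ (offset i ℚ.+ slope i ℚ.* y) ℚ.* eval p y)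
        ≡⟨ solve 4 (λ c a d e → c :* (a :+ d :* e) := a :* c :+ (c :* d) :* e) refl b (a 0) (offset i ℚ.+ slope i ℚ.* y) (eval p y) ⟩
      a 0 ℚ.* b ℚ.+ b ℚ.* (offset i ℚ.+ slope i ℚ.* y) ℚ.* eval p y
        ≡⟨ cong (λ d → a 0 ℚ.* b ℚ.+ d ℚ.* eval p y) (choose-suc t i) ⟩
      a 0 ℚ.* b ℚ.+ choose t (suc i) ℚ.* eval p y
        ≡⟨ cong (a 0 ℚ.* b ℚ.+_) (eval-newtonPolynomial (suc i) m (a ∘ suc) t) ⟩
      newton i (suc m) a t ∎
      where
      open ≡-Reasoning
      open +-*-Solver
      b = choose t i
      y = fromℕ (t ℕ.* L ℕ.+ n₀)
      p = newtonPolynomial (suc i) m (a ∘ suc)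

    length-newtonPolynomial : ∀ i m a → length (newtonPolynomial i m a) ≡ suc m
    length-newtonPolynomial i zero    a = refl
    length-newtonPolynomial i (suc m) a =
      trans (length-affine (a 0) (offset i) (slope i) (newtonPolynomial (suc i) m (a ∘ suc)))
        (cong suc (length-newtonPolynomial (suc i) m (a ∘ suc)))

    newtonPolynomial-degree : ∀ i m a → DegreeAtMost m (newtonPolynomial i m a)
    newtonPolynomial-degree i m a j m<j =
      coeff-≥-length (newtonPolynomial i m a) j (subst (_≤ j) (sym (length-newtonPolynomial i m a)) m<j)

    -- The top coefficient is `a m` times the slopes `1 / (L (j + 1))` for `i ≤ j < i + m`, and
    -- their product telescopes to `i! / (L^m (i + m)!)`.
    coeff-newtonPolynomial : ∀ i m a →
      coeff (newtonPolynomial i m a) m ℚ.* fromℕ (L ℕ.^ m ℕ.* (i ℕ.+ m) !) ≡ a m ℚ.* fromℕ (i !)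
    coeff-newtonPolynomial i zero    a = cong (λ n → a 0 ℚ.* fromℕ n)
      (trans (ℕ.*-identityˡ _) (cong _! (ℕ.+-identityʳ i)))
    coeff-newtonPolynomial i (suc m) a = *fromℕ-cancelʳ (suc i) (begin
      coeff (affine (a 0) (offset i) s p) (suc m) ℚ.* fromℕ (L ℕ.* L ℕ.^ m ℕ.* (i ℕ.+ suc m) !) ℚ.* fromℕ (suc i)
        ≡⟨ cong₂ (λ u v → u ℚ.* v ℚ.* fromℕ (suc i)) top fact ⟩
      s ℚ.* coeff p m ℚ.* (fromℕ L ℚ.* f) ℚ.* fromℕ (suc i)
        ≡⟨ solve 5 (λ s c l f i → s :* c :* (l :* f) :* i := s :* (l :* i) :* (c :* f)) refl s (coeff p m) (fromℕ L) f (fromℕ (suc i)) ⟩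
      s ℚ.* (fromℕ L ℚ.* fromℕ (suc i)) ℚ.* (coeff p m ℚ.* f)
        ≡⟨ cong₂ ℚ._*_ (slope≡ i) (coeff-newtonPolynomial (suc i) m (a ∘ suc)) ⟩
      1ℚ ℚ.* (a (suc m) ℚ.* fromℕ (suc i !))
        ≡⟨ cong (λ n → 1ℚ ℚ.* (a (suc m) ℚ.* n)) (fromℕ-* (suc i) (i !)) ⟩
      1ℚ ℚ.* (a (suc m) ℚ.* (fromℕ (suc i) ℚ.* fromℕ (i !)))
        ≡⟨ solve 3 (λ a i f → con 1ℚ :* (a :* (i :* f)) := a :* f :* i) refl (a (suc m)) (fromℕ (suc i)) (fromℕ (i !)) ⟩
      a (suc m) ℚ.* fromℕ (i !) ℚ.* fromℕ (suc i) ∎)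
      where
      open ≡-Reasoning
      open +-*-Solver
      s = slope i
      p = newtonPolynomial (suc i) m (a ∘ suc)
      f = fromℕ (L ℕ.^ m ℕ.* (suc i ℕ.+ m) !)
      top : coeff (affine (a 0) (offset i) s p) (suc m) ≡ s ℚ.* coeff p m
      top = trans (coeff-affine-suc (a 0) (offset i) s p m)
        (trans (cong (λ u → offset i ℚ.* u ℚ.+ s ℚ.* coeff p m)
                 (newtonPolynomial-degree (suc i) m (a ∘ suc) (suc m) ℕ.≤-refl))
               (solve 2 (λ o u → o :* con 0ℚ :+ u := u) refl (offset i) (s ℚ.* coeff p m)))
      fact : fromℕ (L ℕ.* L ℕ.^ m ℕ.* (i ℕ.+ suc m) !) ≡ fromℕ L ℚ.* f
      fact = trans (cong fromℕ (trans (ℕ.*-assoc L (L ℕ.^ m) _)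
        (cong (λ j → L ℕ.* (L ℕ.^ m ℕ.* j !)) (ℕ.+-suc i m)))) (fromℕ-* L _)

open Series using (1#; x; _+_; _-_; _*_; -_; _÷_)
open CommutativeRing seriesRing using () renaming
  ( *-assoc to *ˢ-assoc; *-comm to *ˢ-comm; *-identityˡ to *ˢ-identityˡ; *-identityʳ to *ˢ-identityʳ
  ; *-cong to *ˢ-cong; *-congˡ to *ˢ-congˡ; *-congʳ to *ˢ-congʳ
  ; zeroˡ to zeroˡˢ; distribʳ to distribʳˢ; setoid to seriesSetoid )
open RingLemmas seriesRing using (_^_; ^-congˡ; ∏<; ∏<-suc; ∏<-cong; ∏<-*; geometric)
open BinomialFactors seriesRing x
  using (1+x^_; 1-x^_; 1+x^-affine; 1-x^-affine; [1-x^][1+x^]; cleared)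
open RawSemiringDefs ℚ.+-*-rawSemiring using () renaming (_^_ to _^ℚ_)
open RawSemiringDefs ℕ.+-*-rawSemiring using () renaming (product to ∏)
module ∏ℚ = RingLemmas ℚ.+-*-commutativeRing

-- Cancelling units, and multiplication by powers of `x` as a shift of coefficients

*-cancel-unit : ∀ u f g → u 0 ≡ 1ℚ → u * f ≗ u * g → f ≗ g
*-cancel-unit u f g u₀≡1 uf≗ug = begin
  f               ≈⟨ *ˢ-identityˡ f ⟨
  1# * f          ≈⟨ *ˢ-congʳ {f} {v * u} {1#} vu≗1 ⟨
  (v * u) * f     ≈⟨ *ˢ-assoc v u f ⟩
  v * (u * f)     ≈⟨ *ˢ-congˡ {v} {u * f} {u * g} uf≗ug ⟩
  v * (u * g)     ≈⟨ *ˢ-assoc v u g ⟨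
  (v * u) * g     ≈⟨ *ˢ-congʳ {g} {v * u} {1#} vu≗1 ⟩
  1# * g          ≈⟨ *ˢ-identityˡ g ⟩
  g               ∎
  where
  open import Relation.Binary.Reasoning.Setoid seriesSetoid
  v = 1# ÷ u
  vu≗1 : v * u ≗ 1#
  vu≗1 n = trans (*ˢ-comm v u n) (Series.÷-correct 1# u u₀≡1 n)

x*-zero : ∀ f → (x * f) 0 ≡ 0ℚ
x*-zero f = trans (*-constantTerm x f) (ℚ.*-zeroˡ (f 0))

x*-suc : ∀ f n → (x * f) (suc n) ≡ f n
x*-suc f n = begin
  0ℚ ℚ.* f (suc n) ℚ.+ (tail x * f) n
    ≡⟨ cong₂ ℚ._+_ (ℚ.*-zeroˡ (f (suc n))) (*ˢ-cong {tail x} {1#} {f} {f} tail-x (λ _ → refl) n) ⟩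
  0ℚ ℚ.+ (1# * f) n                     ≡⟨ ℚ.+-identityˡ _ ⟩
  (1# * f) n                            ≡⟨ *ˢ-identityˡ f n ⟩
  f n                                   ∎
  where
  open ≡-Reasoning
  tail-x : tail x ≗ 1#
  tail-x zero    = refl
  tail-x (suc n) = refl

x^*-+ : ∀ e f n → (x ^ e * f) (e ℕ.+ n) ≡ f n
x^*-+ zero    f n = *ˢ-identityˡ f n
x^*-+ (suc e) f n = trans (*ˢ-assoc x (x ^ e) f (suc e ℕ.+ n))
  (trans (x*-suc (x ^ e * f) (e ℕ.+ n)) (x^*-+ e f n))

x^*-< : ∀ e f n → n < e → (x ^ e * f) n ≡ 0ℚ
x^*-< (suc e) f zero    _         = trans (*ˢ-assoc x (x ^ e) f 0) (x*-zero (x ^ e * f))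
x^*-< (suc e) f (suc n) (s≤s n<e) = trans (*ˢ-assoc x (x ^ e) f (suc n))
  (trans (x*-suc (x ^ e * f) n) (x^*-< e f n n<e))

-*-distrib : ∀ u f → (- u) * f ≗ - (u * f)
-*-distrib u f n = sym (-‿distribˡ-* u f n)
  where open import Algebra.Properties.Ring (CommutativeRing.ring seriesRing) using (-‿distribˡ-*)

[1+]-* : ∀ u f n → ((1# + u) * f) n ≡ f n ℚ.+ (u * f) n
[1+]-* u f n = trans (distribʳˢ f 1# u n) (cong (ℚ._+ (u * f) n) (*ˢ-identityˡ f n))

[1-]-* : ∀ u f n → ((1# - u) * f) n ≡ f n ℚ.- (u * f) n
[1-]-* u f n = trans ([1+]-* (- u) f n) (cong (f n ℚ.+_) (-*-distrib u f n))

1+x^*-+ : ∀ e f n → (1+x^ e * f) (e ℕ.+ n) ≡ f (e ℕ.+ n) ℚ.+ f n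
1+x^*-+ e f n = trans ([1+]-* (x ^ e) f (e ℕ.+ n)) (cong (f (e ℕ.+ n) ℚ.+_) (x^*-+ e f n))

1-x^*-+ : ∀ e f n → (1-x^ e * f) (e ℕ.+ n) ≡ f (e ℕ.+ n) ℚ.- f n
1-x^*-+ e f n = trans ([1-]-* (x ^ e) f (e ℕ.+ n)) (cong (λ a → f (e ℕ.+ n) ℚ.- a) (x^*-+ e f n))

∏<-constantTerm : ∀ n f → (∀ i → f i 0 ≡ 1ℚ) → ∏< n f 0 ≡ 1ℚ
∏<-constantTerm zero    f f₀≡1 = refl
∏<-constantTerm (suc n) f f₀≡1 = *-constantTerm-1 (∏< n f) (f n) (∏<-constantTerm n f f₀≡1) (f₀≡1 n)

^-constantTerm : ∀ n f → f 0 ≡ 1ℚ → (f ^ n) 0 ≡ 1ℚ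
^-constantTerm zero    f f₀≡1 = refl
^-constantTerm (suc n) f f₀≡1 = *-constantTerm-1 f (f ^ n) f₀≡1 (^-constantTerm n f f₀≡1)

-- Coefficients and degrees of products

DegreeBelow-resp : ∀ {d f g} → f ≗ g → DegreeBelow d f → DegreeBelow d g
DegreeBelow-resp f≗g f≡0 n d≤n = trans (sym (f≗g n)) (f≡0 n d≤n)

Finite-resp : ∀ {f g} → f ≗ g → Finite f → Finite g
Finite-resp {f} {g} f≗g (d , f≡0) = d , DegreeBelow-resp {d} {f} {g} f≗g f≡0

Finite-* : ∀ {f g} → Finite f → Finite g → Finite (f * g)
Finite-* {f} {g} f-finite g-finite = proj₂ (CommutativeRing._*_ polynomialRing (f , f-finite) (g , g-finite))

1#-degree : DegreeBelow 1 1#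
1#-degree (suc n) _ = refl

x^-degree : ∀ e → DegreeBelow (suc e) (x ^ e)
x^-degree e n e<n = trans (sym (*ˢ-identityʳ (x ^ e) n))
  (trans (cong (x ^ e * 1#) (sym (ℕ.m+[n∸m]≡n (ℕ.<⇒≤ e<n))))
    (trans (x^*-+ e 1# (n ∸ e)) (1#-degree (n ∸ e) (ℕ.m<n⇒0<n∸m e<n))))

1+x^-degree : ∀ e → DegreeBelow (suc e) (1+x^ e)
1+x^-degree e n e<n = cong₂ ℚ._+_ (1#-degree n (ℕ.≤-trans (s≤s z≤n) e<n)) (x^-degree e n e<n)

1-x^-degree : ∀ e → DegreeBelow (suc e) (1-x^ e)
1-x^-degree e n e<n = cong₂ ℚ._-_ (1#-degree n (ℕ.≤-trans (s≤s z≤n) e<n)) (x^-degree e n e<n)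

Σ< : ℕ → (ℕ → ℕ) → ℕ
Σ< zero    e = 0
Σ< (suc n) e = Σ< n e ℕ.+ e n

∏<-degree : ∀ n f e → (∀ i → DegreeBelow (suc (e i)) (f i)) → DegreeBelow (suc (Σ< n e)) (∏< n f)
∏<-degree zero    f e f≡0 = 1#-degree
∏<-degree (suc n) f e f≡0 = subst (λ d → DegreeBelow d (∏< n f * f n)) (ℕ.+-suc (Σ< n e) (e n))
  (*-degreeBelow (Σ< n e) (suc (e n)) (∏< n f) (f n) (∏<-degree n f e f≡0) (f≡0 n))

^-degree : ∀ n f d → DegreeBelow (suc d) f → DegreeBelow (suc (n ℕ.* d)) (f ^ n)
^-degree zero    f d f≡0 = 1#-degree
^-degree (suc n) f d f≡0 = subst (λ e → DegreeBelow e (f * f ^ n)) (ℕ.+-suc d (n ℕ.* d))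
  (*-degreeBelow d (suc (n ℕ.* d)) f (f ^ n) f≡0 (^-degree n f d f≡0))

-- Vanishing is pulled down in steps of `e` from the bound that `Finite` provides. Some such bound
-- is essential: `1 / (1 - x)` times `1 - x` has degree 0, but the quotient never ends.
descend : ∀ e d f → 0 < e → Finite f → (∀ n → d ≤ n → f (e ℕ.+ n) ≡ 0ℚ → f n ≡ 0ℚ) → DegreeBelow d f
descend e d f 0<e (b , f≡0) step n d≤n = go b n d≤n (ℕ.m≤n+m b n)
  where
  go : ∀ i n → d ≤ n → b ≤ n ℕ.+ i → f n ≡ 0ℚ
  go zero    n d≤n b≤n   = f≡0 n (subst (b ≤_) (ℕ.+-identityʳ n) b≤n)
  go (suc i) n d≤n b≤n+i = step n d≤n (go i (e ℕ.+ n) (ℕ.m≤n⇒m≤o+n e d≤n)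
    (ℕ.≤-trans b≤n+i (subst (_≤ e ℕ.+ n ℕ.+ i) (sym (ℕ.+-suc n i)) (ℕ.+-monoˡ-≤ i (ℕ.+-monoˡ-≤ n 0<e)))))

1+x^*-degree⁻¹ : ∀ e d f → 0 < e → Finite f → DegreeBelow (e ℕ.+ d) (1+x^ e * f) → DegreeBelow d f
1+x^*-degree⁻¹ e d f 0<e f-finite ≡0 = descend e d f 0<e f-finite λ n d≤n f[e+n]≡0 → begin
  f n                           ≡⟨ ℚ.+-identityˡ (f n) ⟨
  0ℚ ℚ.+ f n                    ≡⟨ cong (ℚ._+ f n) f[e+n]≡0 ⟨
  f (e ℕ.+ n) ℚ.+ f n           ≡⟨ 1+x^*-+ e f n ⟨
  (1+x^ e * f) (e ℕ.+ n)        ≡⟨ ≡0 (e ℕ.+ n) (ℕ.+-monoʳ-≤ e d≤n) ⟩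
  0ℚ                            ∎
  where open ≡-Reasoning

1-x^*-degree⁻¹ : ∀ e d f → 0 < e → Finite f → DegreeBelow (e ℕ.+ d) (1-x^ e * f) → DegreeBelow d f
1-x^*-degree⁻¹ e d f 0<e f-finite ≡0 = descend e d f 0<e f-finite λ n d≤n f[e+n]≡0 → begin
  f n                           ≡⟨ solve 1 (λ a → a := con 0ℚ :- (con 0ℚ :- a)) refl (f n) ⟩
  0ℚ ℚ.- (0ℚ ℚ.- f n)           ≡⟨ cong (λ a → 0ℚ ℚ.- (a ℚ.- f n)) f[e+n]≡0 ⟨
  0ℚ ℚ.- (f (e ℕ.+ n) ℚ.- f n)  ≡⟨ cong (λ a → 0ℚ ℚ.- a) (1-x^*-+ e f n) ⟨
  0ℚ ℚ.- (1-x^ e * f) (e ℕ.+ n) ≡⟨ cong (λ a → 0ℚ ℚ.- a) (≡0 (e ℕ.+ n) (ℕ.+-monoʳ-≤ e d≤n)) ⟩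
  0ℚ                            ∎
  where
  open ≡-Reasoning
  open +-*-Solver

∏<*-degree⁻¹ : ∀ (F : ℕ → PowerSeries) (e : ℕ → ℕ) →
  (∀ i → Finite (F i)) →
  (∀ i d f → Finite f → DegreeBelow (e i ℕ.+ d) (F i * f) → DegreeBelow d f) →
  ∀ n d f → Finite f → DegreeBelow (Σ< n e ℕ.+ d) (∏< n F * f) → DegreeBelow d f
∏<*-degree⁻¹ F e F-finite F-cancel zero    d f f-finite ≡0 = DegreeBelow-resp {d} {1# * f} {f} (*ˢ-identityˡ f) ≡0
∏<*-degree⁻¹ F e F-finite F-cancel (suc n) d f f-finite ≡0 =
  F-cancel n d f f-finite
    (∏<*-degree⁻¹ F e F-finite F-cancel n (e n ℕ.+ d) (F n * f) (Finite-* {F n} {f} (F-finite n) f-finite)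
      (subst (λ b → DegreeBelow b (∏< n F * (F n * f))) (ℕ.+-assoc (Σ< n e) (e n) d)
        (DegreeBelow-resp {Σ< n e ℕ.+ e n ℕ.+ d} {∏< n F * F n * f} {∏< n F * (F n * f)}
          (*ˢ-assoc (∏< n F) (F n) f) ≡0)))

module _ (L : ℕ) .{{_ : NonZero L}} where

  ∂^-comm : ∀ m f n → ∂^ L m (∂ L f) n ≡ ∂ L (∂^ L m f) n
  ∂^-comm zero    f n = refl
  ∂^-comm (suc m) f n = ∂^-comm m (∂ L f) n

  -- The bridge between degrees and differences. Reading the product at `m L + n` yields forward
  -- differences, in which no coefficient of negative index can occur.
  1-x^^*≡∂^ : ∀ m f n → ((1-x^ L) ^ m * f) (m ℕ.* L ℕ.+ n) ≡ ∂^ L m f n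
  1-x^^*≡∂^ zero    f n = *ˢ-identityˡ f n
  1-x^^*≡∂^ (suc m) f n = begin
    ((1-x^ L) * w ^ m * f) (L ℕ.+ m ℕ.* L ℕ.+ n)      ≡⟨ *ˢ-assoc w (w ^ m) f (L ℕ.+ m ℕ.* L ℕ.+ n) ⟩
    (w * (w ^ m * f)) (L ℕ.+ m ℕ.* L ℕ.+ n)           ≡⟨ cong (w * (w ^ m * f)) (ℕ.+-assoc L (m ℕ.* L) n) ⟩
    (w * (w ^ m * f)) (L ℕ.+ (m ℕ.* L ℕ.+ n))         ≡⟨ 1-x^*-+ L (w ^ m * f) (m ℕ.* L ℕ.+ n) ⟩
    (w ^ m * f) (L ℕ.+ (m ℕ.* L ℕ.+ n)) ℚ.- (w ^ m * f) (m ℕ.* L ℕ.+ n)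
      ≡⟨ cong₂ ℚ._-_ (trans (cong (w ^ m * f) shift) (1-x^^*≡∂^ m f (L ℕ.+ n))) (1-x^^*≡∂^ m f n) ⟩
    ∂ L (∂^ L m f) n                                  ≡⟨ ∂^-comm m f n ⟨
    ∂^ L (suc m) f n                                  ∎
    where
    open ≡-Reasoning
    w = 1-x^ L
    shift : L ℕ.+ (m ℕ.* L ℕ.+ n) ≡ m ℕ.* L ℕ.+ (L ℕ.+ n)
    shift = solve 3 (λ l a n → l :+ (a :+ n) := a :+ (l :+ n)) refl L (m ℕ.* L) n
      where open ℕ.+-*-Solver

-- Eventually constant series

Eventually : (ℕ → Set) → Set
Eventually P = ∃[ n₀ ] ∀ n → n₀ ≤ n → P n

-- The substitute for evaluation at 1: a simple pole `v / (1 - x)` plus a polynomial.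
EventuallyConst : PowerSeries → ℚ → Set
EventuallyConst f v = Eventually λ n → f n ≡ v

EventuallyConst-resp : ∀ {f g v} → f ≗ g → EventuallyConst f v → EventuallyConst g v
EventuallyConst-resp f≗g (n₀ , f≡v) = n₀ , λ n n₀≤n → trans (sym (f≗g n)) (f≡v n n₀≤n)

EventuallyConst-unique : ∀ {f u v} → EventuallyConst f u → EventuallyConst f v → u ≡ v
EventuallyConst-unique (a , f≡u) (b , f≡v) =
  trans (sym (f≡u (a ℕ.+ b) (ℕ.m≤m+n a b))) (f≡v (a ℕ.+ b) (ℕ.m≤n+m b a))

above : ∀ e {n n₀} → e ℕ.+ n₀ ≤ n → ∃[ m ] n ≡ e ℕ.+ m × n₀ ≤ m
above e {n} {n₀} e+n₀≤n = n ∸ e , sym (ℕ.m+[n∸m]≡n (ℕ.m+n≤o⇒m≤o e e+n₀≤n)) ,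
  subst (_≤ n ∸ e) (ℕ.m+n∸m≡n e n₀) (ℕ.∸-monoˡ-≤ e e+n₀≤n)

-- The factor 2 is the value of `1 + x^e` at 1; in `geometric*-const` the factor `e` is that of
-- `1 + x + ... + x^(e-1)`.
1+x^*-const : ∀ e f v → EventuallyConst f v → EventuallyConst (1+x^ e * f) (fromℕ 2 ℚ.* v)
1+x^*-const e f v (n₀ , f≡v) = e ℕ.+ n₀ , λ n e+n₀≤n → step n (above e e+n₀≤n)
  where
  open +-*-Solver
  step : ∀ n → ∃[ m ] n ≡ e ℕ.+ m × n₀ ≤ m → (1+x^ e * f) n ≡ fromℕ 2 ℚ.* v
  step _ (m , refl , n₀≤m) = trans (1+x^*-+ e f m)
    (trans (cong₂ ℚ._+_ (f≡v (e ℕ.+ m) (ℕ.m≤n⇒m≤o+n e n₀≤m)) (f≡v m n₀≤m))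
      (solve 1 (λ v → v :+ v := con (fromℕ 2) :* v) refl v))

geometric*-const : ∀ e f v → EventuallyConst f v → EventuallyConst (geometric x e * f) (fromℕ e ℚ.* v)
geometric*-const zero f v _ = 0 , λ n _ → trans (zeroˡˢ f n) (sym (ℚ.*-zeroˡ v))
geometric*-const (suc e) f v f-const@(a , f≡v) with b , g≡ev ← geometric*-const e f v f-const =
  suc (a ℕ.+ b) , step
  where
  open ≡-Reasoning
  g = geometric x e * f
  step : ∀ n → suc (a ℕ.+ b) ≤ n → (geometric x (suc e) * f) n ≡ fromℕ (suc e) ℚ.* v
  step (suc n) (s≤s a+b≤n) = begin
    ((1# + x * geometric x e) * f) (suc n)        ≡⟨ [1+]-* (x * geometric x e) f (suc n) ⟩
    f (suc n) ℚ.+ (x * geometric x e * f) (suc n)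
      ≡⟨ cong₂ ℚ._+_ (f≡v (suc n) (ℕ.m≤n⇒m≤1+n (ℕ.m+n≤o⇒m≤o a a+b≤n)))
                                                       (trans (*ˢ-assoc x (geometric x e) f (suc n)) (x*-suc g n)) ⟩
    v ℚ.+ g n                                     ≡⟨ cong (v ℚ.+_) (g≡ev n (ℕ.m+n≤o⇒n≤o a a+b≤n)) ⟩
    v ℚ.+ fromℕ e ℚ.* v
      ≡⟨ solve 2 (λ v e → v :+ e :* v := (con 1ℚ :+ e) :* v) refl v (fromℕ e) ⟩
    (1ℚ ℚ.+ fromℕ e) ℚ.* v                        ≡⟨ cong (ℚ._* v) (fromℕ-+ 1 e) ⟨
    fromℕ (suc e) ℚ.* v                           ∎
    where open +-*-Solver

∏<*-const : ∀ n (F : ℕ → PowerSeries) (a : ℕ → ℚ) →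
  (∀ i f v → EventuallyConst f v → EventuallyConst (F i * f) (a i ℚ.* v)) →
  ∀ f v → EventuallyConst f v → EventuallyConst (∏< n F * f) (∏ℚ.∏< n a ℚ.* v)
∏<*-const zero    F a F-const f v f-const =
  subst (EventuallyConst (1# * f)) (sym (ℚ.*-identityˡ v))
    (EventuallyConst-resp {f} {1# * f} (λ n → sym (*ˢ-identityˡ f n)) f-const)
∏<*-const (suc n) F a F-const f v f-const =
  subst (EventuallyConst (∏< n F * F n * f)) (sym (ℚ.*-assoc (∏ℚ.∏< n a) (a n) v))
    (EventuallyConst-resp {∏< n F * (F n * f)} {∏< n F * F n * f} (λ m → sym (*ˢ-assoc (∏< n F) (F n) f m))
      (∏<*-const n F a F-const (F n * f) (a n ℚ.* v) (F-const n f v f-const)))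

1/[1-x]-const : EventuallyConst (1# ÷ 1-x^ 1) 1ℚ
1/[1-x]-const = 0 , λ n _ → e≡1 n
  where
  e = 1# ÷ 1-x^ 1
  de≗1 : (1-x^ 1) * e ≗ 1#
  de≗1 = Series.÷-correct 1# (1-x^ 1) refl
  e≡1 : ∀ n → e n ≡ 1ℚ
  e≡1 zero    = refl
  e≡1 (suc n) = begin
    e (suc n)                        ≡⟨ solve 2 (λ a b → a := (a :- b) :+ b) refl (e (suc n)) (e n) ⟩
    e (suc n) ℚ.- e n ℚ.+ e n        ≡⟨ cong (ℚ._+ e n) (trans (sym (1-x^*-+ 1 e n)) (de≗1 (suc n))) ⟩
    0ℚ ℚ.+ e n                       ≡⟨ ℚ.+-identityˡ (e n) ⟩
    e n                              ≡⟨ e≡1 n ⟩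
    1ℚ                               ∎
    where
    open ≡-Reasoning
    open +-*-Solver

^*-const : ∀ n F a → (∀ f v → EventuallyConst f v → EventuallyConst (F * f) (a ℚ.* v)) →
           ∀ f v → EventuallyConst f v → EventuallyConst (F ^ n * f) (a ^ℚ n ℚ.* v)
^*-const zero    F a F-const f v f-const =
  subst (EventuallyConst (1# * f)) (sym (ℚ.*-identityˡ v))
    (EventuallyConst-resp {f} {1# * f} (λ n → sym (*ˢ-identityˡ f n)) f-const)
^*-const (suc n) F a F-const f v f-const =
  subst (EventuallyConst (F * F ^ n * f)) (sym (ℚ.*-assoc a (a ^ℚ n) v))
    (EventuallyConst-resp {F * (F ^ n * f)} {F * F ^ n * f} (λ m → sym (*ˢ-assoc F (F ^ n) f m))
      (F-const (F ^ n * f) (a ^ℚ n ℚ.* v) (^*-const n F a F-const f v f-const)))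

∏1+x^*-const : ∀ n (e : ℕ → ℕ) f v → EventuallyConst f v →
  EventuallyConst (∏< n (λ i → 1+x^ (e i)) * f) (∏ℚ.∏< n (λ _ → fromℕ 2) ℚ.* v)
∏1+x^*-const n e = ∏<*-const n (λ i → 1+x^ (e i)) (λ _ → fromℕ 2) (λ i → 1+x^*-const (e i))

-- After cancelling powers of 1 - x, both sides are eventually constant up to
-- a factor 1 / (1 - x).
limit-equation : ∀ m r L (e g : ℕ → ℕ) y v → EventuallyConst y v →
  ∏< (suc m) (λ i → 1-x^ (e i)) * y ≗ ∏< r (λ i → 1+x^ (g i)) * (1-x^ L) ^ m →
  ∏ℚ.∏< (suc m) (fromℕ ∘ e) ℚ.* v ≡ ∏ℚ.∏< r (λ _ → fromℕ 2) ℚ.* fromℕ L ^ℚ m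
limit-equation m r L e g y v y-const eq =
  -- The eventual value of `u` is found in two ways: from that of `y`, and from `u` being a
  -- polynomial times `1 / (1 - x)`, whose coefficients are all 1.
  trans (EventuallyConst-unique {u} lhs-const (EventuallyConst-resp {q * geometric x L ^ m * s} {u} qs≗u rhs-const))
    (cong (∏ℚ.∏< r (λ _ → fromℕ 2) ℚ.*_) (ℚ.*-identityʳ (fromℕ L ^ℚ m)))
  where
  open import Relation.Binary.Reasoning.Setoid seriesSetoid
  s = 1# ÷ 1-x^ 1
  q = ∏< r λ i → 1+x^ (g i)
  u = ∏< (suc m) (λ i → geometric x (e i)) * y
  lhs-const : EventuallyConst u (∏ℚ.∏< (suc m) (fromℕ ∘ e) ℚ.* v)
  lhs-const = ∏<*-const (suc m) (λ i → geometric x (e i)) (fromℕ ∘ e) (λ i → geometric*-const (e i)) y v y-const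
  rhs-const : EventuallyConst (q * geometric x L ^ m * s) (∏ℚ.∏< r (λ _ → fromℕ 2) ℚ.* (fromℕ L ^ℚ m ℚ.* 1ℚ))
  rhs-const = EventuallyConst-resp {q * (geometric x L ^ m * s)} {q * geometric x L ^ m * s}
    (λ n → sym (*ˢ-assoc q (geometric x L ^ m) s n))
    (∏1+x^*-const r g (geometric x L ^ m * s) (fromℕ L ^ℚ m ℚ.* 1ℚ)
      (^*-const m (geometric x L) (fromℕ L) (geometric*-const L) s 1ℚ 1/[1-x]-const))
  du≗ : (1-x^ 1) * u ≗ q * geometric x L ^ m
  du≗ = *-cancel-unit ((1-x^ 1) ^ m) ((1-x^ 1) * u) (q * geometric x L ^ m)
    (^-constantTerm m (1-x^ 1) refl) (cleared m r L e g y eq)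
  qs≗u : q * geometric x L ^ m * s ≗ u
  qs≗u = *-cancel-unit (1-x^ 1) (q * geometric x L ^ m * s) u refl (begin
    (1-x^ 1) * (q * geometric x L ^ m * s)    ≈⟨ *ˢ-comm (1-x^ 1) (q * geometric x L ^ m * s) ⟩
    q * geometric x L ^ m * s * 1-x^ 1        ≈⟨ *ˢ-assoc (q * geometric x L ^ m) s (1-x^ 1) ⟩
    q * geometric x L ^ m * (s * 1-x^ 1)      ≈⟨ *ˢ-congˡ {q * geometric x L ^ m} {s * 1-x^ 1} {1#}
                                                   (λ n → trans (*ˢ-comm s (1-x^ 1) n) (Series.÷-correct 1# (1-x^ 1) refl n)) ⟩
    q * geometric x L ^ m * 1#                ≈⟨ *ˢ-comm (q * geometric x L ^ m) 1# ⟩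
    1# * (q * geometric x L ^ m)              ≈⟨ *ˢ-identityˡ (q * geometric x L ^ m) ⟩
    q * geometric x L ^ m                     ≈⟨ du≗ ⟨
    (1-x^ 1) * u                              ∎)

constant-tail : ∀ f → Finite ((1-x^ 1) * f) → ∃[ v ] EventuallyConst f v
constant-tail f (d , ≡0) = f d , d , λ n d≤n → subst (λ n → f n ≡ f d) (ℕ.m+[n∸m]≡n d≤n) (go (n ∸ d))
  where
  open ≡-Reasoning
  open +-*-Solver
  go : ∀ i → f (d ℕ.+ i) ≡ f d
  go zero    = cong f (ℕ.+-identityʳ d)
  go (suc i) = begin
    f (d ℕ.+ suc i)                                       ≡⟨ cong f (ℕ.+-suc d i) ⟩
    f (1 ℕ.+ (d ℕ.+ i))
      ≡⟨ solve 2 (λ a b → a := a :- b :+ b) refl (f (1 ℕ.+ (d ℕ.+ i))) (f (d ℕ.+ i)) ⟩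
    f (1 ℕ.+ (d ℕ.+ i)) ℚ.- f (d ℕ.+ i) ℚ.+ f (d ℕ.+ i)
      ≡⟨ cong (ℚ._+ f (d ℕ.+ i)) (1-x^*-+ 1 f (d ℕ.+ i)) ⟨
    ((1-x^ 1) * f) (1 ℕ.+ (d ℕ.+ i)) ℚ.+ f (d ℕ.+ i)
      ≡⟨ cong₂ ℚ._+_ (≡0 (1 ℕ.+ (d ℕ.+ i)) (ℕ.m≤n⇒m≤1+n (ℕ.m≤m+n d i))) (go i) ⟩
    0ℚ ℚ.+ f d                                            ≡⟨ ℚ.+-identityˡ (f d) ⟩
    f d                                                   ∎

-- The substitution x ↦ -x

σ : ℕ → ℚ
σ n = (ℚ.- 1ℚ) ^ℚ n

σ-suc : ∀ n → σ (suc n) ≡ ℚ.- σ n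
σ-suc n = solve 1 (λ a → con (ℚ.- 1ℚ) :* a := :- a) refl (σ n)
  where open +-*-Solver

σ-+ : ∀ m n → σ (m ℕ.+ n) ≡ σ m ℚ.* σ n
σ-+ = ∏ℚ.^-homo-* (ℚ.- 1ℚ)

σ-even : ∀ {n} → 2 ∣ n → σ n ≡ 1ℚ
σ-even (divides zero    refl) = refl
σ-even (divides (suc q) refl) = trans (σ-+ 2 (q ℕ.* 2)) (trans (ℚ.*-identityˡ (σ (q ℕ.* 2))) (σ-even (divides q refl)))

odd⇒2∣suc : ∀ n → 2 ∤ n → 2 ∣ suc n
odd⇒2∣suc zero          2∤n = contradiction (divides 0 refl) 2∤n
odd⇒2∣suc (suc zero)    2∤n = divides 1 refl
odd⇒2∣suc (suc (suc n)) 2∤n = ∣m∣n⇒∣m+n (divides 1 refl) (odd⇒2∣suc n λ 2∣n → 2∤n (∣m∣n⇒∣m+n (divides 1 refl) 2∣n))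

σ-odd : ∀ {n} → 2 ∣ suc n → σ n ≡ ℚ.- 1ℚ
σ-odd {n} 2∣1+n = begin
  σ n               ≡⟨ solve 1 (λ a → a := :- (:- a)) refl (σ n) ⟩
  ℚ.- (ℚ.- σ n)     ≡⟨ cong ℚ.-_ (σ-suc n) ⟨
  ℚ.- σ (suc n)     ≡⟨ cong ℚ.-_ (σ-even 2∣1+n) ⟩
  ℚ.- 1ℚ            ∎
  where
  open ≡-Reasoning
  open +-*-Solver

σ*σ : ∀ n → σ n ℚ.* σ n ≡ 1ℚ
σ*σ n = trans (sym (σ-+ n n)) (σ-even (divides n (trans (cong (n ℕ.+_) (sym (ℕ.+-identityʳ n))) (ℕ.*-comm 2 n))))

twist : PowerSeries → PowerSeries
twist f n = σ n ℚ.* f n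

tail-twist : ∀ f → tail (twist f) ≗ λ n → ℚ.- 1ℚ ℚ.* twist (tail f) n
tail-twist f n = ℚ.*-assoc (ℚ.- 1ℚ) (σ n) (f (suc n))

twist-* : ∀ f g → twist (f * g) ≗ twist f * twist g
twist-* f g zero = begin
  1ℚ ℚ.* (f * g) 0                    ≡⟨ cong (1ℚ ℚ.*_) (*-constantTerm f g) ⟩
  1ℚ ℚ.* (f 0 ℚ.* g 0)
    ≡⟨ solve 2 (λ a b → con 1ℚ :* (a :* b) := con 1ℚ :* a :* (con 1ℚ :* b)) refl (f 0) (g 0) ⟩
  1ℚ ℚ.* f 0 ℚ.* (1ℚ ℚ.* g 0)         ≡⟨ *-constantTerm (twist f) (twist g) ⟨
  (twist f * twist g) 0               ∎
  where
  open ≡-Reasoning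
  open +-*-Solver
twist-* f g (suc n) = begin
  σ (suc n) ℚ.* (f 0 ℚ.* g (suc n) ℚ.+ (tail f * g) n)
    ≡⟨ solve 4 (λ s a b c → con (ℚ.- 1ℚ) :* s :* (a :* b :+ c)
                            := con 1ℚ :* a :* (con (ℚ.- 1ℚ) :* s :* b) :+ con (ℚ.- 1ℚ) :* (s :* c))
         refl (σ n) (f 0) (g (suc n)) ((tail f * g) n) ⟩
  1ℚ ℚ.* f 0 ℚ.* twist g (suc n) ℚ.+ ℚ.- 1ℚ ℚ.* twist (tail f * g) n
    ≡⟨ cong (λ a → 1ℚ ℚ.* f 0 ℚ.* twist g (suc n) ℚ.+ ℚ.- 1ℚ ℚ.* a) (twist-* (tail f) g n) ⟩
  1ℚ ℚ.* f 0 ℚ.* twist g (suc n) ℚ.+ ℚ.- 1ℚ ℚ.* (twist (tail f) * twist g) n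
    ≡⟨ cong (1ℚ ℚ.* f 0 ℚ.* twist g (suc n) ℚ.+_) (*-scaleˡ (ℚ.- 1ℚ) (twist (tail f)) (twist g) n) ⟨
  1ℚ ℚ.* f 0 ℚ.* twist g (suc n) ℚ.+ ((λ m → ℚ.- 1ℚ ℚ.* twist (tail f) m) * twist g) n
    ≡⟨ cong (1ℚ ℚ.* f 0 ℚ.* twist g (suc n) ℚ.+_)
         (*ˢ-congʳ {twist g} {tail (twist f)} {λ m → ℚ.- 1ℚ ℚ.* twist (tail f) m} (tail-twist f) n) ⟨
  (twist f * twist g) (suc n) ∎
  where
  open ≡-Reasoning
  open +-*-Solver

twist-1# : twist 1# ≗ 1#
twist-1# zero    = refl
twist-1# (suc n) = ℚ.*-zeroʳ (σ (suc n))

twist-x^ : ∀ e n → twist (x ^ e) n ≡ σ e ℚ.* (x ^ e) n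
twist-x^ zero    n       = trans (twist-1# n) (sym (ℚ.*-identityˡ (1# n)))
twist-x^ (suc e) zero    = trans (cong (σ 0 ℚ.*_) (x*-zero (x ^ e)))
  (trans (ℚ.*-zeroʳ (σ 0)) (sym (trans (cong (σ (suc e) ℚ.*_) (x*-zero (x ^ e))) (ℚ.*-zeroʳ (σ (suc e))))))
twist-x^ (suc e) (suc n) = begin
  σ (suc n) ℚ.* (x * x ^ e) (suc n)           ≡⟨ cong (σ (suc n) ℚ.*_) (x*-suc (x ^ e) n) ⟩
  ℚ.- 1ℚ ℚ.* σ n ℚ.* (x ^ e) n                ≡⟨ ℚ.*-assoc (ℚ.- 1ℚ) (σ n) ((x ^ e) n) ⟩
  ℚ.- 1ℚ ℚ.* twist (x ^ e) n                  ≡⟨ cong (ℚ.- 1ℚ ℚ.*_) (twist-x^ e n) ⟩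
  ℚ.- 1ℚ ℚ.* (σ e ℚ.* (x ^ e) n)              ≡⟨ ℚ.*-assoc (ℚ.- 1ℚ) (σ e) ((x ^ e) n) ⟨
  σ (suc e) ℚ.* (x ^ e) n                     ≡⟨ cong (σ (suc e) ℚ.*_) (x*-suc (x ^ e) n) ⟨
  σ (suc e) ℚ.* (x * x ^ e) (suc n)           ∎
  where open ≡-Reasoning

twist-1+x^ : ∀ e n → twist (1+x^ e) n ≡ 1# n ℚ.+ σ e ℚ.* (x ^ e) n
twist-1+x^ e n = trans (ℚ.*-distribˡ-+ (σ n) (1# n) ((x ^ e) n)) (cong₂ ℚ._+_ (twist-1# n) (twist-x^ e n))

twist-1-x^ : ∀ e n → twist (1-x^ e) n ≡ 1# n ℚ.- σ e ℚ.* (x ^ e) n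
twist-1-x^ e n = trans (solve 3 (λ s a b → s :* (a :- b) := s :* a :- s :* b) refl (σ n) (1# n) ((x ^ e) n))
  (cong₂ ℚ._-_ (twist-1# n) (twist-x^ e n))
  where open +-*-Solver

twist-1+x^-odd : ∀ {e} → 2 ∣ suc e → twist (1+x^ e) ≗ 1-x^ e
twist-1+x^-odd {e} odd n = trans (twist-1+x^ e n) (trans (cong (λ s → 1# n ℚ.+ s ℚ.* (x ^ e) n) (σ-odd odd))
  (solve 2 (λ a b → a :+ con (ℚ.- 1ℚ) :* b := a :- b) refl (1# n) ((x ^ e) n)))
  where open +-*-Solver

twist-1-x^-odd : ∀ {e} → 2 ∣ suc e → twist (1-x^ e) ≗ 1+x^ e
twist-1-x^-odd {e} odd n = trans (twist-1-x^ e n) (trans (cong (λ s → 1# n ℚ.- s ℚ.* (x ^ e) n) (σ-odd odd))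
  (solve 2 (λ a b → a :- con (ℚ.- 1ℚ) :* b := a :+ b) refl (1# n) ((x ^ e) n)))
  where open +-*-Solver

twist-1+x^-even : ∀ {e} → 2 ∣ e → twist (1+x^ e) ≗ 1+x^ e
twist-1+x^-even {e} even n = trans (twist-1+x^ e n)
  (cong (1# n ℚ.+_) (trans (cong (ℚ._* (x ^ e) n) (σ-even even)) (ℚ.*-identityˡ ((x ^ e) n))))

twist-1-x^-even : ∀ {e} → 2 ∣ e → twist (1-x^ e) ≗ 1-x^ e
twist-1-x^-even {e} even n = trans (twist-1-x^ e n)
  (cong (λ a → 1# n ℚ.- a) (trans (cong (ℚ._* (x ^ e) n) (σ-even even)) (ℚ.*-identityˡ ((x ^ e) n))))

twist-∏< : ∀ n F F′ → (∀ i → twist (F i) ≗ F′ i) → twist (∏< n F) ≗ ∏< n F′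
twist-∏< zero    F F′ F≗F′ = twist-1#
twist-∏< (suc n) F F′ F≗F′ m = trans (twist-* (∏< n F) (F n) m)
  (*ˢ-cong {twist (∏< n F)} {∏< n F′} {twist (F n)} {F′ n} (twist-∏< n F F′ F≗F′) (F≗F′ n) m)

twist-^ : ∀ n f f′ → twist f ≗ f′ → twist (f ^ n) ≗ f′ ^ n
twist-^ zero    f f′ f≗f′ = twist-1#
twist-^ (suc n) f f′ f≗f′ m = trans (twist-* f (f ^ n) m)
  (*ˢ-cong {twist f} {f′} {twist (f ^ n)} {f′ ^ n} f≗f′ (twist-^ n f f′ f≗f′) m)

Finite-twist : ∀ {f} → Finite f → Finite (twist f)
Finite-twist {f} (d , f≡0) = d , λ n d≤n → trans (cong (σ n ℚ.*_) (f≡0 n d≤n)) (ℚ.*-zeroʳ (σ n))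

-- A polynomial plus `a / (1 - x) + b / (1 + x)`: simple poles at 1 and -1 only.
EventuallyAlternating : PowerSeries → ℚ → ℚ → Set
EventuallyAlternating f a b = Eventually λ n → f n ≡ a ℚ.+ σ n ℚ.* b

twist-alternating : ∀ f a b → EventuallyAlternating f a b → EventuallyAlternating (twist f) b a
twist-alternating f a b (n₀ , f≡) = n₀ , λ n n₀≤n → begin
  σ n ℚ.* f n                               ≡⟨ cong (σ n ℚ.*_) (f≡ n n₀≤n) ⟩
  σ n ℚ.* (a ℚ.+ σ n ℚ.* b)
    ≡⟨ solve 3 (λ s a b → s :* (a :+ s :* b) := s :* s :* b :+ s :* a) refl (σ n) a b ⟩
  σ n ℚ.* σ n ℚ.* b ℚ.+ σ n ℚ.* a           ≡⟨ cong (λ s → s ℚ.* b ℚ.+ σ n ℚ.* a) (σ*σ n) ⟩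
  1ℚ ℚ.* b ℚ.+ σ n ℚ.* a                    ≡⟨ cong (ℚ._+ σ n ℚ.* a) (ℚ.*-identityˡ b) ⟩
  b ℚ.+ σ n ℚ.* a                           ∎
  where
  open ≡-Reasoning
  open +-*-Solver

-- Each coefficient is half the sum plus half the difference of itself and its predecessor. The sums
-- are the coefficients of `(1 + x) f`, which `1 - x` makes finite; the differences are those of
-- `(1 - x) f`, which `1 + x` makes finite, so they are eventually constant after the twist.
alternating-tail : ∀ f → Finite ((1+x^ 1) * ((1-x^ 1) * f)) → ∃[ a ] ∃[ b ] EventuallyAlternating f a b
alternating-tail f finite = combine
  (constant-tail u (Finite-resp {(1+x^ 1) * ((1-x^ 1) * f)} {(1-x^ 1) * u} swap finite))
  (constant-tail (twist v) (Finite-resp {twist ((1+x^ 1) * v)} {(1-x^ 1) * twist v} twisted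
    (Finite-twist {(1+x^ 1) * v} finite)))
  where
  open ≡-Reasoning
  open +-*-Solver
  u = (1+x^ 1) * f
  v = (1-x^ 1) * f
  swap : (1+x^ 1) * ((1-x^ 1) * f) ≗ (1-x^ 1) * u
  swap n = trans (sym (*ˢ-assoc (1+x^ 1) (1-x^ 1) f n))
    (trans (*ˢ-congʳ {f} {(1+x^ 1) * (1-x^ 1)} {(1-x^ 1) * (1+x^ 1)} (*ˢ-comm (1+x^ 1) (1-x^ 1)) n)
      (*ˢ-assoc (1-x^ 1) (1+x^ 1) f n))
  twisted : twist ((1+x^ 1) * v) ≗ (1-x^ 1) * twist v
  twisted n = trans (twist-* (1+x^ 1) v n)
    (*ˢ-congʳ {twist v} {twist (1+x^ 1)} {1-x^ 1} (twist-1+x^-odd {1} (divides 1 refl)) n)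
  combine : ∃[ a ] EventuallyConst u a → ∃[ b ] EventuallyConst (twist v) b →
            ∃[ a ] ∃[ b ] EventuallyAlternating f a b
  combine (a , m , u≡a) (b , n , v≡b) = ½ ℚ.* a , ½ ℚ.* b , suc (m ℕ.+ n) , step
    where
    step : ∀ i → suc (m ℕ.+ n) ≤ i → f i ≡ ½ ℚ.* a ℚ.+ σ i ℚ.* (½ ℚ.* b)
    step (suc i) (s≤s m+n≤i) = begin
      f (suc i)
        ≡⟨ solve 2 (λ p q → p := con ½ :* (p :+ q) :+ con 1ℚ :* (con ½ :* (p :- q))) refl (f (suc i)) (f i) ⟩
      ½ ℚ.* (f (suc i) ℚ.+ f i) ℚ.+ 1ℚ ℚ.* (½ ℚ.* (f (suc i) ℚ.- f i))
        ≡⟨ cong₂ (λ p q → ½ ℚ.* p ℚ.+ 1ℚ ℚ.* (½ ℚ.* q)) (1+x^*-+ 1 f i) (1-x^*-+ 1 f i) ⟨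
      ½ ℚ.* u (suc i) ℚ.+ 1ℚ ℚ.* (½ ℚ.* v (suc i))
        ≡⟨ cong (λ s → ½ ℚ.* u (suc i) ℚ.+ s ℚ.* (½ ℚ.* v (suc i))) (σ*σ (suc i)) ⟨
      ½ ℚ.* u (suc i) ℚ.+ σ (suc i) ℚ.* σ (suc i) ℚ.* (½ ℚ.* v (suc i))
        ≡⟨ solve 3 (λ u s v → con ½ :* u :+ s :* s :* (con ½ :* v) := con ½ :* u :+ s :* (con ½ :* (s :* v)))
             refl (u (suc i)) (σ (suc i)) (v (suc i)) ⟩
      ½ ℚ.* u (suc i) ℚ.+ σ (suc i) ℚ.* (½ ℚ.* twist v (suc i))
        ≡⟨ cong₂ (λ p q → ½ ℚ.* p ℚ.+ σ (suc i) ℚ.* (½ ℚ.* q))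
             (u≡a (suc i) (ℕ.m≤n⇒m≤1+n (ℕ.m+n≤o⇒m≤o m m+n≤i))) (v≡b (suc i) (ℕ.m≤n⇒m≤1+n (ℕ.m+n≤o⇒n≤o m m+n≤i))) ⟩
      ½ ℚ.* a ℚ.+ σ (suc i) ℚ.* (½ ℚ.* b) ∎

-- For odd `e` the factor `1 + x^e` vanishes at -1, which removes the pole there; at 1 it has the
-- value 2.
1+x^*-alternating : ∀ e f a b → 2 ∣ suc e → EventuallyAlternating f a b → EventuallyConst (1+x^ e * f) (fromℕ 2 ℚ.* a)
1+x^*-alternating e f a b odd (n₀ , f≡) = e ℕ.+ n₀ , λ n e+n₀≤n → step n (above e e+n₀≤n)
  where
  open ≡-Reasoning
  open +-*-Solver
  step : ∀ n → ∃[ m ] n ≡ e ℕ.+ m × n₀ ≤ m → (1+x^ e * f) n ≡ fromℕ 2 ℚ.* a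
  step _ (m , refl , n₀≤m) = begin
    (1+x^ e * f) (e ℕ.+ m)                                    ≡⟨ 1+x^*-+ e f m ⟩
    f (e ℕ.+ m) ℚ.+ f m
      ≡⟨ cong₂ ℚ._+_ (f≡ (e ℕ.+ m) (ℕ.m≤n⇒m≤o+n e n₀≤m)) (f≡ m n₀≤m) ⟩
    a ℚ.+ σ (e ℕ.+ m) ℚ.* b ℚ.+ (a ℚ.+ σ m ℚ.* b)
      ≡⟨ cong (λ s → a ℚ.+ s ℚ.* b ℚ.+ (a ℚ.+ σ m ℚ.* b))
                                                                   (trans (σ-+ e m) (cong (ℚ._* σ m) (σ-odd odd))) ⟩
    a ℚ.+ ℚ.- 1ℚ ℚ.* σ m ℚ.* b ℚ.+ (a ℚ.+ σ m ℚ.* b)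
      ≡⟨ solve 3 (λ a s b → a :+ con (ℚ.- 1ℚ) :* s :* b :+ (a :+ s :* b) := con (fromℕ 2) :* a) refl a (σ m) b ⟩
    fromℕ 2 ℚ.* a                                             ∎

-- One odd factor removes the alternating part, and the others act on an eventually constant series.
-- The count `suc n` guarantees that one factor.
∏1+x^*-alternating : ∀ n (e : ℕ → ℕ) f a b → (∀ i → 2 ∣ suc (e i)) → EventuallyAlternating f a b →
  EventuallyConst (∏< (suc n) (λ i → 1+x^ (e i)) * f) (∏ℚ.∏< (suc n) (λ _ → fromℕ 2) ℚ.* a)
∏1+x^*-alternating n e f a b odd f-alt =
  subst (EventuallyConst (p * 1+x^ (e n) * f)) (sym (ℚ.*-assoc (∏ℚ.∏< n (λ _ → fromℕ 2)) (fromℕ 2) a))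
    (EventuallyConst-resp {p * (1+x^ (e n) * f)} {p * 1+x^ (e n) * f} (λ m → sym (*ˢ-assoc p (1+x^ (e n)) f m))
      (∏1+x^*-const n e (1+x^ (e n) * f) (fromℕ 2 ℚ.* a) (1+x^*-alternating (e n) f a b (odd n) f-alt)))
  where p = ∏< n λ i → 1+x^ (e i)

-- The period and the threshold

∈⇒∣lcm : ∀ {a as} → a ∈ as → a ∣ List.foldr lcm 1 as
∈⇒∣lcm {as = b ∷ as} (here refl)  = m∣lcm[m,n] b (List.foldr lcm 1 as)
∈⇒∣lcm {as = b ∷ as} (there a∈as) = ∣-trans (∈⇒∣lcm a∈as) (n∣lcm[m,n] b (List.foldr lcm 1 as))

foldr-lcm-nonZero : ∀ {as} → All NonZero as → NonZero (List.foldr lcm 1 as)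
foldr-lcm-nonZero []                       = _
foldr-lcm-nonZero {a ∷ as} (a≢0 ∷ as≢0) = ℕ.≢-nonZero λ lcm≡0 →
  ℕ.≢-nonZero⁻¹ (a ℕ.* b) {{ℕ.m*n≢0 a b {{a≢0}} {{foldr-lcm-nonZero as≢0}}}}
    (trans (sym (gcd*lcm a b)) (trans (cong (gcd a b ℕ.*_) lcm≡0) (ℕ.*-zeroʳ (gcd a b))))
  where b = List.foldr lcm 1 as

β≡ : ∀ k j → (k ℕ.+ 1) ℕ.* j ℕ.+ 1 ≡ β k j
β≡ k j = cong (λ K → K ℕ.* j ℕ.+ 1) (ℕ.+-comm k 1)

[k+1][1+i]≡1+α : ∀ k i → (k ℕ.+ 1) ℕ.* suc i ≡ suc (α k i)
[k+1][1+i]≡1+α = solve 2 (λ k i → (k :+ con 1) :* (con 1 :+ i) := con 1 :+ (k :+ (con 1 :+ k) :* i)) refl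
  where open ℕ.+-*-Solver

α≡ : ∀ k i → (k ℕ.+ 1) ℕ.* suc i ∸ 1 ≡ α k i
α≡ k i = cong (_∸ 1) ([k+1][1+i]≡1+α k i)

2α≡ : ∀ k i → 2 ℕ.* (k ℕ.+ 1) ℕ.* suc i ∸ 2 ≡ 2 ℕ.* α k i
2α≡ k i = cong (_∸ 2) (trans (ℕ.*-assoc 2 (k ℕ.+ 1) (suc i))
  (trans (cong (2 ℕ.*_) ([k+1][1+i]≡1+α k i)) (ℕ.*-suc 2 (α k i))))

β∣Λ : ∀ k N M {j} → j < M → β k j ∣ Λ k N M
β∣Λ k N M {j} j<M = subst (_∣ Λ k N M) (β≡ k j) (∈⇒∣lcm (∈-++⁺ˡ (∈-applyUpTo⁺ _ j<M)))

2α∣Λ : ∀ k N M {i} → i < N → 2 ℕ.* α k i ∣ Λ k N M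
2α∣Λ k N M {i} i<N = subst (_∣ Λ k N M) (2α≡ k i) (∈⇒∣lcm
  (∈-++⁺ʳ (applyUpTo (λ j → (k ℕ.+ 1) ℕ.* j ℕ.+ 1) M)
    (∈-applyUpTo⁺ (λ i → 2 ℕ.* (k ℕ.+ 1) ℕ.* suc i ∸ 2) i<N)))

Λ-nonZero : ∀ k N M .{{_ : NonZero k}} → NonZero (Λ k N M)
Λ-nonZero k@(suc _) N M = foldr-lcm-nonZero (All.++⁺
  (All.applyUpTo⁺₂ _ M λ j → subst NonZero (sym (trans (β≡ k j) (ℕ.+-comm _ 1))) _)
  (All.applyUpTo⁺₂ _ N λ i → subst NonZero (sym (2α≡ k i)) _))

-- `Δ` at `N = suc n` and `M = suc m` with the subtraction carried out: `- M` is absorbed by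
-- `N (M - 1) + N`.
δ : (k n m : ℕ) → ℕ
δ k n m = k ℕ.* suc n ℕ.* m ℕ.+ n ℕ.* m ℕ.+ n

Δ≡δ : ∀ k n m → Δ k (suc n) (suc m) ≡ + δ k n m
Δ≡δ k n m = begin
  + (k ℕ.+ 1) ℤ.* + suc n ℤ.* + m ℤ.+ + suc n ℤ.- + suc m
    ≡⟨ cong (λ z → z ℤ.* + m ℤ.+ + suc n ℤ.- + suc m) (ℤ.pos-* (k ℕ.+ 1) (suc n)) ⟨
  + ((k ℕ.+ 1) ℕ.* suc n) ℤ.* + m ℤ.+ + suc n ℤ.- + suc m
    ≡⟨ cong (λ z → z ℤ.+ + suc n ℤ.- + suc m) (ℤ.pos-* ((k ℕ.+ 1) ℕ.* suc n) m) ⟨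
  + ((k ℕ.+ 1) ℕ.* suc n ℕ.* m ℕ.+ suc n) ℤ.- + suc m
    ≡⟨ cong (λ a → + a ℤ.- + suc m) (solve 3 (λ k n m → (k :+ con 1) :* (con 1 :+ n) :* m :+ (con 1 :+ n)
          := con 1 :+ m :+ (k :* (con 1 :+ n) :* m :+ n :* m :+ n)) refl k n m) ⟩
  + (suc m ℕ.+ δ k n m) ℤ.- + suc m
    ≡⟨ ℤ.m-n≡m⊖n (suc m ℕ.+ δ k n m) (suc m) ⟩
  (suc m ℕ.+ δ k n m) ℤ.⊖ suc m
    ≡⟨ ℤ.⊖-≥ (ℕ.m≤m+n (suc m) (δ k n m)) ⟩
  + (suc m ℕ.+ δ k n m ∸ suc m)
    ≡⟨ cong +_ (ℕ.m+n∸m≡n (suc m) (δ k n m)) ⟩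
  + δ k n m ∎
  where
  open ≡-Reasoning
  open ℕ.+-*-Solver

-- This is where `Δ` comes from: the degree of the numerator minus that of the denominator. One more
-- denominator factor brings one more numerator factor; the recursion lowers `m` first, then `n` at
-- `m = 0`.
degree-count : ∀ k n m → Σ< (suc n) (α k) ℕ.+ Σ< (suc m) (β k) ℕ.+ δ k n m ≡ Σ< (n ℕ.+ suc m) (γ k)
degree-count k zero zero = solve 1 (λ k → k :+ (con 1 :+ k) :* con 0 :+ ((con 1 :+ k) :* con 0 :+ con 1)
    :+ (k :* con 1 :* con 0 :+ con 0 :+ con 0)
  := (con 1 :+ k) :* con 1) refl k
  where open ℕ.+-*-Solver
degree-count k (suc n) zero = begin
  s ℕ.+ α k (suc n) ℕ.+ Σ< 1 (β k) ℕ.+ δ k (suc n) 0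
    ≡⟨ solve 3 (λ k n s → s :+ (k :+ (con 1 :+ k) :* (con 1 :+ n)) :+ ((con 1 :+ k) :* con 0 :+ con 1)
                            :+ (k :* (con 2 :+ n) :* con 0 :+ (con 1 :+ n) :* con 0 :+ (con 1 :+ n))
                          := s :+ ((con 1 :+ k) :* con 0 :+ con 1) :+ (k :* (con 1 :+ n) :* con 0 :+ n :* con 0 :+ n)
                            :+ (con 1 :+ k) :* (con 1 :+ (n :+ con 1))) refl k n s ⟩
  s ℕ.+ Σ< 1 (β k) ℕ.+ δ k n 0 ℕ.+ γ k (n ℕ.+ 1)
    ≡⟨ cong (ℕ._+ γ k (n ℕ.+ 1)) (degree-count k n zero) ⟩
  Σ< (n ℕ.+ 1) (γ k) ℕ.+ γ k (n ℕ.+ 1) ∎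
  where
  open ≡-Reasoning
  open ℕ.+-*-Solver
  s = Σ< (suc n) (α k)
degree-count k n (suc m) = begin
  s ℕ.+ (t ℕ.+ β k (suc m)) ℕ.+ δ k n (suc m)
    ≡⟨ solve 5 (λ k n m s t → s :+ (t :+ ((con 1 :+ k) :* (con 1 :+ m) :+ con 1))
                            :+ (k :* (con 1 :+ n) :* (con 1 :+ m) :+ n :* (con 1 :+ m) :+ n)
                          := s :+ t :+ (k :* (con 1 :+ n) :* m :+ n :* m :+ n)
                            :+ (con 1 :+ k) :* (con 1 :+ (n :+ (con 1 :+ m)))) refl k n m s t ⟩
  s ℕ.+ t ℕ.+ δ k n m ℕ.+ γ k (n ℕ.+ suc m)
    ≡⟨ cong (ℕ._+ γ k (n ℕ.+ suc m)) (degree-count k n m) ⟩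
  Σ< (suc (n ℕ.+ suc m)) (γ k)
    ≡⟨ cong (λ r → Σ< r (γ k)) (ℕ.+-suc n (suc m)) ⟨
  Σ< (n ℕ.+ suc (suc m)) (γ k) ∎
  where
  open ≡-Reasoning
  open ℕ.+-*-Solver
  s = Σ< (suc n) (α k)
  t = Σ< (suc m) (β k)

%-cong-multiples : ∀ L .{{_ : NonZero L}} {a b} p q → a ℕ.+ p ℕ.* L ≡ b ℕ.+ q ℕ.* L → a % L ≡ b % L
%-cong-multiples L {a} {b} p q a+pL≡b+qL =
  trans (sym ([m+kn]%n≡m%n a p L)) (trans (cong (_% L) a+pL≡b+qL) ([m+kn]%n≡m%n b q L))

-- The absolute difference does not tell which number is larger, so multiples of `L` are allowed on
-- both sides in place of a subtraction.
≡-mod⇒ : ∀ {a b L} → a ≡ b mod L → ∃[ p ] ∃[ q ] a ℕ.+ p ℕ.* L ≡ b ℕ.+ q ℕ.* L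
≡-mod⇒ {a} {b} {L} (divides q ∣a-b∣≡qL) with ℕ.≤-total a b
... | inj₁ a≤b = q , 0 , (begin
  a ℕ.+ q ℕ.* L         ≡⟨ cong (a ℕ.+_) (trans (sym ∣a-b∣≡qL) (ℕ.m≤n⇒∣m-n∣≡n∸m a≤b)) ⟩
  a ℕ.+ (b ∸ a)         ≡⟨ ℕ.m+[n∸m]≡n a≤b ⟩
  b                     ≡⟨ ℕ.+-identityʳ b ⟨
  b ℕ.+ 0               ∎)
  where open ≡-Reasoning
... | inj₂ b≤a = 0 , q , (begin
  a ℕ.+ 0               ≡⟨ ℕ.+-identityʳ a ⟩
  a                     ≡⟨ ℕ.m+[n∸m]≡n b≤a ⟨
  b ℕ.+ (a ∸ b)         ≡⟨ cong (b ℕ.+_) (trans (sym (ℕ.m≤n⇒∣n-m∣≡n∸m b≤a)) ∣a-b∣≡qL) ⟩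
  b ℕ.+ q ℕ.* L         ∎)
  where open ≡-Reasoning

-- Eventual positivity

/-≡ : ∀ {m n q} .{{_ : NonZero n}} → q ℚ.* fromℕ n ≡ fromℕ m → q ≡ + m ℚ./ n
/-≡ {m} {n} qn≡m = *fromℕ-cancelʳ n (trans qn≡m (sym (/-*-cancel m n)))

/-positive : ∀ m n .{{_ : NonZero m}} .{{_ : NonZero n}} → 0ℚ ℚ.< + m ℚ./ n
/-positive m n = ℚ.positive⁻¹ (+ m ℚ./ n) {{ℚ.normalize-pos m n}}

fromℕ-mono-< : ∀ {m n} → m < n → fromℕ m ℚ.< fromℕ n
fromℕ-mono-< {m} {n} m<n = subst₂ ℚ._<_ (ℚ.+-identityʳ (fromℕ m))
  (trans (sym (fromℕ-+ m (n ∸ m))) (cong fromℕ (ℕ.m+[n∸m]≡n (ℕ.<⇒≤ m<n))))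
  (ℚ.+-monoʳ-< (fromℕ m) (ℚ.positive⁻¹ _ {{fromℕ-pos (n ∸ m) {{ℕ.>-nonZero (ℕ.m<n⇒0<n∸m m<n)}}}}))

/-antimono-< : ∀ p {m n} .{{_ : NonZero p}} .{{_ : NonZero m}} .{{_ : NonZero n}} → m < n → + p ℚ./ n ℚ.< + p ℚ./ m
/-antimono-< p {m} {n} m<n = ℚ.*-cancelʳ-<-nonNeg (fromℕ n) {{ℚ.normalize-nonNeg n 1}} (begin-strict
  (+ p ℚ./ n) ℚ.* fromℕ n     ≡⟨ trans (/-*-cancel p n) (sym (/-*-cancel p m)) ⟩
  (+ p ℚ./ m) ℚ.* fromℕ m     <⟨ ℚ.*-monoʳ-<-pos (+ p ℚ./ m) {{ℚ.normalize-pos p m}} (fromℕ-mono-< m<n) ⟩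
  (+ p ℚ./ m) ℚ.* fromℕ n     ∎)
  where open ℚ.≤-Reasoning

-- The absolute value of the numerator is large enough, since the denominator is at least 1.
archimedean : ∀ q → ∃[ n ] q ℚ.≤ fromℕ n
archimedean q@record{} = ℤ.∣ ℚ.↥ q ∣ , ℚ.toℚᵘ-cancel-≤ (begin
  ℚ.toℚᵘ q
    ≤⟨ ℚᵘ.*≤* (ℤ.≤-trans (ℤ.≤-reflexive (ℤ.*-identityʳ (ℚ.↥ q))) (bound (ℚ.↥ q) (ℚ.↧ₙ q))) ⟩
  mkℚᵘ (+ ℤ.∣ ℚ.↥ q ∣) 0           ≃⟨ ℚ.toℚᵘ-fromℚᵘ (mkℚᵘ (+ ℤ.∣ ℚ.↥ q ∣) 0) ⟨
  ℚ.toℚᵘ (fromℕ ℤ.∣ ℚ.↥ q ∣)       ∎)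
  where
  open ℚᵘ.≤-Reasoning
  bound : ∀ i n .{{_ : NonZero n}} → i ℤ.≤ + ℤ.∣ i ∣ ℤ.* + n
  bound (+ m)        n = subst (+ m ℤ.≤_) (ℤ.pos-* m n) (ℤ.+≤+ (ℕ.m≤m*n m n))
  bound ℤ.-[1+ m ]   n = subst (ℤ.-[1+ m ] ℤ.≤_) (ℤ.pos-* (suc m) n) ℤ.-≤+

eval-0 : ∀ p y → (∀ i → coeff p i ≡ 0ℚ) → eval p y ≡ 0ℚ
eval-0 []      y p≡0 = refl
eval-0 (a ∷ p) y p≡0 = trans (cong₂ ℚ._+_ (p≡0 0) (trans (cong (y ℚ.*_) (eval-0 p y (p≡0 ∘ suc))) (ℚ.*-zeroʳ y)))
  (ℚ.+-identityʳ 0ℚ)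

-- Mere positivity would not survive the induction: in `a + n p(n)` the second term has to outgrow
-- `- a`, which takes a fixed lower bound `ε` for `p(n)`. From `n ≥ (1 - a) / ε` on, the value is at
-- least 1.
eval-eventually-≥ : ∀ p d → DegreeAtMost d p → 0ℚ ℚ.< coeff p d →
  ∃[ ε ] ℚ.Positive ε × Eventually λ n → ε ℚ.≤ eval p (fromℕ n)
eval-eventually-≥ []      d       deg 0<0 = contradiction 0<0 (ℚ.<-irrefl refl)
eval-eventually-≥ (a ∷ p) zero    deg 0<a = a , ℚ.positive 0<a , 0 , λ n _ → ℚ.≤-reflexive (sym (begin
  a ℚ.+ fromℕ n ℚ.* eval p (fromℕ n)
    ≡⟨ cong (λ e → a ℚ.+ fromℕ n ℚ.* e) (eval-0 p (fromℕ n) λ i → deg (suc i) (s≤s z≤n)) ⟩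
  a ℚ.+ fromℕ n ℚ.* 0ℚ                ≡⟨ cong (a ℚ.+_) (ℚ.*-zeroʳ (fromℕ n)) ⟩
  a ℚ.+ 0ℚ                            ≡⟨ ℚ.+-identityʳ a ⟩
  a                                   ∎))
  where open ≡-Reasoning
eval-eventually-≥ (a ∷ p) (suc d) deg 0<c
  with ε , ε>0 , n₀ , ε≤p ← eval-eventually-≥ p d (λ i d<i → deg (suc i) (s≤s d<i)) 0<c
  = 1ℚ , _ , 1ℚ-bound
  where
  instance
    _ = ε>0
    ε≢0 = ℚ.pos⇒nonZero ε
    ε≥0 = ℚ.pos⇒nonNeg ε
  1ℚ-bound : Eventually λ n → 1ℚ ℚ.≤ eval (a ∷ p) (fromℕ n)
  1ℚ-bound with N , q≤N ← archimedean ((1ℚ ℚ.- a) ℚ.* ℚ.1/ ε) = n₀ ℕ.+ N , λ n n₀+N≤n → begin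
    1ℚ
      ≡⟨ solve 1 (λ a → con 1ℚ := a :+ (con 1ℚ :- a) :* con 1ℚ) refl a ⟩
    a ℚ.+ (1ℚ ℚ.- a) ℚ.* 1ℚ                  ≡⟨ cong (λ u → a ℚ.+ (1ℚ ℚ.- a) ℚ.* u) (ℚ.*-inverseˡ ε) ⟨
    a ℚ.+ (1ℚ ℚ.- a) ℚ.* (ℚ.1/ ε ℚ.* ε)      ≡⟨ cong (a ℚ.+_) (ℚ.*-assoc (1ℚ ℚ.- a) (ℚ.1/ ε) ε) ⟨
    a ℚ.+ (1ℚ ℚ.- a) ℚ.* ℚ.1/ ε ℚ.* ε
      ≤⟨ ℚ.+-monoʳ-≤ a (ℚ.*-monoʳ-≤-nonNeg ε (ℚ.≤-trans q≤N (fromℕ-mono-≤ (ℕ.m+n≤o⇒n≤o n₀ n₀+N≤n)))) ⟩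
    a ℚ.+ fromℕ n ℚ.* ε
      ≤⟨ ℚ.+-monoʳ-≤ a (ℚ.*-monoˡ-≤-nonNeg (fromℕ n) {{ℚ.normalize-nonNeg n 1}} (ε≤p n (ℕ.m+n≤o⇒m≤o n₀ n₀+N≤n))) ⟩
    a ℚ.+ fromℕ n ℚ.* eval p (fromℕ n)       ∎
    where
    open ℚ.≤-Reasoning
    open +-*-Solver
    fromℕ-mono-≤ : ∀ {m n} → m ≤ n → fromℕ m ℚ.≤ fromℕ n
    fromℕ-mono-≤ m≤n with ℕ.m≤n⇒m<n∨m≡n m≤n
    ... | inj₁ m<n  = ℚ.<⇒≤ (fromℕ-mono-< m<n)
    ... | inj₂ refl = ℚ.≤-refl

eval-eventually-positive : ∀ p d → DegreeAtMost d p → 0ℚ ℚ.< coeff p d →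
  Eventually λ n → 0ℚ ℚ.< eval p (fromℕ n)
eval-eventually-positive p d deg 0<c with ε , ε>0 , n₀ , ε≤p ← eval-eventually-≥ p d deg 0<c =
  n₀ , λ n n₀≤n → ℚ.<-≤-trans (ℚ.positive⁻¹ ε {{ε>0}}) (ε≤p n n₀≤n)

Eventually-Fin : ∀ L {P : Fin L → ℕ → Set} → (∀ r → Eventually (P r)) → Eventually λ n → ∀ r → P r n
Eventually-Fin zero    ev = 0 , λ n _ ()
Eventually-Fin (suc L) ev with a , Pa ← ev Fin.zero | b , Pb ← Eventually-Fin L (ev ∘ Fin.suc) =
  a ℕ.+ b , λ { n a+b≤n Fin.zero    → Pa n (ℕ.m+n≤o⇒m≤o a a+b≤n)
              ; n a+b≤n (Fin.suc r) → Pb n (ℕ.m+n≤o⇒n≤o a a+b≤n) r }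

-- The leading coefficients

∏-mono-< : ∀ n {f g : ℕ → ℕ} → (∀ i → f i < g i) → ∏ {suc n} (f ∘ toℕ) < ∏ {suc n} (g ∘ toℕ)
∏-mono-< zero    f<g = ℕ.*-monoˡ-< 1 (f<g 0)
∏-mono-< (suc n) f<g = ℕ.*-mono-< (f<g 0) (∏-mono-< n (f<g ∘ suc))

-- Factor by factor `(k+1) i + 1` is compared with `(k+1) i + k`. At `k = 1` the two products
-- coincide and the alternating coefficient of odd classes would be zero, in accordance with the
-- exceptional case.
A<B : ∀ k n → 1 < k → A k (suc n) < B k (suc n)
A<B k n 1<k = ∏-mono-< n {λ j → (k ℕ.+ 1) ℕ.* j ℕ.+ 1} {λ i → (k ℕ.+ 1) ℕ.* suc i ∸ 1} λ i → begin-strict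
  (k ℕ.+ 1) ℕ.* i ℕ.+ 1     ≡⟨ β≡ k i ⟩
  suc k ℕ.* i ℕ.+ 1         <⟨ ℕ.+-monoʳ-< (suc k ℕ.* i) 1<k ⟩
  suc k ℕ.* i ℕ.+ k         ≡⟨ ℕ.+-comm (suc k ℕ.* i) k ⟩
  α k i                     ≡⟨ α≡ k i ⟨
  (k ℕ.+ 1) ℕ.* suc i ∸ 1   ∎
  where open ℕ.≤-Reasoning

leading-positive : ∀ k M → 0ℚ ℚ.< leading k M
leading-positive k M = /-positive (2 ℕ.^ (M ∸ 1)) ((M ∸ 1) ! ℕ.* A k M)
  {{ℕ.m^n≢0 2 (M ∸ 1)}} {{ℕ.m*n≢0 ((M ∸ 1) !) (A k M) {{(M ∸ 1) ℕ.!≢0}} {{A-nonZero k M}}}}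

σ≡±1 : ∀ n → σ n ≡ 1ℚ ⊎ σ n ≡ ℚ.- 1ℚ
σ≡±1 zero    = inj₁ refl
σ≡±1 (suc n) with σ≡±1 n
... | inj₁ σ≡1  = inj₂ (trans (σ-suc n) (cong ℚ.-_ σ≡1))
... | inj₂ σ≡-1 = inj₁ (trans (σ-suc n) (cong ℚ.-_ σ≡-1))

leadingAlternating-positive : ∀ k n .{{_ : NonZero k}} → 1 < k → ∀ r → 0ℚ ℚ.< leadingAlternating k (suc n) r
leadingAlternating-positive k n 1<k r = ℚ.positive⁻¹ _ {{ℚ.pos*pos⇒pos ((+ 1 ℚ./ n !) {{n ℕ.!≢0}})
  {{ℚ.normalize-pos 1 (n !) {{n ℕ.!≢0}}}} (u ℚ.+ σ r ℚ.* v) {{ℚ.positive u±v>0}}}}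
  where
  instance
    _ = A-nonZero k (suc n)
    _ = B-nonZero k (suc n)
    _ = ℕ.m^n≢0 2 n
  u = + (2 ℕ.^ n) ℚ./ A k (suc n)
  v = + (2 ℕ.^ n) ℚ./ B k (suc n)
  u±v>0 : 0ℚ ℚ.< u ℚ.+ σ r ℚ.* v
  u±v>0 with σ≡±1 r
  ... | inj₁ σ≡1  = subst (λ s → 0ℚ ℚ.< u ℚ.+ s ℚ.* v) (sym σ≡1)
    (subst (λ w → 0ℚ ℚ.< u ℚ.+ w) (sym (ℚ.*-identityˡ v))
      (ℚ.+-mono-< (/-positive (2 ℕ.^ n) (A k (suc n))) (/-positive (2 ℕ.^ n) (B k (suc n)))))
  ... | inj₂ σ≡-1 = subst (λ s → 0ℚ ℚ.< u ℚ.+ s ℚ.* v) (sym σ≡-1) (begin-strict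
    0ℚ                        ≡⟨ ℚ.+-inverseʳ v ⟨
    v ℚ.- v                   <⟨ ℚ.+-monoˡ-< (ℚ.- v) (/-antimono-< (2 ℕ.^ n) (A<B k n 1<k)) ⟩
    u ℚ.- v                   ≡⟨ solve 2 (λ u v → u :- v := u :+ con (ℚ.- 1ℚ) :* v) refl u v ⟩
    u ℚ.+ ℚ.- 1ℚ ℚ.* v        ∎)
    where
    open ℚ.≤-Reasoning
    open +-*-Solver

-- `2^N` comes from the `N` denominator factors `1 + x^e` and `2^(N + m)` from the `N + M - 1`
-- numerator factors; the quotient `2^m` is the power of 2 in the leading coefficient.
limit-value : ∀ N m L E a .{{_ : NonZero L}} .{{_ : NonZero E}} →
  fromℕ E ℚ.* (fromℕ (2 ℕ.^ N) ℚ.* a) ≡ fromℕ (2 ℕ.^ (N ℕ.+ m)) ℚ.* fromℕ (L ℕ.^ m) →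
  a ≡ (+ (2 ℕ.^ m) ℚ./ E) ℚ.* fromℕ (L ℕ.^ m)
limit-value N m L E a eq = *fromℕ-cancelʳ E (*fromℕ-cancelʳ (2 ℕ.^ N) {{ℕ.m^n≢0 2 N}} (begin
  a ℚ.* fromℕ E ℚ.* 2ᴺ
    ≡⟨ solve 3 (λ a e p → a :* e :* p := e :* (p :* a)) refl a (fromℕ E) 2ᴺ ⟩
  fromℕ E ℚ.* (2ᴺ ℚ.* a)
    ≡⟨ eq ⟩
  fromℕ (2 ℕ.^ (N ℕ.+ m)) ℚ.* Lᵐ
    ≡⟨ cong (ℚ._* Lᵐ) (trans (cong fromℕ (ℕ.^-distribˡ-+-* 2 N m)) (fromℕ-* (2 ℕ.^ N) (2 ℕ.^ m))) ⟩
  2ᴺ ℚ.* fromℕ (2 ℕ.^ m) ℚ.* Lᵐ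
    ≡⟨ cong (λ z → 2ᴺ ℚ.* z ℚ.* Lᵐ) (/-*-cancel (2 ℕ.^ m) E) ⟨
  2ᴺ ℚ.* ((+ (2 ℕ.^ m) ℚ./ E) ℚ.* fromℕ E) ℚ.* Lᵐ
    ≡⟨ solve 4 (λ p z e l → p :* (z :* e) :* l := z :* l :* e :* p) refl 2ᴺ (+ (2 ℕ.^ m) ℚ./ E) (fromℕ E) Lᵐ ⟩
  (+ (2 ℕ.^ m) ℚ./ E) ℚ.* Lᵐ ℚ.* fromℕ E ℚ.* 2ᴺ ∎))
  where
  open ≡-Reasoning
  open +-*-Solver
  2ᴺ = fromℕ (2 ℕ.^ N)
  Lᵐ = fromℕ (L ℕ.^ m)

∏ℚ-const : ∀ n a → ∏ℚ.∏< n (λ _ → fromℕ a) ≡ fromℕ (a ℕ.^ n)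
∏ℚ-const zero    a = refl
∏ℚ-const (suc n) a = trans (cong (ℚ._* fromℕ a) (∏ℚ-const n a))
  (trans (ℚ.*-comm (fromℕ (a ℕ.^ n)) (fromℕ a)) (sym (fromℕ-* a (a ℕ.^ n))))

fromℕ-^ : ∀ a n → fromℕ a ^ℚ n ≡ fromℕ (a ℕ.^ n)
fromℕ-^ a zero    = refl
fromℕ-^ a (suc n) = trans (cong (fromℕ a ℚ.*_) (fromℕ-^ a n)) (sym (fromℕ-* a (a ℕ.^ n)))

fromℕ-∏ : ∀ n (f : ℕ → ℕ) → ∏ℚ.∏< n (fromℕ ∘ f) ≡ fromℕ (∏ {n} (f ∘ toℕ))
fromℕ-∏ zero    f = refl
fromℕ-∏ (suc n) f = trans (∏ℚ.∏<-suc n (fromℕ ∘ f))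
  (trans (cong (fromℕ (f 0) ℚ.*_) (fromℕ-∏ n (f ∘ suc))) (sym (fromℕ-* (f 0) _)))

-- G as a quotient of products of binomials

⦅⦆≗∏< : ∀ z q n → Series.⦅ z ⨾ q ⦆ n ≗ ∏< n (λ i → 1# - z * q ^ i)
⦅⦆≗∏< z q n = product≗∏< n (λ i → 1# - z * q ^ i)
  where
  product≗∏< : ∀ n F → Series.product {n} (F ∘ toℕ) ≗ ∏< n F
  product≗∏< zero    F i = refl
  product≗∏< (suc n) F i = trans
    (*ˢ-congˡ {F 0} {Series.product {n} (F ∘ suc ∘ toℕ)} {∏< n (F ∘ suc)} (product≗∏< n (F ∘ suc)) i)
    (sym (∏<-suc n F i))

∏α ∏β ∏γ : ℕ → ℕ → PowerSeries
∏α k n = ∏< n λ i → 1+x^ (α k i)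
∏β k m = ∏< m λ j → 1-x^ (β k j)
∏γ k r = ∏< r λ i → 1+x^ (γ k i)

numerator≗ : ∀ k N M → numerator k N M ≗ ∏γ k (N ℕ.+ M ∸ 1)
numerator≗ k N M i = trans (⦅⦆≗∏< (- (x ^ (k ℕ.+ 1))) (x ^ (k ℕ.+ 1)) (N ℕ.+ M ∸ 1) i)
  (∏<-cong (N ℕ.+ M ∸ 1) {λ r → 1# - - (x ^ (k ℕ.+ 1)) * (x ^ (k ℕ.+ 1)) ^ r} {λ r → 1+x^ (γ k r)} (λ r n → trans
    (1+x^-affine (k ℕ.+ 1) (k ℕ.+ 1) r n) (cong (λ e → (1+x^ e) n)
      (trans (sym (ℕ.*-suc (k ℕ.+ 1) r)) (cong (ℕ._* suc r) (ℕ.+-comm k 1))))) i)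

denominator≗ : ∀ k N M → denominator k N M ≗ ∏α k N * ∏β k M
denominator≗ k N M = *ˢ-cong {Series.⦅ - (x ^ k) ⨾ q ⦆ N} {∏α k N} {Series.⦅ x ⨾ q ⦆ M} {∏β k M}
  (λ i → trans (⦅⦆≗∏< (- (x ^ k)) q N i)
    (∏<-cong N {λ j → 1# - - (x ^ k) * q ^ j} {λ j → 1+x^ (α k j)} (λ j n → trans (1+x^-affine k (k ℕ.+ 1) j n)
      (cong (λ K → (1+x^ (k ℕ.+ K ℕ.* j)) n) (ℕ.+-comm k 1))) i))
  (λ i → trans (⦅⦆≗∏< x q M i)
    (∏<-cong M {λ j → 1# - x * q ^ j} {λ j → 1-x^ (β k j)} (λ j n → trans (1-x^-affine (k ℕ.+ 1) j n)
      (cong (λ e → (1-x^ e) n) (β≡ k j))) i))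
  where q = x ^ (k ℕ.+ 1)

G-equation : ∀ k N M .{{_ : NonZero k}} → ∏α k N * ∏β k M * G k N M ≗ ∏γ k (N ℕ.+ M ∸ 1)
G-equation k N M i = trans
  (*ˢ-congʳ {G k N M} {∏α k N * ∏β k M} {denominator k N M} (λ n → sym (denominator≗ k N M n)) i)
  (trans (G-correct k N M i) (numerator≗ k N M i))

module ℚ[x] where
  open CommutativeRing polynomialRing public
  open RingLemmas polynomialRing public
  open BinomialFactors polynomialRing X public

proj₁-^ : ∀ p n → proj₁ (p ℚ[x].^ n) ≡ proj₁ p ^ n
proj₁-^ p zero    = refl
proj₁-^ p (suc n) = cong (proj₁ p *_) (proj₁-^ p n)

proj₁-∏< : ∀ n F F′ → (∀ i → proj₁ (F i) ≗ F′ i) → proj₁ (ℚ[x].∏< n F) ≗ ∏< n F′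
proj₁-∏< zero    F F′ F≗F′ = λ _ → refl
proj₁-∏< (suc n) F F′ F≗F′ = *ˢ-cong {proj₁ (ℚ[x].∏< n F)} {∏< n F′} {proj₁ (F n)} {F′ n}
  (proj₁-∏< n F F′ F≗F′) (F≗F′ n)

proj₁-1+x^ : ∀ e → proj₁ (ℚ[x].1+x^ e) ≗ 1+x^ e
proj₁-1+x^ e n = cong (λ f → 1# n ℚ.+ f n) (proj₁-^ X e)

proj₁-1-x^ : ∀ e → proj₁ (ℚ[x].1-x^ e) ≗ 1-x^ e
proj₁-1-x^ e n = cong (λ f → 1# n ℚ.- f n) (proj₁-^ X e)

-- The quasi-polynomial and its leading coefficients

module Fixed (k n m : ℕ) .{{k≢0 : NonZero k}} where

  -- `r` is the number of numerator factors, in the form to which `N ℕ.+ M ∸ 1` computes.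
  N M L r : ℕ
  N = suc n
  M = suc m
  L = Λ k N M
  r = n ℕ.+ suc m

  instance
    L≢0 : NonZero L
    L≢0 = Λ-nonZero k N M

  open CommonMultiples polynomialRing X k L N M (λ i → 2α∣Λ k N M {i}) (λ j → β∣Λ k N M {j})
    using (∏α∏β∣∏γ; ∏α∣w^; ∏β∣w^M; ∏β∣[1-x]w^; ∏α∣t[1-x]w^)
    renaming (w to wᵖ; ∏α to ∏αᵖ; ∏β to ∏βᵖ; ∏γ to ∏γᵖ)

  g w : PowerSeries
  g = G k N M
  w = 1-x^ L

  α>0 : ∀ i → 0 < α k i
  α>0 i = ℕ.≤-trans (ℕ.>-nonZero⁻¹ k) (ℕ.m≤m+n k (suc k ℕ.* i))

  β>0 : ∀ j → 0 < β k j
  β>0 j = ℕ.m≤n+m 1 (suc k ℕ.* j)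

  unit : (∏α k N * ∏β k M) 0 ≡ 1ℚ
  unit = *-constantTerm-1 (∏α k N) (∏β k M)
    (∏<-constantTerm N (λ i → 1+x^ (α k i)) λ i → trans (cong (1ℚ ℚ.+_) (x^-constantTerm (α k i) (α>0 i))) (ℚ.+-identityʳ 1ℚ))
    (∏<-constantTerm M (λ j → 1-x^ (β k j)) λ j → cong (λ a → 1ℚ ℚ.- a) (x^-constantTerm (β k j) (β>0 j)))
    where
    x^-constantTerm : ∀ e → 0 < e → (x ^ e) 0 ≡ 0ℚ
    x^-constantTerm (suc e) _ = x*-zero (x ^ e)
  module _ (W : ℚ[x].Carrier) where
    open ≡-Reasoning

    private
      D f : PowerSeries
      D = ∏α k N * ∏β k M
      f = proj₁ W

    D*[W*g] : ∀ i → (D * (f * g)) i ≡ (∏γ k r * f) i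
    D*[W*g] i = begin
      (D * (f * g)) i       ≡⟨ *ˢ-congˡ {D} {f * g} {g * f} (*ˢ-comm f g) i ⟩
      (D * (g * f)) i       ≡⟨ *ˢ-assoc D g f i ⟨
      (D * g * f) i         ≡⟨ *ˢ-congʳ {f} {D * g} {∏γ k r} (G-equation k N M) i ⟩
      (∏γ k r * f) i        ∎

    proj₁-D : proj₁ (∏αᵖ N ℚ[x].* ∏βᵖ M) ≗ D
    proj₁-D = *ˢ-cong {proj₁ (∏αᵖ N)} {∏α k N} {proj₁ (∏βᵖ M)} {∏β k M}
      (proj₁-∏< N (λ i → ℚ[x].1+x^ (α k i)) (λ i → 1+x^ (α k i)) (λ i → proj₁-1+x^ (α k i)))
      (proj₁-∏< M (λ j → ℚ[x].1-x^ (β k j)) (λ j → 1-x^ (β k j)) (λ j → proj₁-1-x^ (β k j)))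

    -- The polynomial quotient `p` and the series `f * g` satisfy the same equation after
    -- multiplication by `D`. As `D` is a unit among the series, they are equal.
    W*g-finite : ∏αᵖ N ℚ[x].* ∏βᵖ M ℚ[x].∣ ∏γᵖ r ℚ[x].* W → Finite (f * g)
    W*g-finite ((p , p-finite) ℚ[x]., pD≗) = Finite-resp {p} {f * g} (*-cancel-unit D p (f * g) unit Dp≗Dfg) p-finite
      where
      Dp≗Dfg : ∀ i → (D * p) i ≡ (D * (f * g)) i
      Dp≗Dfg i = begin
        (D * p) i                                   ≡⟨ *ˢ-comm D p i ⟩
        (p * D) i
          ≡⟨ *ˢ-congˡ {p} {proj₁ (∏αᵖ N ℚ[x].* ∏βᵖ M)} {D} proj₁-D i ⟨
        (p * proj₁ (∏αᵖ N ℚ[x].* ∏βᵖ M)) i          ≡⟨ pD≗ i ⟩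
        (proj₁ (∏γᵖ r) * f) i                       ≡⟨ *ˢ-congʳ {f} {proj₁ (∏γᵖ r)} {∏γ k r}
                                                         (proj₁-∏< r (λ i → ℚ[x].1+x^ (γ k i)) (λ i → 1+x^ (γ k i))
                                                           (λ i → proj₁-1+x^ (γ k i))) i ⟩
        (∏γ k r * f) i                              ≡⟨ D*[W*g] i ⟨
        (D * (f * g)) i                             ∎

  proj₁-w : proj₁ wᵖ ≗ w
  proj₁-w = proj₁-1-x^ L

  proj₁-w^ : ∀ a → proj₁ (wᵖ ℚ[x].^ a) ≗ w ^ a
  proj₁-w^ a i = trans (cong (λ f → f i) (proj₁-^ wᵖ a)) (^-congˡ a {proj₁ wᵖ} {w} proj₁-w i)

  w^*g-equation : ∀ a i → (∏α k N * ∏β k M * (w ^ a * g)) i ≡ (∏γ k r * w ^ a) i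
  w^*g-equation a i = begin
    (D * (w ^ a * g)) i
      ≡⟨ *ˢ-congˡ {D} {f * g} {w ^ a * g} (*ˢ-congʳ {g} {f} {w ^ a} (proj₁-w^ a)) i ⟨
    (D * (f * g)) i                         ≡⟨ D*[W*g] (wᵖ ℚ[x].^ a) i ⟩
    (∏γ k r * f) i                          ≡⟨ *ˢ-congˡ {∏γ k r} {f} {w ^ a} (proj₁-w^ a) i ⟩
    (∏γ k r * w ^ a) i                      ∎
    where
    open ≡-Reasoning
    D = ∏α k N * ∏β k M
    f = proj₁ (wᵖ ℚ[x].^ a)

  -- Two stages: the recurrence gives finiteness without a useful bound, and then the degrees of
  -- `∏α` and `∏β` are subtracted from that of `∏γ k r * w ^ M`. `degree-count` turns the result
  -- into `Δ` plus the degree of `w ^ M`.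
  w^M*g-degree : n ≤ m → DegreeBelow (suc (δ k n m ℕ.+ M ℕ.* L)) (w ^ M * g)
  w^M*g-degree n≤m = ∏β-cancel (∏α-cancel (subst (λ d → DegreeBelow d (∏α k N * (∏β k M * f))) count rhs-degree))
    where
    f = w ^ M * g
    d = suc (δ k n m ℕ.+ M ℕ.* L)
    sα = Σ< N (α k)
    sβ = Σ< M (β k)
    f-finite : Finite f
    f-finite = Finite-resp {proj₁ (wᵖ ℚ[x].^ M) * g} {f} (*ˢ-congʳ {g} {proj₁ (wᵖ ℚ[x].^ M)} {w ^ M} (proj₁-w^ M))
      -- `N ≤ M` enters here: the `N` factors of `∏α` must fit into `w ^ M`.
      (W*g-finite (wᵖ ℚ[x].^ M) (∏α∏β∣∏γ r {wᵖ ℚ[x].^ M} refl (∏α∣w^ (s≤s n≤m)) ∏β∣w^M))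
    ∏β-finite : Finite (∏β k M)
    ∏β-finite = suc sβ , ∏<-degree M (λ j → 1-x^ (β k j)) (β k) (λ j → 1-x^-degree (β k j))
    rhs-degree : DegreeBelow (Σ< r (γ k) ℕ.+ suc (M ℕ.* L)) (∏α k N * (∏β k M * f))
    rhs-degree = DegreeBelow-resp {Σ< r (γ k) ℕ.+ suc (M ℕ.* L)} {∏γ k r * w ^ M} {∏α k N * (∏β k M * f)}
      (λ i → sym (trans (sym (*ˢ-assoc (∏α k N) (∏β k M) f i)) (w^*g-equation M i)))
      (*-degreeBelow (Σ< r (γ k)) (suc (M ℕ.* L)) (∏γ k r) (w ^ M)
        (∏<-degree r (λ i → 1+x^ (γ k i)) (γ k) (λ i → 1+x^-degree (γ k i)))
        (^-degree M w L (1-x^-degree L)))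
    count : Σ< r (γ k) ℕ.+ suc (M ℕ.* L) ≡ sα ℕ.+ (sβ ℕ.+ d)
    count = trans (cong (ℕ._+ suc (M ℕ.* L)) (sym (degree-count k n m)))
      (solve 4 (λ a b e l → a :+ b :+ e :+ (con 1 :+ l) := a :+ (b :+ (con 1 :+ (e :+ l)))) refl sα sβ (δ k n m) (M ℕ.* L))
      where open ℕ.+-*-Solver
    ∏α-cancel : DegreeBelow (sα ℕ.+ (sβ ℕ.+ d)) (∏α k N * (∏β k M * f)) → DegreeBelow (sβ ℕ.+ d) (∏β k M * f)
    ∏α-cancel = ∏<*-degree⁻¹ (λ i → 1+x^ (α k i)) (α k) (λ i → suc (α k i) , 1+x^-degree (α k i))
      (λ i e p → 1+x^*-degree⁻¹ (α k i) e p (α>0 i)) N (sβ ℕ.+ d) (∏β k M * f) (Finite-* {∏β k M} {f} ∏β-finite f-finite)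
    ∏β-cancel : DegreeBelow (sβ ℕ.+ d) (∏β k M * f) → DegreeBelow d f
    ∏β-cancel = ∏<*-degree⁻¹ (λ j → 1-x^ (β k j)) (β k) (λ j → suc (β k j) , 1-x^-degree (β k j))
      (λ j e p → 1-x^*-degree⁻¹ (β k j) e p (β>0 j)) M d f f-finite

  ∂^M-vanishes : n ≤ m → ∀ i → δ k n m < i → ∂^ L M g i ≡ 0ℚ
  ∂^M-vanishes n≤m i δ<i = trans (sym (1-x^^*≡∂^ L M g i))
    (w^M*g-degree n≤m (M ℕ.* L ℕ.+ i)
      (subst (_≤ M ℕ.* L ℕ.+ i) (trans (ℕ.+-suc (M ℕ.* L) (δ k n m)) (cong suc (ℕ.+-comm (M ℕ.* L) (δ k n m))))
        (ℕ.+-monoʳ-≤ (M ℕ.* L) δ<i)))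

  -- The least element of the class of s above the threshold
  start : ℕ → ℕ
  start s = suc (δ k n m) ℕ.+ (s ℕ.+ suc (δ k n m) ℕ.* (L ∸ 1)) % L

  private
    -- `suc δ * (L ∸ 1)` plays the part of `- suc δ` modulo `L`, which keeps `start` free of
    -- truncated subtraction.
    offset-mod : ∀ s → s ℕ.+ suc (δ k n m) ℕ.* (L ∸ 1) ℕ.+ suc (δ k n m) ≡ s ℕ.+ suc (δ k n m) ℕ.* L
    offset-mod s = trans (ℕ.+-assoc s _ d) (cong (s ℕ.+_) (trans (ℕ.+-comm (d ℕ.* (L ∸ 1)) d)
      (trans (sym (ℕ.*-suc d (L ∸ 1))) (cong (d ℕ.*_) (ℕ.suc-pred L)))))
      where d = suc (δ k n m)

  start≡ : ∀ s → ∃[ p ] ∃[ q ] start s ℕ.+ p ℕ.* L ≡ s ℕ.+ q ℕ.* L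
  start≡ s = z / L , d , (begin
    d ℕ.+ z % L ℕ.+ z / L ℕ.* L      ≡⟨ ℕ.+-assoc d (z % L) _ ⟩
    d ℕ.+ (z % L ℕ.+ z / L ℕ.* L)    ≡⟨ cong (d ℕ.+_) (m≡m%n+[m/n]*n z L) ⟨
    d ℕ.+ z                          ≡⟨ ℕ.+-comm d z ⟩
    z ℕ.+ d                          ≡⟨ offset-mod s ⟩
    s ℕ.+ d ℕ.* L                    ∎)
    where
    open ≡-Reasoning
    d = suc (δ k n m)
    z = s ℕ.+ d ℕ.* (L ∸ 1)

  above-start : ∀ s i → δ k n m < i → i ≡ s mod L → ∃[ t ] i ≡ t ℕ.* L ℕ.+ start s
  above-start s i δ<i i≡s with p , q , i+pL≡s+qL ← ≡-mod⇒ {i} {s} {L} i≡s = j / L , (begin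
    i                                ≡⟨ ℕ.m+[n∸m]≡n δ<i ⟨
    d ℕ.+ j                          ≡⟨ cong (d ℕ.+_) (m≡m%n+[m/n]*n j L) ⟩
    d ℕ.+ (j % L ℕ.+ j / L ℕ.* L)
      ≡⟨ cong (λ a → d ℕ.+ (a ℕ.+ j / L ℕ.* L)) (%-cong-multiples L {j} {z} (p ℕ.+ d) q j≡z) ⟩
    d ℕ.+ (z % L ℕ.+ j / L ℕ.* L)    ≡⟨ ℕ.+-assoc d (z % L) _ ⟨
    start s ℕ.+ j / L ℕ.* L          ≡⟨ ℕ.+-comm (start s) _ ⟩
    j / L ℕ.* L ℕ.+ start s          ∎)
    where
    open ≡-Reasoning
    d = suc (δ k n m)
    j = i ∸ d
    z = s ℕ.+ d ℕ.* (L ∸ 1)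
    j≡z : j ℕ.+ (p ℕ.+ d) ℕ.* L ≡ z ℕ.+ q ℕ.* L
    j≡z = ℕ.+-cancelʳ-≡ d _ _ (begin
      j ℕ.+ (p ℕ.+ d) ℕ.* L ℕ.+ d
        ≡⟨ solve 4 (λ j p d l → j :+ (p :+ d) :* l :+ d := (d :+ j) :+ p :* l :+ d :* l) refl j p d L ⟩
      d ℕ.+ j ℕ.+ p ℕ.* L ℕ.+ d ℕ.* L ≡⟨ cong (λ a → a ℕ.+ p ℕ.* L ℕ.+ d ℕ.* L) (ℕ.m+[n∸m]≡n δ<i) ⟩
      i ℕ.+ p ℕ.* L ℕ.+ d ℕ.* L       ≡⟨ cong (ℕ._+ d ℕ.* L) i+pL≡s+qL ⟩
      s ℕ.+ q ℕ.* L ℕ.+ d ℕ.* L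
        ≡⟨ solve 3 (λ s q d → s :+ q :+ d := s :+ d :+ q) refl s (q ℕ.* L) (d ℕ.* L) ⟩
      s ℕ.+ d ℕ.* L ℕ.+ q ℕ.* L       ≡⟨ cong (ℕ._+ q ℕ.* L) (offset-mod s) ⟨
      z ℕ.+ d ℕ.+ q ℕ.* L             ≡⟨ solve 3 (λ z d q → z :+ d :+ q := z :+ q :+ d) refl z d (q ℕ.* L) ⟩
      z ℕ.+ q ℕ.* L ℕ.+ d             ∎)
      where open ℕ.+-*-Solver

  Q : ℕ → Polynomial
  Q s = newtonPolynomial L (start s) 0 m (λ j → ∂^ L j g (start s))

  Q-degree : ∀ s → DegreeAtMost m (Q s)
  Q-degree s = newtonPolynomial-degree L (start s) 0 m (λ j → ∂^ L j g (start s))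

  start>δ : ∀ s → δ k n m < start s
  start>δ s = ℕ.m≤m+n (suc (δ k n m)) _

  Q-correct : n ≤ m → ∀ s i → δ k n m < i → i ≡ s mod L → g i ≡ eval (Q s) (fromℕ i)
  Q-correct n≤m s i δ<i i≡s = go (above-start s i δ<i i≡s)
    where
    open ≡-Reasoning
    go : ∃[ t ] i ≡ t ℕ.* L ℕ.+ start s → g i ≡ eval (Q s) (fromℕ i)
    go (t , refl) = begin
      g (t ℕ.* L ℕ.+ start s)
        ≡⟨ newton-∂ L m g (start s) (λ i s≤i → ∂^M-vanishes n≤m i (ℕ.≤-trans (start>δ s) s≤i)) t ⟩
      newton 0 m (λ j → ∂^ L j g (start s)) t
        ≡⟨ eval-newtonPolynomial L (start s) 0 m (λ j → ∂^ L j g (start s)) t ⟨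
      1ℚ ℚ.* eval (Q s) (fromℕ (t ℕ.* L ℕ.+ start s))
        ≡⟨ ℚ.*-identityˡ _ ⟩
      eval (Q s) (fromℕ (t ℕ.* L ℕ.+ start s)) ∎

  h : PowerSeries
  h = w ^ m * g

  -- The `m`-th difference is constant along each class beyond the threshold. The free `t` lets its
  -- value be read arbitrarily far out, where the eventual form of `h` is known.
  coeff-Q : n ≤ m → ∀ s t → coeff (Q s) m ℚ.* fromℕ (L ℕ.^ m ℕ.* m !) ≡ h (m ℕ.* L ℕ.+ (t ℕ.* L ℕ.+ start s))
  coeff-Q n≤m s t = begin
    coeff (Q s) m ℚ.* fromℕ (L ℕ.^ m ℕ.* m !)
      ≡⟨ coeff-newtonPolynomial L (start s) 0 m (λ j → ∂^ L j g (start s)) ⟩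
    ∂^ L m g (start s) ℚ.* 1ℚ                   ≡⟨ newton-∂ L 0 (∂^ L m g) (start s) constant t ⟨
    ∂^ L m g (t ℕ.* L ℕ.+ start s)              ≡⟨ 1-x^^*≡∂^ L m g (t ℕ.* L ℕ.+ start s) ⟨
    h (m ℕ.* L ℕ.+ (t ℕ.* L ℕ.+ start s))       ∎
    where
    open ≡-Reasoning
    constant : ∀ i → start s ≤ i → ∂ L (∂^ L m g) i ≡ 0ℚ
    constant i s≤i = trans (sym (∂^-comm L m g i)) (∂^M-vanishes n≤m i (ℕ.≤-trans (start>δ s) s≤i))

  private
    far : ∀ s t → t ≤ m ℕ.* L ℕ.+ (t ℕ.* L ℕ.+ start s)
    far s t = ℕ.m≤n⇒m≤o+n (m ℕ.* L) (ℕ.m≤n⇒m≤n+o (start s) (ℕ.m≤m*n t L))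

  coeff-Q-const : n ≤ m → ∀ a → EventuallyConst h a → ∀ s → coeff (Q s) m ℚ.* fromℕ (L ℕ.^ m ℕ.* m !) ≡ a
  coeff-Q-const n≤m a (n₀ , h≡a) s = trans (coeff-Q n≤m s n₀) (h≡a _ (far s n₀))

  -- Since `L` is even, steps of `L` do not change the parity, so the sign at the index that is read
  -- is the sign of the class `s`.
  coeff-Q-alternating : n ≤ m → 2 ∣ L → ∀ a b → EventuallyAlternating h a b → ∀ s →
    coeff (Q s) m ℚ.* fromℕ (L ℕ.^ m ℕ.* m !) ≡ a ℚ.+ σ s ℚ.* b
  coeff-Q-alternating n≤m 2∣L a b (n₀ , h≡) s = trans (coeff-Q n≤m s n₀)
    (trans (h≡ _ (far s n₀)) (cong (λ e → a ℚ.+ e ℚ.* b) parity))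
    where
    open ≡-Reasoning
    σ-L : ∀ q i → σ (q ℕ.* L ℕ.+ i) ≡ σ i
    σ-L q i = trans (σ-+ (q ℕ.* L) i) (trans (cong (ℚ._* σ i) (σ-even (∣n⇒∣m*n q 2∣L))) (ℚ.*-identityˡ (σ i)))
    class : ∃[ p ] ∃[ q ] start s ℕ.+ p ℕ.* L ≡ s ℕ.+ q ℕ.* L → σ (start s) ≡ σ s
    class (p , q , eq) = begin
      σ (start s)               ≡⟨ σ-L p (start s) ⟨
      σ (p ℕ.* L ℕ.+ start s)   ≡⟨ cong σ (trans (ℕ.+-comm (p ℕ.* L) _) (trans eq (ℕ.+-comm s _))) ⟩
      σ (q ℕ.* L ℕ.+ s)         ≡⟨ σ-L q s ⟩
      σ s                       ∎
    parity : σ (m ℕ.* L ℕ.+ (n₀ ℕ.* L ℕ.+ start s)) ≡ σ s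
    parity = trans (σ-L m _) (trans (σ-L n₀ (start s)) (class (start≡ s)))

  -- Serves both constants: with `e = β k` for the pole at 1, and with `e = α k` after `x ↦ -x` for
  -- the pole at -1. `e′` is the same family as spelled in `A` and `B`.
  limit : ∀ y a (e e′ g′ : ℕ → ℕ) → (∀ i → e′ i ≡ e i) → EventuallyConst y (∏ℚ.∏< N (λ _ → fromℕ 2) ℚ.* a) →
    ∏< M (λ i → 1-x^ (e i)) * y ≗ ∏< r (λ i → 1+x^ (g′ i)) * w ^ m →
    .{{_ : NonZero (∏ {M} (e′ ∘ toℕ))}} →
    a ≡ (+ (2 ℕ.^ m) ℚ./ ∏ {M} (e′ ∘ toℕ)) ℚ.* fromℕ (L ℕ.^ m)
  limit y a e e′ g′ e′≡e y-const eq = limit-value N m L (∏ {M} (e′ ∘ toℕ)) a (begin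
    fromℕ (∏ {M} (e′ ∘ toℕ)) ℚ.* (fromℕ (2 ℕ.^ N) ℚ.* a)
      ≡⟨ cong₂ (λ p q → p ℚ.* (q ℚ.* a)) (trans (sym (fromℕ-∏ M e′)) (∏ℚ.∏<-cong M (λ i → cong fromℕ (e′≡e i))))
           (sym (∏ℚ-const N 2)) ⟩
    ∏ℚ.∏< M (fromℕ ∘ e) ℚ.* (∏ℚ.∏< N (λ _ → fromℕ 2) ℚ.* a)
      ≡⟨ limit-equation m r L e g′ y (∏ℚ.∏< N (λ _ → fromℕ 2) ℚ.* a) y-const eq ⟩
    ∏ℚ.∏< r (λ _ → fromℕ 2) ℚ.* fromℕ L ^ℚ m
      ≡⟨ cong₂ ℚ._*_ (trans (∏ℚ-const r 2) (cong (λ r → fromℕ (2 ℕ.^ r)) (ℕ.+-suc n m))) (fromℕ-^ L m) ⟩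
    fromℕ (2 ℕ.^ (N ℕ.+ m)) ℚ.* fromℕ (L ℕ.^ m) ∎)
    where open ≡-Reasoning

  instance
    A≢0 : NonZero (A k M)
    A≢0 = A-nonZero k M

  A-limit : ∀ a → EventuallyConst (∏α k N * h) (∏ℚ.∏< N (λ _ → fromℕ 2) ℚ.* a) →
    a ≡ (+ (2 ℕ.^ m) ℚ./ A k M) ℚ.* fromℕ (L ℕ.^ m)
  A-limit a y-const = limit (∏α k N * h) a (β k) (λ j → (k ℕ.+ 1) ℕ.* j ℕ.+ 1) (γ k) (β≡ k) y-const λ i → begin
    (∏β k M * (∏α k N * h)) i     ≡⟨ *ˢ-assoc (∏β k M) (∏α k N) h i ⟨
    (∏β k M * ∏α k N * h) i
      ≡⟨ *ˢ-congʳ {h} {∏β k M * ∏α k N} {∏α k N * ∏β k M} (*ˢ-comm (∏β k M) (∏α k N)) i ⟩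
    (∏α k N * ∏β k M * h) i       ≡⟨ w^*g-equation m i ⟩
    (∏γ k r * w ^ m) i            ∎
    where open ≡-Reasoning

  A-limit-const : ∀ a → EventuallyConst h a → a ≡ (+ (2 ℕ.^ m) ℚ./ A k M) ℚ.* fromℕ (L ℕ.^ m)
  A-limit-const a h-const = A-limit a (∏1+x^*-const N (α k) h a h-const)

  module _ (k-odd : 2 ∣ suc k) where

    α-odd : ∀ i → 2 ∣ suc (α k i)
    α-odd i = subst (2 ∣_) (trans (cong (ℕ._* suc i) (ℕ.+-comm 1 k)) ([k+1][1+i]≡1+α k i)) (∣m⇒∣m*n (suc i) k-odd)

    β-odd : ∀ j → 2 ∣ suc (β k j)
    β-odd j = subst (2 ∣_) (ℕ.+-suc (suc k ℕ.* j) 1) (∣m∣n⇒∣m+n (∣m⇒∣m*n j k-odd) (divides 1 refl))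

    γ-even : ∀ i → 2 ∣ γ k i
    γ-even i = ∣m⇒∣m*n (suc i) k-odd

    L-even : 2 ∣ L
    L-even = ∣-trans (m∣m*n (α k 0)) (2α∣Λ k N M {0} (s≤s z≤n))

    A-limit-alternating : ∀ a b → EventuallyAlternating h a b → a ≡ (+ (2 ℕ.^ m) ℚ./ A k M) ℚ.* fromℕ (L ℕ.^ m)
    A-limit-alternating a b h-alt = A-limit a (∏1+x^*-alternating n (α k) h a b α-odd h-alt)

    -- For odd `k` all `α` and `β` are odd while `γ` and `L` are even. So `x ↦ -x` fixes the
    -- numerator and `w`, and makes the `α` family the one that vanishes at 1; hence `B` in place of
    -- `A`. `N = M` makes the exchanged families have the sizes that `limit` expects.
    B-limit-alternating : n ≡ m → ∀ a b → EventuallyAlternating h a b →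
      b ≡ ((+ (2 ℕ.^ m) ℚ./ B k M) {{B-nonZero k M}}) ℚ.* fromℕ (L ℕ.^ m)
    B-limit-alternating refl a b h-alt = limit (p * twist h) b (α k) (λ i → (k ℕ.+ 1) ℕ.* suc i ∸ 1) (γ k) (α≡ k)
      (∏1+x^*-alternating n (β k) (twist h) b a β-odd (twist-alternating h a b h-alt))
      (λ i → begin
        (q * (p * twist h)) i                                   ≡⟨ *ˢ-assoc q p (twist h) i ⟨
        (q * p * twist h) i
          ≡⟨ *ˢ-congʳ {twist h} {twist (∏α k N * ∏β k N)} {q * p} twist-D i ⟨
        (twist (∏α k N * ∏β k N) * twist h) i                   ≡⟨ twist-* (∏α k N * ∏β k N) h i ⟨
        twist (∏α k N * ∏β k N * h) i                           ≡⟨ cong (σ i ℚ.*_) (w^*g-equation m i) ⟩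
        twist (∏γ k r * w ^ m) i                                ≡⟨ twist-* (∏γ k r) (w ^ m) i ⟩
        (twist (∏γ k r) * twist (w ^ m)) i
          ≡⟨ *ˢ-cong {twist (∏γ k r)} {∏γ k r} {twist (w ^ m)} {w ^ m}
                                                                     (twist-∏< r (λ i → 1+x^ (γ k i)) (λ i → 1+x^ (γ k i))
                                                                       (λ i → twist-1+x^-even {γ k i} (γ-even i)))
                                                                     (twist-^ m w w (twist-1-x^-even {L} L-even)) i ⟩
        (∏γ k r * w ^ m) i                                      ∎)
      {{B-nonZero k M}}
      where
      open ≡-Reasoning
      p = ∏< N λ j → 1+x^ (β k j)
      q = ∏< N λ i → 1-x^ (α k i)
      twist-D : twist (∏α k N * ∏β k N) ≗ q * p
      twist-D i = trans (twist-* (∏α k N) (∏β k N) i) (*ˢ-cong {twist (∏α k N)} {q} {twist (∏β k N)} {p}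
        (twist-∏< N (λ i → 1+x^ (α k i)) (λ i → 1-x^ (α k i)) (λ i → twist-1+x^-odd {α k i} (α-odd i)))
        (twist-∏< N (λ j → 1-x^ (β k j)) (λ j → 1+x^ (β k j)) (λ j → twist-1-x^-odd {β k j} (β-odd j))) i)

  -- Saving one power of `w`: the three cases of the leading coefficient

  Wᵖ : ℚ[x].Carrier
  Wᵖ = (ℚ[x].1-x^ 1) ℚ[x].* wᵖ ℚ[x].^ m

  W*g≗ : proj₁ Wᵖ * g ≗ (1-x^ 1) * h
  W*g≗ i = trans
    (*ˢ-congʳ {g} {proj₁ Wᵖ} {(1-x^ 1) * w ^ m}
      (*ˢ-cong {proj₁ (ℚ[x].1-x^ 1)} {1-x^ 1} {proj₁ (wᵖ ℚ[x].^ m)} {w ^ m} (proj₁-1-x^ 1) (proj₁-w^ m)) i)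
    (*ˢ-assoc (1-x^ 1) (w ^ m) g i)

  ∏β∣W : ∏βᵖ M ℚ[x].∣ Wᵖ
  ∏β∣W = ∏β∣[1-x]w^ refl

  multiple-finite : ∀ t → ∏αᵖ N ℚ[x].∣ t ℚ[x].* Wᵖ → Finite (proj₁ t * ((1-x^ 1) * h))
  multiple-finite t ∏α∣tW = Finite-resp {proj₁ (t ℚ[x].* Wᵖ) * g} {proj₁ t * ((1-x^ 1) * h)}
    (λ i → trans (*ˢ-assoc (proj₁ t) (proj₁ Wᵖ) g i) (*ˢ-congˡ {proj₁ t} {proj₁ Wᵖ * g} {(1-x^ 1) * h} W*g≗ i))
    (W*g-finite (t ℚ[x].* Wᵖ) (∏α∏β∣∏γ r {t ℚ[x].* Wᵖ} refl ∏α∣tW (ℚ[x].x∣ʳy⇒x∣ʳzy t ∏β∣W)))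

  -- With `N < M` the power `w ^ m` alone has room for the `N` factors of `∏α`, so `t = 1` will do.
  [1-x]h-finite-< : N ≤ m → Finite ((1-x^ 1) * h)
  [1-x]h-finite-< N≤m = Finite-resp {1# * ((1-x^ 1) * h)} {(1-x^ 1) * h} (*ˢ-identityˡ ((1-x^ 1) * h))
    (multiple-finite ℚ[x].1# (ℚ[x].x∣ʳy⇒x∣ʳzy ℚ[x].1# (ℚ[x].x∣ʳy⇒x∣ʳzy (ℚ[x].1-x^ 1) (∏α∣w^ N≤m))))

  -- The constant `t = 2` from `pair-∣-even` is harmless, as 2 is invertible in ℚ.
  [1-x]h-finite-even : ∀ {n′} → n ≡ suc n′ → n ≡ m → 2 ∣ k → Finite ((1-x^ 1) * h)
  [1-x]h-finite-even {n′} refl refl 2∣k = halve (multiple-finite 2ᵖ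
    (∏α∣t[1-x]w^ {n′} 2ᵖ refl (ℚ[x].pair-∣-even k {wᵖ} 2∣k)))
    where
    2ᵖ = ℚ[x].1# ℚ[x].+ ℚ[x].1#
    f = (1-x^ 1) * h
    halve : Finite ((1# + 1#) * f) → Finite f
    halve (d , ≡0) = d , λ i d≤i → *fromℕ-cancelʳ 2 (begin
      f i ℚ.* fromℕ 2         ≡⟨ solve 1 (λ a → a :* con (fromℕ 2) := a :+ a) refl (f i) ⟩
      f i ℚ.+ f i             ≡⟨ cong (f i ℚ.+_) (*ˢ-identityˡ f i) ⟨
      f i ℚ.+ (1# * f) i      ≡⟨ [1+]-* 1# f i ⟨
      ((1# + 1#) * f) i       ≡⟨ ≡0 i d≤i ⟩
      0ℚ ℚ.* fromℕ 2          ∎)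
      where
      open ≡-Reasoning
      open +-*-Solver

  [1-x²]h-finite : ∀ {n′} → n ≡ suc n′ → n ≡ m → Finite ((1+x^ 1) * ((1-x^ 1) * h))
  [1-x²]h-finite {n′} refl refl = Finite-resp {proj₁ (ℚ[x].1+x^ 1) * ((1-x^ 1) * h)} {(1+x^ 1) * ((1-x^ 1) * h)}
    (*ˢ-congʳ {(1-x^ 1) * h} {proj₁ (ℚ[x].1+x^ 1)} {1+x^ 1} (proj₁-1+x^ 1))
    (multiple-finite (ℚ[x].1+x^ 1) (∏α∣t[1-x]w^ {n′} (ℚ[x].1+x^ 1) refl (ℚ[x].pair-∣ k {wᵖ})))

  private
    instance
      m!≢0 : NonZero (m !)
      m!≢0 = m ℕ.!≢0
      Lᵐ≢0 : NonZero (L ℕ.^ m)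
      Lᵐ≢0 = ℕ.m^n≢0 L m

  coeff-factorial : ∀ {s v} → coeff (Q s) m ℚ.* fromℕ (L ℕ.^ m ℕ.* m !) ≡ v ℚ.* fromℕ (L ℕ.^ m) →
    coeff (Q s) m ℚ.* fromℕ (m !) ≡ v
  coeff-factorial {s} {v} eq = *fromℕ-cancelʳ (L ℕ.^ m) (begin
    coeff (Q s) m ℚ.* fromℕ (m !) ℚ.* fromℕ (L ℕ.^ m)
      ≡⟨ solve 3 (λ a b c → a :* b :* c := a :* (c :* b)) refl (coeff (Q s) m) (fromℕ (m !)) (fromℕ (L ℕ.^ m)) ⟩
    coeff (Q s) m ℚ.* (fromℕ (L ℕ.^ m) ℚ.* fromℕ (m !))
      ≡⟨ cong (coeff (Q s) m ℚ.*_) (fromℕ-* (L ℕ.^ m) (m !)) ⟨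
    coeff (Q s) m ℚ.* fromℕ (L ℕ.^ m ℕ.* m !)             ≡⟨ eq ⟩
    v ℚ.* fromℕ (L ℕ.^ m)                                 ∎)
    where
    open ≡-Reasoning
    open +-*-Solver

  coeff-leading : n ≤ m → Finite ((1-x^ 1) * h) → ∀ s → coeff (Q s) m ≡ leading k M
  coeff-leading n≤m finite s = from-limit (constant-tail h finite)
    where
    open ≡-Reasoning
    q = coeff (Q s) m
    from-limit : ∃[ a ] EventuallyConst h a → q ≡ leading k M
    from-limit (a , h-const) = /-≡ {2 ℕ.^ m} {m ! ℕ.* A k M} {{ℕ.m*n≢0 (m !) (A k M)}} (begin
      q ℚ.* fromℕ (m ! ℕ.* A k M)                         ≡⟨ cong (q ℚ.*_) (fromℕ-* (m !) (A k M)) ⟩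
      q ℚ.* (fromℕ (m !) ℚ.* fromℕ (A k M))               ≡⟨ ℚ.*-assoc q (fromℕ (m !)) (fromℕ (A k M)) ⟨
      q ℚ.* fromℕ (m !) ℚ.* fromℕ (A k M)
        ≡⟨ cong (ℚ._* fromℕ (A k M)) (coeff-factorial {s} {+ (2 ℕ.^ m) ℚ./ A k M}
            (trans (coeff-Q-const n≤m a h-const s) (A-limit-const a h-const))) ⟩
      (+ (2 ℕ.^ m) ℚ./ A k M) ℚ.* fromℕ (A k M)           ≡⟨ /-*-cancel (2 ℕ.^ m) (A k M) ⟩
      fromℕ (2 ℕ.^ m)                                     ∎)

  coeff-leadingAlternating : n ≡ m → 2 ∣ suc k → Finite ((1+x^ 1) * ((1-x^ 1) * h)) → ∀ s →
    coeff (Q s) m ≡ leadingAlternating k M s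
  coeff-leadingAlternating n≡m k-odd finite s = from-limits (alternating-tail h finite)
    where
    open ≡-Reasoning
    open +-*-Solver
    instance _ = B-nonZero k M
    q = coeff (Q s) m
    u₁ = + (2 ℕ.^ m) ℚ./ A k M
    u₂ = + (2 ℕ.^ m) ℚ./ B k M
    v = u₁ ℚ.+ σ s ℚ.* u₂
    expand : ∀ a b → EventuallyAlternating h a b → a ℚ.+ σ s ℚ.* b ≡ v ℚ.* fromℕ (L ℕ.^ m)
    expand a b h-alt = trans
      (cong₂ (λ a b → a ℚ.+ σ s ℚ.* b) (A-limit-alternating k-odd a b h-alt) (B-limit-alternating k-odd n≡m a b h-alt))
      (solve 4 (λ u w s l → u :* l :+ s :* (w :* l) := (u :+ s :* w) :* l) refl u₁ u₂ (σ s) (fromℕ (L ℕ.^ m)))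
    from-limits : ∃[ a ] ∃[ b ] EventuallyAlternating h a b → q ≡ leadingAlternating k M s
    from-limits (a , b , h-alt) = *fromℕ-cancelʳ (m !) (begin
      q ℚ.* fromℕ (m !)                                        ≡⟨ coeff-factorial {s} {v} (trans
          (coeff-Q-alternating (ℕ.≤-reflexive n≡m) (L-even k-odd) a b h-alt s) (expand a b h-alt)) ⟩
      v                                                        ≡⟨ ℚ.*-identityˡ v ⟨
      1ℚ ℚ.* v                                                 ≡⟨ cong (ℚ._* v) (/-*-cancel 1 (m !)) ⟨
      (+ 1 ℚ./ m !) ℚ.* fromℕ (m !) ℚ.* v
        ≡⟨ solve 3 (λ a b c → a :* b :* c := a :* c :* b) refl (+ 1 ℚ./ m !) (fromℕ (m !)) v ⟩
      (+ 1 ℚ./ m !) ℚ.* v ℚ.* fromℕ (m !)                      ∎)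

-- The case k = 1, N = M: G = ∏ (1 + x^{2r}) / ∏ (1 - x^{4j+2})

EvenPositive : PowerSeries → Set
EvenPositive f = ∀ n → (2 ∤ n → f n ≡ 0ℚ) × (2 ∣ n → 0ℚ ℚ.< f n)

EvenPositive-resp : ∀ {f g} → f ≗ g → EvenPositive f → EvenPositive g
EvenPositive-resp f≗g f-even n = (λ 2∤n → trans (sym (f≗g n)) (proj₁ (f-even n) 2∤n)) ,
  λ 2∣n → subst (0ℚ ℚ.<_) (f≗g n) (proj₂ (f-even n) 2∣n)

below-or-above : ∀ e n → n < e ⊎ ∃[ i ] n ≡ e ℕ.+ i
below-or-above e n with ℕ.≤-total e n
... | inj₁ e≤n = inj₂ (n ∸ e , sym (ℕ.m+[n∸m]≡n e≤n))
... | inj₂ n≤e with ℕ.m≤n⇒m<n∨m≡n n≤e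
...   | inj₁ n<e  = inj₁ n<e
...   | inj₂ refl = inj₂ (0 , sym (ℕ.+-identityʳ n))

1+x^*-even : ∀ e f → 2 ∣ e → EvenPositive f → EvenPositive (1+x^ e * f)
1+x^*-even e f 2∣e f-even n with below-or-above e n
... | inj₁ n<e = (λ 2∤n → trans value (proj₁ (f-even n) 2∤n)) , λ 2∣n → subst (0ℚ ℚ.<_) (sym value) (proj₂ (f-even n) 2∣n)
  where
  value : (1+x^ e * f) n ≡ f n
  value = trans ([1+]-* (x ^ e) f n) (trans (cong (f n ℚ.+_) (x^*-< e f n n<e)) (ℚ.+-identityʳ (f n)))
... | inj₂ (i , refl) =
  (λ 2∤n → trans (1+x^*-+ e f i) (cong₂ ℚ._+_ (proj₁ (f-even (e ℕ.+ i)) 2∤n) (proj₁ (f-even i) λ 2∣i → 2∤n (∣m∣n⇒∣m+n 2∣e 2∣i)))) ,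
  λ 2∣n → subst (0ℚ ℚ.<_) (sym (1+x^*-+ e f i)) (ℚ.+-mono-< (proj₂ (f-even (e ℕ.+ i)) 2∣n) (proj₂ (f-even i) (∣m+n∣m⇒∣n 2∣n 2∣e)))

-- Dividing by `1 - x^e` adds to each coefficient the one `e` places earlier, which has the same
-- parity of index; strong induction then preserves both zeros and signs.
1-x^*-even⁻¹ : ∀ e f → 0 < e → 2 ∣ e → EvenPositive (1-x^ e * f) → EvenPositive f
1-x^*-even⁻¹ e f 0<e 2∣e f-even n = <-rec (λ n → (2 ∤ n → f n ≡ 0ℚ) × (2 ∣ n → 0ℚ ℚ.< f n)) step n
  where
  step : ∀ n → (∀ {i} → i < n → (2 ∤ i → f i ≡ 0ℚ) × (2 ∣ i → 0ℚ ℚ.< f i)) → (2 ∤ n → f n ≡ 0ℚ) × (2 ∣ n → 0ℚ ℚ.< f n)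
  step n rec with below-or-above e n
  ... | inj₁ n<e = (λ 2∤n → trans value (proj₁ (f-even n) 2∤n)) , λ 2∣n → subst (0ℚ ℚ.<_) (sym value) (proj₂ (f-even n) 2∣n)
    where
    value : f n ≡ (1-x^ e * f) n
    value = sym (trans ([1-]-* (x ^ e) f n) (trans (cong (λ a → f n ℚ.- a) (x^*-< e f n n<e)) (ℚ.+-identityʳ (f n))))
  ... | inj₂ (i , refl) =
    (λ 2∤n → trans value (cong₂ ℚ._+_ (proj₁ (f-even (e ℕ.+ i)) 2∤n) (proj₁ (rec i<n) λ 2∣i → 2∤n (∣m∣n⇒∣m+n 2∣e 2∣i)))) ,
    λ 2∣n → subst (0ℚ ℚ.<_) (sym value) (ℚ.+-mono-< (proj₂ (f-even (e ℕ.+ i)) 2∣n) (proj₂ (rec i<n) (∣m+n∣m⇒∣n 2∣n 2∣e)))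
    where
    i<n : i < e ℕ.+ i
    i<n = ℕ.+-monoˡ-≤ i 0<e
    value : f (e ℕ.+ i) ≡ (1-x^ e * f) (e ℕ.+ i) ℚ.+ f i
    value = trans (solve 2 (λ a b → a := a :- b :+ b) refl (f (e ℕ.+ i)) (f i)) (cong (ℚ._+ f i) (sym (1-x^*-+ e f i)))
      where open +-*-Solver

∏1+x^*-even : ∀ n (e : ℕ → ℕ) f → (∀ i → 2 ∣ e i) → EvenPositive f → EvenPositive (∏< n (λ i → 1+x^ (e i)) * f)
∏1+x^*-even zero    e f 2∣e f-even = EvenPositive-resp {f} {1# * f} (λ n → sym (*ˢ-identityˡ f n)) f-even
∏1+x^*-even (suc n) e f 2∣e f-even = EvenPositive-resp {p * (1+x^ (e n) * f)} {p * 1+x^ (e n) * f}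
  (λ i → sym (*ˢ-assoc p (1+x^ (e n)) f i)) (∏1+x^*-even n e (1+x^ (e n) * f) 2∣e (1+x^*-even (e n) f (2∣e n) f-even))
  where p = ∏< n λ i → 1+x^ (e i)

∏1-x^*-even⁻¹ : ∀ n (e : ℕ → ℕ) f → (∀ i → 0 < e i) → (∀ i → 2 ∣ e i) →
  EvenPositive (∏< n (λ i → 1-x^ (e i)) * f) → EvenPositive f
∏1-x^*-even⁻¹ zero    e f 0<e 2∣e f-even = EvenPositive-resp {1# * f} {f} (*ˢ-identityˡ f) f-even
∏1-x^*-even⁻¹ (suc n) e f 0<e 2∣e f-even = 1-x^*-even⁻¹ (e n) f (0<e n) (2∣e n)
  (∏1-x^*-even⁻¹ n e (1-x^ (e n) * f) 0<e 2∣e (EvenPositive-resp {p * 1-x^ (e n) * f} {p * (1-x^ (e n) * f)}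
    (*ˢ-assoc p (1-x^ (e n)) f) f-even))
  where p = ∏< n λ i → 1-x^ (e i)

1/[1-x²]-even : EvenPositive (1# ÷ 1-x^ 2)
1/[1-x²]-even n = <-rec (λ n → (2 ∤ n → e n ≡ 0ℚ) × (2 ∣ n → 0ℚ ℚ.< e n)) step n
  where
  e = 1# ÷ 1-x^ 2
  e-suc : ∀ n → e (2 ℕ.+ n) ≡ e n
  e-suc n = trans (solve 2 (λ a b → a := a :- b :+ b) refl (e (2 ℕ.+ n)) (e n))
    (trans (cong (ℚ._+ e n) (trans (sym (1-x^*-+ 2 e n)) (Series.÷-correct 1# (1-x^ 2) refl (2 ℕ.+ n)))) (ℚ.+-identityˡ (e n)))
    where open +-*-Solver
  step : ∀ n → (∀ {i} → i < n → (2 ∤ i → e i ≡ 0ℚ) × (2 ∣ i → 0ℚ ℚ.< e i)) → (2 ∤ n → e n ≡ 0ℚ) × (2 ∣ n → 0ℚ ℚ.< e n)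
  step zero          rec = (λ 2∤0 → contradiction (divides 0 refl) 2∤0) , λ _ → ℚ.positive⁻¹ 1ℚ
  step (suc zero)    rec = (λ _ → refl) , λ 2∣1 → contradiction (∣1⇒≡1 2∣1) λ ()
  step (suc (suc n)) rec = (λ 2∤ → trans (e-suc n) (proj₁ (rec n<) λ 2∣n → 2∤ (∣m∣n⇒∣m+n (divides 1 refl) 2∣n))) ,
    λ 2∣ → subst (0ℚ ℚ.<_) (sym (e-suc n)) (proj₂ (rec n<) (∣m+n∣m⇒∣n 2∣ (divides 1 refl)))
    where
    n< : n < 2 ℕ.+ n
    n< = s≤s (ℕ.n≤1+n n)

-- The denominator factor for `j = 0` is kept apart as the seed: `1 / (1 - x²)` already has every
-- even coefficient positive, and the other factors only have to preserve this.
G-even : ∀ n → EvenPositive (G 1 (suc n) (suc n))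
G-even n = ∏1-x^*-even⁻¹ n (λ i → 2 ℕ.* β 1 (suc i)) g
  (λ i → ℕ.≤-trans (ℕ.m≤n+m 1 (2 ℕ.* suc i)) (ℕ.m≤n*m (β 1 (suc i)) 2)) (λ i → m∣m*n (β 1 (suc i)))
  (EvenPositive-resp {∏γ 1 r * e} {p * g} quotient (∏1+x^*-even r (γ 1) e (λ i → m∣m*n (suc i)) 1/[1-x²]-even))
  where
  open ≡-Reasoning
  g = G 1 (suc n) (suc n)
  e = 1# ÷ 1-x^ 2
  r = n ℕ.+ suc n
  p = ∏< n λ i → 1-x^ (2 ℕ.* β 1 (suc i))
  -- At `k = 1` the exponent families `α` and `β` coincide, so the factors pair up to even
  -- binomials.
  factor : ∀ i → 1+x^ (α 1 i) * 1-x^ (β 1 i) ≗ 1-x^ (2 ℕ.* β 1 i)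
  factor i j = begin
    (1+x^ (α 1 i) * 1-x^ b) j           ≡⟨ cong (λ a → (1+x^ a * 1-x^ b) j) (ℕ.+-comm 1 (2 ℕ.* i)) ⟩
    (1+x^ b * 1-x^ b) j                 ≡⟨ *ˢ-comm (1+x^ b) (1-x^ b) j ⟩
    (1-x^ b * 1+x^ b) j                 ≡⟨ [1-x^][1+x^] b j ⟩
    (1-x^ (2 ℕ.* b)) j                  ∎
    where b = β 1 i
  D≗ : ∏α 1 (suc n) * ∏β 1 (suc n) ≗ 1-x^ 2 * p
  D≗ j = begin
    (∏α 1 (suc n) * ∏β 1 (suc n)) j
      ≡⟨ ∏<-* (suc n) (λ i → 1+x^ (α 1 i)) (λ i → 1-x^ (β 1 i)) j ⟨
    ∏< (suc n) (λ i → 1+x^ (α 1 i) * 1-x^ (β 1 i)) j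
      ≡⟨ ∏<-cong (suc n) {λ i → 1+x^ (α 1 i) * 1-x^ (β 1 i)} {λ i → 1-x^ (2 ℕ.* β 1 i)} factor j ⟩
    ∏< (suc n) (λ i → 1-x^ (2 ℕ.* β 1 i)) j                     ≡⟨ ∏<-suc n (λ i → 1-x^ (2 ℕ.* β 1 i)) j ⟩
    (1-x^ 2 * p) j                                              ∎
  quotient : ∏γ 1 r * e ≗ p * g
  quotient = *-cancel-unit (1-x^ 2) (∏γ 1 r * e) (p * g) refl λ j → begin
    (1-x^ 2 * (∏γ 1 r * e)) j         ≡⟨ *ˢ-comm (1-x^ 2) (∏γ 1 r * e) j ⟩
    (∏γ 1 r * e * 1-x^ 2) j           ≡⟨ *ˢ-assoc (∏γ 1 r) e (1-x^ 2) j ⟩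
    (∏γ 1 r * (e * 1-x^ 2)) j
      ≡⟨ *ˢ-congˡ {∏γ 1 r} {e * 1-x^ 2} {1#} (λ i → trans (*ˢ-comm e (1-x^ 2) i) (Series.÷-correct 1# (1-x^ 2) refl i)) j ⟩
    (∏γ 1 r * 1#) j                   ≡⟨ trans (*ˢ-comm (∏γ 1 r) 1# j) (*ˢ-identityˡ (∏γ 1 r) j) ⟩
    ∏γ 1 r j                          ≡⟨ G-equation 1 (suc n) (suc n) j ⟨
    (∏α 1 (suc n) * ∏β 1 (suc n) * g) j ≡⟨ *ˢ-congʳ {g} {∏α 1 (suc n) * ∏β 1 (suc n)} {1-x^ 2 * p} D≗ j ⟩
    (1-x^ 2 * p * g) j                ≡⟨ *ˢ-assoc (1-x^ 2) p g j ⟩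
    (1-x^ 2 * (p * g)) j              ∎

-- From positive leading coefficients in all classes to positive coefficients

eventually-positive : ∀ k n m .{{_ : NonZero k}} → n ≤ m →
  (∀ s → 0ℚ ℚ.< coeff (Fixed.Q k n m s) m) → ∃[ n₀ ] ∀ i → n₀ ≤ i → 0ℚ ℚ.< c k (suc n) (suc m) i
eventually-positive k n m n≤m 0<coeff = conclude (Eventually-Fin L λ r →
  eval-eventually-positive (Q (toℕ r)) m (Q-degree (toℕ r)) (0<coeff (toℕ r)))
  where
  open Fixed k n m
  conclude : Eventually (λ i → (r : Fin L) → 0ℚ ℚ.< eval (Q (toℕ r)) (fromℕ i)) → ∃[ n₀ ] ∀ i → n₀ ≤ i → 0ℚ ℚ.< g i
  conclude (n₀ , Q>0) = n₀ ℕ.+ suc (δ k n m) , λ i n₀+δ<i →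
    let s = toℕ (Fin.fromℕ< (m%n<n i L))
        i≡s = divides (i / L) (trans (cong (ℕ.∣ i -_∣) (Fin.toℕ-fromℕ< (m%n<n i L)))
                (trans (cong (ℕ.∣_- i % L ∣) (m≡m%n+[m/n]*n i L))
                (trans (ℕ.∣-∣-comm (i % L ℕ.+ i / L ℕ.* L) (i % L)) (ℕ.∣m-m+n∣≡n (i % L) (i / L ℕ.* L)))))
    in subst (0ℚ ℚ.<_) (sym (Q-correct n≤m s i (ℕ.m+n≤o⇒n≤o n₀ n₀+δ<i) i≡s))
         (Q>0 i (ℕ.m+n≤o⇒m≤o n₀ n₀+δ<i) (Fin.fromℕ< (m%n<n i L)))

positive⇒≢0 : ∀ {q} → 0ℚ ℚ.< q → q ≢ 0ℚ
positive⇒≢0 0<q q≡0 = ℚ.<⇒≢ 0<q (sym q≡0)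

theorem1p5 :
    (k N M : ℕ) .{{_ : NonZero k}} .{{_ : NonZero N}} .{{_ : NonZero M}} → N ≤ M →
    (Σ[ Q ∈ (Fin (Λ k N M) → Polynomial) ]
        ((r : Fin (Λ k N M)) → DegreeAtMost (M ∸ 1) (Q r))
      × ((r : Fin (Λ k N M)) (n : ℕ) → Δ k N M ℤ.< + n → n ≡ toℕ r mod Λ k N M →
           c k N M n ≡ eval (Q r) (fromℕ n))
      × (N < M →
           (r : Fin (Λ k N M)) → HasLeadingTerm (Q r) (M ∸ 1) (leading k M))
      × (M ≡ N → 2 ≤ N → 2 ∣ k →
           (r : Fin (Λ k N M)) → HasLeadingTerm (Q r) (N ∸ 1) (leading k N))
      × (M ≡ N → 2 ≤ N → 1 < k → 2 ∤ k →
           ((r : Fin (Λ k N M)) → HasLeadingTerm (Q r) (N ∸ 1) (leadingAlternating k N (toℕ r)))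
           × ((s : ℕ) → 0ℚ ℚ.< leadingAlternating k N s)))
    -- 2 ≤ M excludes only N = M = 1, where G = x/(1-x) + 1/(1+x^k): for k > 1
    -- its coefficients vanish at every odd multiple of k.
    × (¬ (M ≡ N × k ≡ 1) → 2 ≤ M →
         ∃[ n₀ ] ((n : ℕ) → n₀ ≤ n → 0ℚ ℚ.< c k N M n))
    × (M ≡ N → k ≡ 1 →
         (n : ℕ) → (2 ∤ n → c k N M n ≡ 0ℚ) × (2 ∣ n → 0ℚ ℚ.< c k N M n))
theorem1p5 k (suc n) (suc m) (s≤s n≤m) =
  ( Q ∘ toℕ
  , (λ r → Q-degree (toℕ r))
  , (λ r i Δ<i i≡r → Q-correct n≤m (toℕ r) i (ℤ.drop‿+<+ (subst (ℤ._< + i) (Δ≡δ k n m) Δ<i)) i≡r)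
  , (λ N<M r → Q-degree (toℕ r) , case-< N<M (toℕ r) , positive⇒≢0 (leading-positive k (suc m)))
  , (λ { refl 2≤N 2∣k r → Q-degree (toℕ r) , case-even refl 2≤N 2∣k (toℕ r)
                        , positive⇒≢0 (leading-positive k (suc n)) })
  , (λ { refl 2≤N 1<k 2∤k →
         (λ r → Q-degree (toℕ r) , case-odd refl 2≤N 2∤k (toℕ r)
              , positive⇒≢0 (leadingAlternating-positive k n 1<k (toℕ r)))
         , leadingAlternating-positive k n 1<k })
  )
  , positive
  , λ { refl refl → G-even n }
  where
  open Fixed k n m
  case-< : suc n < suc m → ∀ s → coeff (Q s) m ≡ leading k (suc m)
  case-< (s≤s n<m) = coeff-leading n≤m ([1-x]h-finite-< n<m)
  2≤⇒ : 2 ≤ suc n → ∃[ n′ ] n ≡ suc n′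
  2≤⇒ (s≤s (s≤s {n = n′} _)) = n′ , refl
  case-even : n ≡ m → 2 ≤ suc n → 2 ∣ k → ∀ s → coeff (Q s) m ≡ leading k (suc m)
  case-even n≡m 2≤N 2∣k = coeff-leading n≤m ([1-x]h-finite-even (proj₂ (2≤⇒ 2≤N)) n≡m 2∣k)
  case-odd : n ≡ m → 2 ≤ suc n → 2 ∤ k → ∀ s → coeff (Q s) m ≡ leadingAlternating k (suc m) s
  case-odd n≡m 2≤N 2∤k = coeff-leadingAlternating n≡m (odd⇒2∣suc k 2∤k) ([1-x²]h-finite (proj₂ (2≤⇒ 2≤N)) n≡m)
  from-coeff : ∀ v → (∀ s → coeff (Q s) m ≡ v s) → (∀ s → 0ℚ ℚ.< v s) →
    ∃[ n₀ ] ((i : ℕ) → n₀ ≤ i → 0ℚ ℚ.< c k (suc n) (suc m) i)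
  from-coeff v coeff≡v v>0 = eventually-positive k n m n≤m λ s → subst (0ℚ ℚ.<_) (sym (coeff≡v s)) (v>0 s)
  positive : ¬ (suc m ≡ suc n × k ≡ 1) → 2 ≤ suc m →
    ∃[ n₀ ] ((i : ℕ) → n₀ ≤ i → 0ℚ ℚ.< c k (suc n) (suc m) i)
  positive k≢1 2≤M with ℕ.m≤n⇒m<n∨m≡n n≤m | 2 ∣? k
  ... | inj₁ n<m | _       = from-coeff (λ _ → leading k (suc m)) (case-< (s≤s n<m)) λ _ → leading-positive k (suc m)
  ... | inj₂ n≡m | yes 2∣k = from-coeff (λ _ → leading k (suc m))
    (case-even n≡m (subst (λ a → 2 ≤ suc a) (sym n≡m) 2≤M) 2∣k) λ _ → leading-positive k (suc m)
  -- With `N = M` the excluded case leaves only `k ≠ 1`, hence `1 < k`, and then the alternating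
  -- coefficient is positive in both parity classes.
  ... | inj₂ n≡m | no  2∤k = from-coeff (λ s → leadingAlternating k (suc m) s)
    (case-odd n≡m (subst (λ a → 2 ≤ suc a) (sym n≡m) 2≤M) 2∤k)
    (leadingAlternating-positive k m (ℕ.≤∧≢⇒< (ℕ.>-nonZero⁻¹ k) λ 1≡k → k≢1 (cong suc (sym n≡m) , sym 1≡k)))
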